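{- For $N\in\mathbb{N}$ let $\mathcal{H}_{2AP}=([N],\mathcal{E}_{2AP})$ be the hypergraph of sums of two arithmetic progressions in $[N]$. Then, as $N\to\infty$, (i) $\operatorname{disc}(\mathcal{H}_{2AP})=\Omega(N^{1/2})$, and (ii) $\operatorname{disc}(\mathcal{H}_{2AP})=O(N^{1/2}\log^{1/2}N)$. That is, there exist absolute constants $c,C>0$ and $N_0\in\mathbb{N}$ such that for all $N\ge N_0$ one has $c\,N^{1/2}\le \operatorname{disc}(\mathcal{H}_{2AP})\le C\,N^{1/2}(\log N)^{1/2}$.
   Context: For $N\in\mathbb{N}$, $[N]=\{1,2,\dots,N\}$. For $a\in\mathbb{Z}$ and $\delta,L\in\mathbb{N}$ (positive integers), let $A_{a,\delta,L}=\{a+j\delta : j\in\mathbb{Z},\ 0\le j\le L-1\}$. For sets $M_1,M_2\subseteq\mathbb{Z}$, $M_1+M_2=\{m_1+m_2 : m_1\in M_1,\ m_2\in M_2\}$. The hypergraph $\mathcal{H}_{2AP}=([N],\mathcal{E}_{2AP})$ has vertex set $[N]$ and hyperedge set $$\mathcal{E}_{2AP}=\{(A_{a_1,\delta_1,L_1}+A_{a_2,\delta_2,L_2})\cap[N] : a_1,a_2\in\mathbb{Z},\ \delta_1,\delta_2,L_1,L_2\in[N]\}.$$ For a finite hypergraph $\mathcal{H}=(V,\mathcal{E})$ (a finite set $V$ and a set $\mathcal{E}$ of subsets of $V$) and a coloring $\chi\colon V\to\{ -1,1\}$, put $\chi(E)=\sum_{x\in E}\chi(x)$ for $E\in\mathcal{E}$,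 $\operatorname{disc}(\mathcal{H},\chi)=\max_{E\in\mathcal{E}}|\chi(E)|$, and $\operatorname{disc}(\mathcal{H})=\min_{\chi\colon V\to\{ -1,1\}}\operatorname{disc}(\mathcal{H},\chi)$. -}

module Defs where

open import Algebra.Properties.CommutativeMonoid.Sum using (sum)
open import Data.Bool using (if_then_else_)
open import Data.Fin using (Fin; toℕ)
open import Data.Fin.Subset using (Subset) renaming (_∈_ to _∈ₛ_)
open import Data.Integer as ℤ using (ℤ; +_; 0ℤ; _◃_; ∣_∣)
open import Data.Integer.Properties using (+-0-commutativeMonoid)
open import Data.Nat using (ℕ; suc; _≤_; _<_; _*_; _^_)
open import Data.Product using (_×_; ∃-syntax)
open import Data.Rational using (ℚ; ↥_; ↧ₙ_)
open import Data.Sign using (Sign)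
open import Data.Vec using (lookup)
open import Function.Bundles using (_⇔_)
open import Level using (0ℓ)
open import Relation.Binary.PropositionalEquality using (_≡_)
open import Relation.Unary using (Pred; _∈_)

IsMax IsMin : Pred ℕ 0ℓ → Pred ℕ 0ℓ
IsMax S m = m ∈ S × (∀ k → k ∈ S → k ≤ m)
IsMin S m = m ∈ S × (∀ k → k ∈ S → m ≤ k)

record Hypergraph : Set₁ where
  field
    order : ℕ
    Edge  : Pred (Subset order) 0ℓ

open Hypergraph public

-- The sign s stands for the colour s ◃ 1 ∈ {-1, 1}.
Coloring : ℕ → Set
Coloring n = Fin n → Sign

colorSum : ∀ {n} → Coloring n → Subset n → ℤ
colorSum χ E = sum +-0-commutativeMonoid (λ x → if lookup E x then χ x ◃ 1 else 0ℤ)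

-- IsDiscOf H χ k says disc(H, χ) = k, and IsDisc H d says disc(H) = d.
IsDiscOf : (H : Hypergraph) → Coloring (order H) → Pred ℕ 0ℓ
IsDiscOf H χ = IsMax (λ k → ∃[ E ] (Edge H E × k ≡ ∣ colorSum χ E ∣))

IsDisc : Hypergraph → Pred ℕ 0ℓ
IsDisc H = IsMin (λ k → ∃[ χ ] IsDiscOf H χ k)

AP : ℤ → ℕ → ℕ → Pred ℤ 0ℓ
AP a δ L m = ∃[ j ] (j < L × m ≡ a ℤ.+ (+ j) ℤ.* (+ δ))

infixl 6 _⊕_
_⊕_ : Pred ℤ 0ℓ → Pred ℤ 0ℓ → Pred ℤ 0ℓ
(M₁ ⊕ M₂) m = ∃[ m₁ ] ∃[ m₂ ] (m₁ ∈ M₁ × m₂ ∈ M₂ × m ≡ m₁ ℤ.+ m₂)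

infix 4 _∈[_]
_∈[_] : ℕ → ℕ → Set
k ∈[ N ] = 1 ≤ k × k ≤ N

-- E = M ∩ {1, …, N}, where x : Fin N stands for the integer 1 + toℕ x.
IsTrace : ∀ {N} → Pred ℤ 0ℓ → Subset N → Set
IsTrace M E = ∀ x → (x ∈ₛ E) ⇔ (+ suc (toℕ x) ∈ M)

H2AP : ℕ → Hypergraph
H2AP N = record
  { order = N
  ; Edge  = λ E →
      ∃[ a₁ ] ∃[ a₂ ] ∃[ δ₁ ] ∃[ δ₂ ] ∃[ L₁ ] ∃[ L₂ ]
        ( δ₁ ∈[ N ] × δ₂ ∈[ N ] × L₁ ∈[ N ] × L₂ ∈[ N ]
        × IsTrace (AP a₁ δ₁ L₁ ⊕ AP a₂ δ₂ L₂) E )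
  }

-- For c = p/q > 0:  c √N ≤ d  iff  p² N ≤ q² d².
_·√_≤_ : ℚ → ℕ → ℕ → Set
c ·√ N ≤ d = p * p * N ≤ q * q * (d * d)
  where
  p = ∣ ↥ c ∣
  q = ↧ₙ c

-- For C = p/q > 0 and M ≥ 1:  d ≤ C √(N log₂ M)  iff  q² d² ≤ p² N log₂ M
-- iff  2 ^ (q² d²) ≤ M ^ (p² N).  Another base of the logarithm only rescales C.
_≤_·√[_·log₂_] : ℕ → ℚ → ℕ → ℕ → Set
d ≤ C ·√[ N ·log₂ M ] = 2 ^ (q * q * (d * d)) ≤ M ^ (p * p * N)
  where
  p = ∣ ↥ C ∣
  q = ↧ₙ C

{-# OPTIONS --safe #-}

-- Upper bound: there are at most N⁷ hyperedges, and a greedy (derandomised) choice of the colours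
-- keeps the sum over all hyperedges E and signs s of ∏_{x ∈ E} (1 + s χ(x) / m) at most its
-- average.  With m² ≈ N / log N no hyperedge can then have discrepancy above O(m log N).
--
-- Lower bound: let q be a power of two with N ≤ q ≤ 2N and h a smooth function on ℤ / q with
-- h(y + q/2) = - h(y).  The functions x ↦ h(r x + b), for r and b modulo q, satisfy the exact
-- Parseval identity ∑_{r,b} (∑_x χ(x) h(r x + b))² = q ‖h‖² N, because for 0 < d < q some multiple
-- e d is an odd multiple of q/2, so r ↦ r + e flips the sign of the autocorrelation of h at r d.
-- Hence some r, b give a sum of order √N ‖h‖_∞.  On the other hand the points (x , y) with
-- y ≡ r x mod q form a lattice, and a reduced basis splits the relevant points into boundedly many
-- parallelograms whose projections to x are proper sums of two arithmetic progressions; summation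
-- by parts in both directions, with h twice differentiable, bounds the same sum by O(disc ‖h‖_∞).
module Submission where

open import Algebra.Bundles using (AbelianGroup)
open import Algebra.Properties.CommutativeMonoid.Sum using (sum; sum-cong-≗)
import Algebra.Properties.Group as GroupProperties
open import Data.Bool using (true; false; if_then_else_)
open import Data.Empty using (⊥; ⊥-elim)
open import Data.Fin as Fin using (Fin; toℕ; fromℕ<)
import Data.Fin.Properties as Finₚ
open import Data.Fin.Subset using (Subset)
open import Data.Integer as ℤ using (ℤ; +_; -[1+_]; 0ℤ; 1ℤ; ∣_∣; _◃_)
import Data.Integer.Properties as ℤₚ
open import Data.Integer.Tactic.RingSolver using (solve-∀)
open import Data.List using (List; []; _∷_; length; map; foldr; upTo; cartesianProduct; _++_)
open import Data.List.Membership.Propositional using (_∈_)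
import Data.List.Membership.Propositional.Properties as ∈ₚ
import Data.List.Properties as Listₚ
open import Data.List.Relation.Unary.Any using (here; there)
open import Data.Maybe using (Maybe; just; nothing)
open import Data.Nat as ℕ using (ℕ; zero; suc; _≤_; _<_; _+_; _*_; _^_; _⊔_; z≤n; s≤s; NonZero)
import Data.Nat.Coprimality as Coprimality
open import Data.Nat.Divisibility using (divides; ∣⇒≤; ∣m+n∣m⇒∣n) renaming (_∣_ to _∣ₙ_)
open import Data.Nat.DivMod using (_/_; _%_; m≡m%n+[m/n]*n; m%n<n; m<n⇒m%n≡m; [m+n]%n≡m%n; [m+kn]%n≡m%n)
import Data.Nat.Properties as ℕₚ
import Data.Nat.Tactic.RingSolver as ℕ-Solver
open import Data.Product using (_×_; _,_; ∃-syntax; Σ-syntax; proj₁; proj₂)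
open import Data.Rational as ℚ using (ℚ; 0ℚ; mkℚ; ↥_; ↧ₙ_)
import Data.Rational.Properties as ℚₚ
open import Data.Sign using (Sign)
open import Data.Sum using (_⊎_; inj₁; inj₂)
open import Data.Vec using ([]; _∷_; lookup; tabulate)
open import Data.Vec.Functional using () renaming (_∷_ to _◂_)
import Data.Vec.Properties as Vecₚ
open import Function using (_∘_)
open import Function.Bundles using (_⇔_; mk⇔; Equivalence)
open import Relation.Binary.Definitions using (tri<; tri≈; tri>)
open import Relation.Binary.PropositionalEquality using (_≡_; _≢_; refl; sym; trans; cong; cong₂; subst; subst₂; module ≡-Reasoning)
open import Relation.Nullary using (¬_; Dec; yes; no; does)
open import Relation.Nullary.Decidable using (dec-true; dec-false)
open import Defs

open GroupProperties (AbelianGroup.group ℤₚ.+-0-abelianGroup) using () renaming (∙-cancelˡ to +-cancelˡ)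

-- A hyperedge is a set, so a sum over index pairs (i , j) is a colour sum only if no vertex is hit
-- twice. This dictates the size of the parallelograms, a quarter of the norms in each direction:
-- two points of one parallelogram over the same x would force 4 c < d and 4 a < b, against b d ≤ 2
-- q and a d + b c = q. The basis is reduced so that (a ⊔ b) (c ⊔ d) ≤ 2 q. This keeps the y-extent
-- of a parallelogram of order q along either edge, so that the weight varies there by no more than
-- its own order of magnitude, and it keeps the steps and lengths of the progressions within N. All
-- values stay in ℤ: h is a difference of two translates of a quadratic B-spline, of order q² with
-- first differences of order q and second differences bounded by 8. Second differences enter
-- because summation by parts in two directions produces the mixed difference of the weight. On the
-- Parseval side, a window of length q / 16 on which h is of order q² is enough.

-- Finite integer sums and summation by parts.

∑ : ℕ → (ℕ → ℤ) → ℤ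
∑ zero    f = 0ℤ
∑ (suc n) f = ∑ n f ℤ.+ f n

infixr 8 ∑
syntax ∑ n (λ i → e) = ∑[ i < n ] e

∑-cong : ∀ n {f g : ℕ → ℤ} → (∀ i → i < n → f i ≡ g i) → ∑ n f ≡ ∑ n g
∑-cong zero    h = refl
∑-cong (suc n) h = cong₂ ℤ._+_ (∑-cong n (λ i i<n → h i (ℕₚ.m<n⇒m<1+n i<n))) (h n (ℕₚ.n<1+n n))

∑-ext : ∀ n {f g : ℕ → ℤ} → (∀ i → f i ≡ g i) → ∑ n f ≡ ∑ n g
∑-ext n h = ∑-cong n (λ i _ → h i)

∑-0 : ∀ n {f : ℕ → ℤ} → (∀ i → i < n → f i ≡ 0ℤ) → ∑ n f ≡ 0ℤ
∑-0 zero    h = refl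
∑-0 (suc n) h = cong₂ ℤ._+_ (∑-0 n (λ i i<n → h i (ℕₚ.m<n⇒m<1+n i<n))) (h n (ℕₚ.n<1+n n))

∑-+ : ∀ n (f g : ℕ → ℤ) → ∑[ i < n ] (f i ℤ.+ g i) ≡ ∑ n f ℤ.+ ∑ n g
∑-+ zero    f g = refl
∑-+ (suc n) f g = trans (cong (ℤ._+ (f n ℤ.+ g n)) (∑-+ n f g))
                        (interchange (∑ n f) (∑ n g) (f n) (g n))
  where
  interchange : ∀ a b c d → (a ℤ.+ b) ℤ.+ (c ℤ.+ d) ≡ (a ℤ.+ c) ℤ.+ (b ℤ.+ d)
  interchange = solve-∀

∑-*ˡ : ∀ n k (f : ℕ → ℤ) → ∑[ i < n ] (k ℤ.* f i) ≡ k ℤ.* ∑ n f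
∑-*ˡ zero    k f = sym (ℤₚ.*-zeroʳ k)
∑-*ˡ (suc n) k f = trans (cong (ℤ._+ (k ℤ.* f n)) (∑-*ˡ n k f))
                         (sym (ℤₚ.*-distribˡ-+ k (∑ n f) (f n)))

∑-*ʳ : ∀ n k (f : ℕ → ℤ) → ∑[ i < n ] (f i ℤ.* k) ≡ ∑ n f ℤ.* k
∑-*ʳ n k f = trans (∑-ext n (λ i → ℤₚ.*-comm (f i) k))
                   (trans (∑-*ˡ n k f) (ℤₚ.*-comm k (∑ n f)))

∑-neg : ∀ n (f : ℕ → ℤ) → ∑[ i < n ] (ℤ.- f i) ≡ ℤ.- ∑ n f
∑-neg zero    f = refl
∑-neg (suc n) f = trans (cong (ℤ._+ (ℤ.- f n)) (∑-neg n f))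
                        (sym (ℤₚ.neg-distrib-+ (∑ n f) (f n)))

∑-- : ∀ n (f g : ℕ → ℤ) → ∑[ i < n ] (f i ℤ.- g i) ≡ ∑ n f ℤ.- ∑ n g
∑-- n f g = trans (∑-+ n f (λ i → ℤ.- g i)) (cong (ℤ._+_ (∑ n f)) (∑-neg n g))

∑-swap : ∀ m n (f : ℕ → ℕ → ℤ) →
         ∑[ i < m ] (∑[ j < n ] f i j) ≡ ∑[ j < n ] (∑[ i < m ] f i j)
∑-swap zero    n f = sym (∑-0 n (λ _ _ → refl))
∑-swap (suc m) n f = trans (cong (ℤ._+ ∑ n (f m)) (∑-swap m n f))
                           (sym (∑-+ n (λ j → ∑[ i < m ] f i j) (f m)))

∑-const : ∀ n k → ∑[ _ < n ] k ≡ + n ℤ.* k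
∑-const zero    k = refl
∑-const (suc n) k = trans (cong (ℤ._+ k) (∑-const n k))
                          (trans (ℤₚ.+-comm (+ n ℤ.* k) k) (sym (ℤₚ.suc-* (+ n) k)))

∑-single : ∀ n {k} {f : ℕ → ℤ} → k < n → (∀ i → i < n → i ≢ k → f i ≡ 0ℤ) → ∑ n f ≡ f k
∑-single (suc n) {k} {f} k<1+n h with k ℕₚ.≟ n
... | yes refl = trans (cong (ℤ._+ f k) (∑-0 n λ i i<n → h i (ℕₚ.m<n⇒m<1+n i<n) (ℕₚ.<⇒≢ i<n)))
                       (ℤₚ.+-identityˡ (f k))
... | no k≢n = trans (cong₂ ℤ._+_ (∑-single n (ℕₚ.≤∧≢⇒< (ℕₚ.≤-pred k<1+n) k≢n)
                                     λ i i<n → h i (ℕₚ.m<n⇒m<1+n i<n))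
                                  (h n (ℕₚ.n<1+n n) (λ n≡k → k≢n (sym n≡k))))
                     (ℤₚ.+-identityʳ (f k))

∑∑-single : ∀ m n {k l} {f : ℕ → ℕ → ℤ} → k < m → l < n →
            (∀ i j → i < m → j < n → (i ≡ k → j ≢ l) → f i j ≡ 0ℤ) →
            ∑[ i < m ] (∑[ j < n ] f i j) ≡ f k l
∑∑-single m n k<m l<n h =
  trans (∑-single m k<m (λ i i<m i≢k → ∑-0 n (λ j j<n → h i j i<m j<n (λ i≡k → ⊥-elim (i≢k i≡k)))))
        (∑-single n l<n (λ j j<n j≢l → h _ j k<m j<n (λ _ → j≢l)))

∑-head : ∀ n (f : ℕ → ℤ) → ∑ (suc n) f ≡ f 0 ℤ.+ ∑[ i < n ] f (suc i)
∑-head zero    f = ℤₚ.+-comm 0ℤ (f 0)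
∑-head (suc n) f = trans (cong (ℤ._+ f (suc n)) (∑-head n f))
                         (ℤₚ.+-assoc (f 0) (∑[ i < n ] f (suc i)) (f (suc n)))

∑-split : ∀ m n (f : ℕ → ℤ) → ∑ (m + n) f ≡ ∑ m f ℤ.+ ∑[ i < n ] f (m + i)
∑-split m zero    f = trans (cong (λ k → ∑ k f) (ℕₚ.+-identityʳ m)) (sym (ℤₚ.+-identityʳ _))
∑-split m (suc n) f = trans (cong (λ k → ∑ k f) (ℕₚ.+-suc m n))
  (trans (cong (ℤ._+ f (m + n)) (∑-split m n f)) (ℤₚ.+-assoc (∑ m f) _ (f (m + n))))

∑-blocks : ∀ k L (f : ℕ → ℤ) → ∑ (k * L) f ≡ ∑[ u < k ] (∑[ i < L ] f (u * L + i))
∑-blocks zero    L f = refl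
∑-blocks (suc k) L f = trans (cong (λ n → ∑ n f) (ℕₚ.+-comm L (k * L)))
  (trans (∑-split (k * L) L f) (cong (ℤ._+ (∑[ i < L ] f (k * L + i))) (∑-blocks k L f)))

-- A sum of q + 1 consecutive terms is split at its first and at its last term; by periodicity these
-- two agree and cancel.
∑-shift : ∀ q e (f : ℕ → ℤ) → (∀ i → f (i + q) ≡ f i) → ∑[ i < q ] f (i + e) ≡ ∑ q f
∑-shift q zero    f per = ∑-ext q (λ i → cong f (ℕₚ.+-identityʳ i))
∑-shift q (suc e) f per = trans (∑-ext q (λ i → cong f (ℕₚ.+-suc i e)))
  (trans (+-cancelˡ (f (0 + e)) _ _ eq) (∑-shift q e f per))
  where
  eq : f (0 + e) ℤ.+ ∑[ i < q ] f (suc (i + e)) ≡ f (0 + e) ℤ.+ ∑[ i < q ] f (i + e)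
  eq = trans (sym (∑-head q (λ i → f (i + e))))
       (trans (cong (ℤ._+_ (∑[ i < q ] f (i + e))) (trans (cong f (ℕₚ.+-comm q e)) (per e)))
              (ℤₚ.+-comm _ (f e)))

∑-∣∣ : ∀ n {B} (f : ℕ → ℤ) → (∀ i → i < n → ∣ f i ∣ ≤ B) → ∣ ∑ n f ∣ ≤ n * B
∑-∣∣ zero        f h = z≤n
∑-∣∣ (suc n) {B} f h = ℕₚ.≤-trans (ℤₚ.∣i+j∣≤∣i∣+∣j∣ (∑ n f) (f n))
  (ℕₚ.≤-trans (ℕₚ.+-mono-≤ (∑-∣∣ n f (λ i i<n → h i (ℕₚ.m<n⇒m<1+n i<n))) (h n (ℕₚ.n<1+n n)))
              (ℕₚ.≤-reflexive (ℕₚ.+-comm (n * B) B)))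

∑-mono : ∀ n {f g : ℕ → ℤ} → (∀ i → i < n → f i ℤ.≤ g i) → ∑ n f ℤ.≤ ∑ n g
∑-mono zero    h = ℤₚ.≤-refl
∑-mono (suc n) h = ℤₚ.+-mono-≤ (∑-mono n (λ i i<n → h i (ℕₚ.m<n⇒m<1+n i<n))) (h n (ℕₚ.n<1+n n))

∑-abel : ∀ n (f φ : ℕ → ℤ) →
         ∑[ i < n ] (f i ℤ.* φ i) ≡
         ∑ n f ℤ.* φ n ℤ.- ∑[ i < n ] (∑ (suc i) f ℤ.* (φ (suc i) ℤ.- φ i))
∑-abel zero    f φ = refl
∑-abel (suc n) f φ = trans (cong (ℤ._+ (f n ℤ.* φ n)) (∑-abel n f φ))
  (step (∑ n f) (f n) (φ n) (φ (suc n)) (∑[ i < n ] (∑ (suc i) f ℤ.* (φ (suc i) ℤ.- φ i))))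
  where
  step : ∀ s x p p′ r → (s ℤ.* p ℤ.- r) ℤ.+ x ℤ.* p ≡
         (s ℤ.+ x) ℤ.* p′ ℤ.- (r ℤ.+ (s ℤ.+ x) ℤ.* (p′ ℤ.- p))
  step = solve-∀

∣-∣-mono : ∀ i j {m n} → ∣ i ∣ ≤ m → ∣ j ∣ ≤ n → ∣ i ℤ.- j ∣ ≤ m + n
∣-∣-mono i j p q = ℕₚ.≤-trans (ℤₚ.∣i-j∣≤∣i∣+∣j∣ i j) (ℕₚ.+-mono-≤ p q)

∣*∣-mono : ∀ i j {m n} → ∣ i ∣ ≤ m → ∣ j ∣ ≤ n → ∣ i ℤ.* j ∣ ≤ m * n
∣*∣-mono i j p q = ℕₚ.≤-trans (ℕₚ.≤-reflexive (ℤₚ.abs-* i j)) (ℕₚ.*-mono-≤ p q)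

∑-abel-bound : ∀ n (f φ : ℕ → ℤ) {D V₀ V₁} →
               (∀ m → m ≤ n → ∣ ∑ m f ∣ ≤ D) →
               ∣ φ n ∣ ≤ V₀ → (∀ i → ∣ φ (suc i) ℤ.- φ i ∣ ≤ V₁) →
               ∣ ∑[ i < n ] (f i ℤ.* φ i) ∣ ≤ D * V₀ + n * (D * V₁)
∑-abel-bound n f φ hf h₀ h₁ rewrite ∑-abel n f φ =
  ∣-∣-mono (∑ n f ℤ.* φ n) (∑[ i < n ] (∑ (suc i) f ℤ.* (φ (suc i) ℤ.- φ i)))
    (∣*∣-mono (∑ n f) (φ n) (hf n ℕₚ.≤-refl) h₀)
    (∑-∣∣ n _ (λ i i<n → ∣*∣-mono (∑ (suc i) f) (φ (suc i) ℤ.- φ i) (hf (suc i) i<n) (h₁ i)))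

-- Summation by parts in i, then in j on each resulting sum. Only partial sums over rectangles
-- anchored at the corner appear, and these are again parts of the same block.
∑∑-abel-bound : ∀ m n (f φ : ℕ → ℕ → ℤ) {D V₀₀ V₀₁ V₁₀ V₁₁} →
  (∀ k l → k ≤ m → l ≤ n → ∣ ∑[ i < k ] (∑[ j < l ] f i j) ∣ ≤ D) →
  (∀ i j → ∣ φ i j ∣ ≤ V₀₀) →
  (∀ i j → ∣ φ i (suc j) ℤ.- φ i j ∣ ≤ V₀₁) →
  (∀ i j → ∣ φ (suc i) j ℤ.- φ i j ∣ ≤ V₁₀) →
  (∀ i j → ∣ (φ (suc i) (suc j) ℤ.- φ i (suc j)) ℤ.- (φ (suc i) j ℤ.- φ i j) ∣ ≤ V₁₁) →
  ∣ ∑[ i < m ] (∑[ j < n ] (f i j ℤ.* φ i j)) ∣ ≤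
    (D * V₀₀ + n * (D * V₀₁)) + m * (D * V₁₀ + n * (D * V₁₁))
∑∑-abel-bound m n f φ {D} {V₀₀} {V₀₁} {V₁₀} {V₁₁} hf h₀₀ h₀₁ h₁₀ h₁₁ =
  subst (λ z → ∣ z ∣ ≤ (D * V₀₀ + n * (D * V₀₁)) + m * (D * V₁₀ + n * (D * V₁₁))) (sym eq)
    (∣-∣-mono (∑[ j < n ] (col m j ℤ.* φ m j)) (∑[ i < m ] (∑[ j < n ] (col (suc i) j ℤ.* dφ i j)))
      (∑-abel-bound n (col m) (φ m) (λ l l≤n → partial m l ℕₚ.≤-refl l≤n) (h₀₀ m n) (h₀₁ m))
      (∑-∣∣ m _ λ i i<m → ∑-abel-bound n (col (suc i)) (dφ i)
        (λ l l≤n → partial (suc i) l i<m l≤n) (h₁₀ i n) (h₁₁ i)))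
  where
  col : ℕ → ℕ → ℤ
  col k j = ∑[ i < k ] f i j
  dφ : ℕ → ℕ → ℤ
  dφ i j = φ (suc i) j ℤ.- φ i j
  partial : ∀ k l → k ≤ m → l ≤ n → ∣ ∑[ j < l ] col k j ∣ ≤ D
  partial k l k≤m l≤n = subst (λ z → ∣ z ∣ ≤ D) (∑-swap k l f) (hf k l k≤m l≤n)
  eq : ∑[ i < m ] (∑[ j < n ] (f i j ℤ.* φ i j)) ≡
       ∑[ j < n ] (col m j ℤ.* φ m j) ℤ.- ∑[ i < m ] (∑[ j < n ] (col (suc i) j ℤ.* dφ i j))
  eq = trans (∑-swap m n (λ i j → f i j ℤ.* φ i j))
       (trans (∑-ext n (λ j → ∑-abel m (λ i → f i j) (λ i → φ i j)))
       (trans (∑-- n (λ j → col m j ℤ.* φ m j) (λ j → ∑[ i < m ] (col (suc i) j ℤ.* dφ i j)))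
              (cong (ℤ._-_ (∑[ j < n ] (col m j ℤ.* φ m j)))
                    (sym (∑-swap m n (λ i j → col (suc i) j ℤ.* dφ i j))))))

-- Step bounds and the quadratic B-spline.

∣+∣-mono : ∀ i j {m n} → ∣ i ∣ ≤ m → ∣ j ∣ ≤ n → ∣ i ℤ.+ j ∣ ≤ m + n
∣+∣-mono i j p q = ℕₚ.≤-trans (ℤₚ.∣i+j∣≤∣i∣+∣j∣ i j) (ℕₚ.+-mono-≤ p q)

steps⇒Lipschitz : ∀ (g : ℤ → ℤ) {W} → (∀ z → ∣ g (z ℤ.+ 1ℤ) ℤ.- g z ∣ ≤ W) →
                  ∀ n z → ∣ g (z ℤ.+ + n) ℤ.- g z ∣ ≤ n * W
steps⇒Lipschitz g     h zero    z rewrite ℤₚ.+-identityʳ z | ℤₚ.+-inverseʳ (g z) = z≤n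
steps⇒Lipschitz g {W} h (suc n) z = subst (λ y → ∣ y ∣ ≤ W + n * W) (sym eq)
  (∣+∣-mono (g (z ℤ.+ + n ℤ.+ 1ℤ) ℤ.- g (z ℤ.+ + n)) (g (z ℤ.+ + n) ℤ.- g z)
            (h (z ℤ.+ + n)) (steps⇒Lipschitz g h n z))
  where
  shift : ∀ a b → a ℤ.+ (1ℤ ℤ.+ b) ≡ a ℤ.+ b ℤ.+ 1ℤ
  shift = solve-∀
  telescope : ∀ a b c → a ℤ.- c ≡ (a ℤ.- b) ℤ.+ (b ℤ.- c)
  telescope = solve-∀
  eq : g (z ℤ.+ + suc n) ℤ.- g z ≡
       (g (z ℤ.+ + n ℤ.+ 1ℤ) ℤ.- g (z ℤ.+ + n)) ℤ.+ (g (z ℤ.+ + n) ℤ.- g z)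
  eq = trans (cong (λ y → g y ℤ.- g z) (shift z (+ n)))
             (telescope (g (z ℤ.+ + n ℤ.+ 1ℤ)) (g (z ℤ.+ + n)) (g z))

steps⇒bounded : ∀ (g : ℤ → ℤ) {W Q} → (∀ z → ∣ g (z ℤ.+ 1ℤ) ℤ.- g z ∣ ≤ W) →
                (∀ z → z ℤ.≤ 0ℤ → g z ≡ 0ℤ) → (∀ n → Q ≤ n → g (+ n) ≡ 0ℤ) →
                ∀ z → ∣ g z ∣ ≤ Q * W
steps⇒bounded g         h early late -[1+ n ] rewrite early -[1+ n ] ℤ.-≤+ = z≤n
steps⇒bounded g {W} {Q} h early late (+ n) with ℕₚ.≤-total Q n
... | inj₁ Q≤n rewrite late n Q≤n = z≤n
... | inj₂ n≤Q = ℕₚ.≤-trans (subst (λ y → ∣ y ∣ ≤ n * W) eq (steps⇒Lipschitz g h n 0ℤ))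
                            (ℕₚ.*-monoˡ-≤ W n≤Q)
  where
  eq : g (0ℤ ℤ.+ + n) ℤ.- g 0ℤ ≡ g (+ n)
  eq = trans (cong (ℤ._-_ (g (+ n))) (early 0ℤ ℤₚ.≤-refl)) (ℤₚ.+-identityʳ (g (+ n)))

-- `pos` and `tri` are the discrete truncated powers of degree one and two, normalised so that the
-- forward difference of `tri` is exactly `pos`, also across 0.
pos : ℤ → ℤ
pos (+ n)    = + n
pos -[1+ _ ] = 0ℤ

triangular : ℕ → ℕ
triangular zero    = 0
triangular (suc n) = n + triangular n

tri : ℤ → ℤ
tri (+ n)    = + triangular n
tri -[1+ _ ] = 0ℤ

pos-early : ∀ z → z ℤ.≤ 0ℤ → pos z ≡ 0ℤ
pos-early (+ zero) _                = refl
pos-early (+ suc n) (ℤ.+≤+ ())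
pos-early -[1+ n ] _                = refl

tri-early : ∀ z → z ℤ.≤ 0ℤ → tri z ≡ 0ℤ
tri-early (+ zero) _                = refl
tri-early (+ suc n) (ℤ.+≤+ ())
tri-early -[1+ n ] _                = refl

tri-step : ∀ z → tri (z ℤ.+ 1ℤ) ℤ.- tri z ≡ pos z
tri-step (+ n) rewrite ℕₚ.+-comm n 1 = cancel (+ n) (+ triangular n)
  where
  cancel : ∀ a b → a ℤ.+ b ℤ.- b ≡ a
  cancel = solve-∀
tri-step -[1+ zero ]  = refl
tri-step -[1+ suc n ] = refl

pos-step : ∀ z → ∣ pos (z ℤ.+ 1ℤ) ℤ.- pos z ∣ ≤ 1
pos-step (+ n) rewrite ℕₚ.+-comm n 1 = ℕₚ.≤-reflexive (cong ∣_∣ (cancel (+ n)))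
  where
  cancel : ∀ a → 1ℤ ℤ.+ a ℤ.- a ≡ 1ℤ
  cancel = solve-∀
pos-step -[1+ zero ]  = z≤n
pos-step -[1+ suc n ] = z≤n

2triangular : ∀ n → + 2 ℤ.* + triangular n ≡ + n ℤ.* (+ n ℤ.- 1ℤ)
2triangular zero    = refl
2triangular (suc n) = trans (ℤₚ.*-distribˡ-+ (+ 2) (+ n) (+ triangular n))
  (trans (cong (ℤ._+_ (+ 2 ℤ.* + n)) (2triangular n)) (expand (+ n)))
  where
  expand : ∀ a → + 2 ℤ.* a ℤ.+ a ℤ.* (a ℤ.- 1ℤ) ≡ (1ℤ ℤ.+ a) ℤ.* (1ℤ ℤ.+ a ℤ.- 1ℤ)
  expand = solve-∀

module _ (s : ℕ) where

  -- Third backward difference with step `s`. It kills polynomials of degree at most two, so it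
  -- turns a truncated power into a function supported in [0 , 3 s].
  thirdDifference : (ℤ → ℤ) → ℤ → ℤ
  thirdDifference g z =
    (g z ℤ.- + 3 ℤ.* g (z ℤ.- + s)) ℤ.+
    (+ 3 ℤ.* g (z ℤ.- + (s + s)) ℤ.- g (z ℤ.- + (s + (s + s))))

  private
    commute : ∀ a b → a ℤ.+ 1ℤ ℤ.- b ≡ a ℤ.- b ℤ.+ 1ℤ
    commute = solve-∀

  thirdDifference-step : ∀ (g g′ : ℤ → ℤ) → (∀ z → g (z ℤ.+ 1ℤ) ℤ.- g z ≡ g′ z) →
    ∀ z → thirdDifference g (z ℤ.+ 1ℤ) ℤ.- thirdDifference g z ≡ thirdDifference g′ z
  thirdDifference-step g g′ h z
    rewrite commute z (+ s) | commute z (+ (s + s)) | commute z (+ (s + (s + s)))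
          | sym (h z) | sym (h (z ℤ.- + s)) | sym (h (z ℤ.- + (s + s)))
          | sym (h (z ℤ.- + (s + (s + s))))
    = linear (g (z ℤ.+ 1ℤ)) (g (z ℤ.- + s ℤ.+ 1ℤ)) (g (z ℤ.- + (s + s) ℤ.+ 1ℤ))
             (g (z ℤ.- + (s + (s + s)) ℤ.+ 1ℤ))
             (g z) (g (z ℤ.- + s)) (g (z ℤ.- + (s + s))) (g (z ℤ.- + (s + (s + s))))
    where
    linear : ∀ a b c d a′ b′ c′ d′ →
      (a ℤ.- + 3 ℤ.* b) ℤ.+ (+ 3 ℤ.* c ℤ.- d) ℤ.- ((a′ ℤ.- + 3 ℤ.* b′) ℤ.+ (+ 3 ℤ.* c′ ℤ.- d′)) ≡
      (a ℤ.- a′ ℤ.- + 3 ℤ.* (b ℤ.- b′)) ℤ.+ (+ 3 ℤ.* (c ℤ.- c′) ℤ.- (d ℤ.- d′))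
    linear = solve-∀

  -- 8 = 1 + 3 + 3 + 1 is the sum of the absolute values of the coefficients.
  thirdDifference-bound : ∀ (g : ℤ → ℤ) → (∀ z → ∣ g z ∣ ≤ 1) → ∀ z → ∣ thirdDifference g z ∣ ≤ 8
  thirdDifference-bound g h z =
    ∣+∣-mono (g z ℤ.- + 3 ℤ.* g z₁) (+ 3 ℤ.* g z₂ ℤ.- g z₃)
      (∣-∣-mono (g z) (+ 3 ℤ.* g z₁) (h z) (∣*∣-mono (+ 3) (g z₁) ℕₚ.≤-refl (h z₁)))
      (∣-∣-mono (+ 3 ℤ.* g z₂) (g z₃) (∣*∣-mono (+ 3) (g z₂) ℕₚ.≤-refl (h z₂)) (h z₃))
    where
    z₁ = z ℤ.- + s
    z₂ = z ℤ.- + (s + s)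
    z₃ = z ℤ.- + (s + (s + s))

  thirdDifference-early : ∀ (g : ℤ → ℤ) → (∀ z → z ℤ.≤ 0ℤ → g z ≡ 0ℤ) →
                          ∀ z → z ℤ.≤ + s → thirdDifference g z ≡ g z
  thirdDifference-early g h z z≤s
    rewrite h (z ℤ.- + s) (ℤₚ.i≤j⇒i-j≤0 z≤s)
          | h (z ℤ.- + (s + s)) (ℤₚ.i≤j⇒i-j≤0 (ℤₚ.≤-trans z≤s (ℤ.+≤+ (ℕₚ.m≤m+n s s))))
          | h (z ℤ.- + (s + (s + s))) (ℤₚ.i≤j⇒i-j≤0 (ℤₚ.≤-trans z≤s (ℤ.+≤+ (ℕₚ.m≤m+n s (s + s)))))
    = trans (ℤₚ.+-identityʳ _) (ℤₚ.+-identityʳ (g z))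

  private
    sub₁ : ∀ a n → a ℤ.+ (a ℤ.+ a) ℤ.+ n ℤ.- a ≡ a ℤ.+ a ℤ.+ n
    sub₁ = solve-∀
    sub₂ : ∀ a n → a ℤ.+ (a ℤ.+ a) ℤ.+ n ℤ.- (a ℤ.+ a) ≡ a ℤ.+ n
    sub₂ = solve-∀
    sub₃ : ∀ a n → a ℤ.+ (a ℤ.+ a) ℤ.+ n ℤ.- (a ℤ.+ (a ℤ.+ a)) ≡ n
    sub₃ = solve-∀

  pos-late : ∀ n → s + (s + s) ≤ n → thirdDifference pos (+ n) ≡ 0ℤ
  pos-late n 3s≤n with ℕₚ.m≤n⇒∃[o]m+o≡n 3s≤n
  ... | k , refl rewrite sub₁ (+ s) (+ k) | sub₂ (+ s) (+ k) | sub₃ (+ s) (+ k) = vanish (+ s) (+ k)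
    where
    vanish : ∀ a n → (a ℤ.+ (a ℤ.+ a) ℤ.+ n ℤ.- + 3 ℤ.* (a ℤ.+ a ℤ.+ n)) ℤ.+
             (+ 3 ℤ.* (a ℤ.+ n) ℤ.- n) ≡ 0ℤ
    vanish = solve-∀

  tri-late : ∀ n → s + (s + s) ≤ n → thirdDifference tri (+ n) ≡ 0ℤ
  tri-late n 3s≤n with ℕₚ.m≤n⇒∃[o]m+o≡n 3s≤n
  ... | k , refl rewrite sub₁ (+ s) (+ k) | sub₂ (+ s) (+ k) | sub₃ (+ s) (+ k) =
    -- Doubling clears the denominator of n (n - 1) / 2, so that only a polynomial identity remains.
    ℤₚ.*-cancelˡ-≡ (+ 2) _ _ (trans (double (t (s + (s + s) + k)) (t (s + s + k)) (t (s + k)) (t k))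
      (trans (cong₂ ℤ._+_
               (cong₂ (λ x y → x ℤ.- + 3 ℤ.* y) (2triangular (s + (s + s) + k)) (2triangular (s + s + k)))
               (cong₂ (λ x y → + 3 ℤ.* x ℤ.- y) (2triangular (s + k)) (2triangular k)))
             (vanish (+ s) (+ k))))
    where
    t : ℕ → ℤ
    t m = + triangular m
    double : ∀ a b c d → + 2 ℤ.* ((a ℤ.- + 3 ℤ.* b) ℤ.+ (+ 3 ℤ.* c ℤ.- d)) ≡
             (+ 2 ℤ.* a ℤ.- + 3 ℤ.* (+ 2 ℤ.* b)) ℤ.+ (+ 3 ℤ.* (+ 2 ℤ.* c) ℤ.- + 2 ℤ.* d)
    double = solve-∀
    vanish : ∀ a n →
      ((a ℤ.+ (a ℤ.+ a) ℤ.+ n) ℤ.* (a ℤ.+ (a ℤ.+ a) ℤ.+ n ℤ.- 1ℤ) ℤ.-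
        + 3 ℤ.* ((a ℤ.+ a ℤ.+ n) ℤ.* (a ℤ.+ a ℤ.+ n ℤ.- 1ℤ))) ℤ.+
      (+ 3 ℤ.* ((a ℤ.+ n) ℤ.* (a ℤ.+ n ℤ.- 1ℤ)) ℤ.- n ℤ.* (n ℤ.- 1ℤ)) ≡ 0ℤ
    vanish = solve-∀

  -- The quadratic B-spline with knots 0, s, 2s, 3s.
  spline slope : ℤ → ℤ
  spline = thirdDifference tri
  slope  = thirdDifference pos

  spline-early : ∀ z → z ℤ.≤ 0ℤ → spline z ≡ 0ℤ
  spline-early z z≤0 = trans (thirdDifference-early tri tri-early z (ℤₚ.≤-trans z≤0 (ℤ.+≤+ z≤n)))
                             (tri-early z z≤0)

  slope-early : ∀ z → z ℤ.≤ 0ℤ → slope z ≡ 0ℤ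
  slope-early z z≤0 = trans (thirdDifference-early pos pos-early z (ℤₚ.≤-trans z≤0 (ℤ.+≤+ z≤n)))
                            (pos-early z z≤0)

  spline-step : ∀ z → spline (z ℤ.+ 1ℤ) ℤ.- spline z ≡ slope z
  spline-step = thirdDifference-step tri pos tri-step

  slope-step-bound : ∀ z → ∣ slope (z ℤ.+ 1ℤ) ℤ.- slope z ∣ ≤ 8
  slope-step-bound z
    rewrite thirdDifference-step pos (λ y → pos (y ℤ.+ 1ℤ) ℤ.- pos y) (λ _ → refl) z
    = thirdDifference-bound (λ y → pos (y ℤ.+ 1ℤ) ℤ.- pos y) pos-step z

  -- Bounds climb from the second difference to the spline: each function vanishes up to 0 and from
  -- 3 s on, so each summation costs a factor 3 s.
  slope-bound : ∀ z → ∣ slope z ∣ ≤ (s + (s + s)) * 8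
  slope-bound = steps⇒bounded slope slope-step-bound slope-early pos-late

  spline-step-bound : ∀ z → ∣ spline (z ℤ.+ 1ℤ) ℤ.- spline z ∣ ≤ (s + (s + s)) * 8
  spline-step-bound z rewrite spline-step z = slope-bound z

  spline-bound : ∀ z → ∣ spline z ∣ ≤ (s + (s + s)) * ((s + (s + s)) * 8)
  spline-bound = steps⇒bounded spline spline-step-bound spline-early tri-late

-- The exact Parseval identity for antiperiodic functions.

even-or-odd : ∀ n → ∃[ s ] (n ≡ s + s ⊎ n ≡ suc (s + s))
even-or-odd zero = 0 , inj₁ refl
even-or-odd (suc n) with even-or-odd n
... | s , inj₁ refl = s , inj₂ refl
... | s , inj₂ refl = suc s , inj₁ (cong suc (sym (ℕₚ.+-suc s s)))

+-self-cancel-< : ∀ m n → m + m < n + n → m < n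
+-self-cancel-< m n m+m<n+n = ℕₚ.≰⇒> λ n≤m → ℕₚ.<⇒≱ m+m<n+n (ℕₚ.+-mono-≤ n≤m n≤m)

-- For odd d the multiplier 2 ^ k works; for d = 2 s the multiplier found for s at half the modulus
-- still works.
multiple-odd-half : ∀ k d → 0 < d → d < 2 ^ k + 2 ^ k → ∃[ e ] ∃[ t ] (e * d ≡ 2 ^ k + t * (2 ^ k + 2 ^ k))
multiple-odd-half k d 0<d d<q with even-or-odd d
... | s , inj₂ refl = 2 ^ k , s , expand (2 ^ k) s
  where
  expand : ∀ a s → a * (1 + (s + s)) ≡ a + s * (a + a)
  expand = ℕ-Solver.solve-∀
multiple-odd-half zero    d () d<q | zero  , inj₁ refl
multiple-odd-half zero    d 0<d d<q | suc s , inj₁ refl = ⊥-elim (ℕₚ.<⇒≱ (+-self-cancel-< (suc s) 1 d<q) (s≤s z≤n))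
multiple-odd-half (suc k) d 0<d d<q | s , inj₁ refl with multiple-odd-half k s (+-self-cancel-< 0 s 0<d) s<
  where
  s< : s < 2 ^ k + 2 ^ k
  s< = subst (s <_) (cong (_+_ (2 ^ k)) (ℕₚ.+-identityʳ (2 ^ k))) (+-self-cancel-< s (2 ^ suc k) d<q)
... | e , t , eq = e , t , trans (ℕₚ.*-distribˡ-+ e s s) (trans (cong₂ _+_ eq eq) (double (2 ^ k) t))
  where
  double : ∀ a t → a + t * (a + a) + (a + t * (a + a)) ≡ 2 * a + t * (2 * a + 2 * a)
  double = ℕ-Solver.solve-∀

i≡-i⇒i≡0 : ∀ i → i ≡ ℤ.- i → i ≡ 0ℤ
i≡-i⇒i≡0 (+ zero) _ = refl

∑-swap₃ : ∀ m n (f : ℕ → ℕ → ℕ → ℤ) l →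
          ∑[ b < l ] ∑[ x < m ] ∑[ y < n ] f b x y ≡ ∑[ x < m ] ∑[ y < n ] ∑[ b < l ] f b x y
∑-swap₃ m n f l = trans (∑-swap l m (λ b x → ∑[ y < n ] f b x y))
                        (∑-ext m (λ x → ∑-swap l n (λ b y → f b x y)))

∑-product : ∀ m n (f g : ℕ → ℤ) → ∑ m f ℤ.* ∑ n g ≡ ∑[ x < m ] ∑[ y < n ] (f x ℤ.* g y)
∑-product m n f g = trans (sym (∑-*ʳ m (∑ n g) f)) (∑-ext m (λ x → sym (∑-*ˡ n (f x) g)))

module Antiperiodic (k : ℕ) (h : ℕ → ℤ) (anti : ∀ n → h (n + 2 ^ k) ≡ ℤ.- h n) where

  private
    M q : ℕ
    M = 2 ^ k
    q = M + M

  periodic : ∀ n → h (n + q) ≡ h n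
  periodic n = trans (cong h (sym (ℕₚ.+-assoc n M M)))
                     (trans (anti (n + M)) (trans (cong ℤ.-_ (anti n)) (ℤₚ.neg-involutive (h n))))

  periodic-* : ∀ t n → h (n + t * q) ≡ h n
  periodic-* zero    n = cong h (ℕₚ.+-identityʳ n)
  periodic-* (suc t) n = trans (cong h (sym (ℕₚ.+-assoc n q (t * q))))
                               (trans (periodic-* t (n + q)) (periodic n))

  antiperiodic-odd : ∀ t n → h (n + (M + t * q)) ≡ ℤ.- h n
  antiperiodic-odd t n = trans (cong h (sym (ℕₚ.+-assoc n M (t * q))))
                               (trans (periodic-* t (n + M)) (anti n))

  autocorrelation : ℕ → ℤ
  autocorrelation n = ∑[ b < q ] (h b ℤ.* h (b + n))

  autocorrelation-periodic : ∀ t n → autocorrelation (n + t * q) ≡ autocorrelation n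
  autocorrelation-periodic t n = ∑-ext q λ b →
    cong (h b ℤ.*_) (trans (cong h (sym (ℕₚ.+-assoc b n (t * q)))) (periodic-* t (b + n)))

  autocorrelation-antiperiodic : ∀ t n → autocorrelation (n + (M + t * q)) ≡ ℤ.- autocorrelation n
  autocorrelation-antiperiodic t n = trans
    (∑-ext q λ b → trans
      (cong (h b ℤ.*_) (trans (cong h (sym (ℕₚ.+-assoc b n (M + t * q)))) (antiperiodic-odd t (b + n))))
      (sym (ℤₚ.neg-distribʳ-* (h b) (h (b + n)))))
    (∑-neg q (λ b → h b ℤ.* h (b + n)))

  -- If e d is an odd multiple of q / 2, then r ↦ r + e permutes the residues and flips every sign.
  autocorrelation-dilates : ∀ d → 0 < d → d < q → ∑[ r < q ] autocorrelation (r * d) ≡ 0ℤ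
  autocorrelation-dilates d 0<d d<q with multiple-odd-half k d 0<d d<q
  ... | e , t , eq = i≡-i⇒i≡0 _ (trans (sym (∑-shift q e (λ r → autocorrelation (r * d)) per))
                       (trans (∑-ext q flip) (∑-neg q (λ r → autocorrelation (r * d)))))
    where
    per : ∀ r → autocorrelation ((r + q) * d) ≡ autocorrelation (r * d)
    per r = trans (cong autocorrelation (trans (ℕₚ.*-distribʳ-+ d r q) (cong (_+_ (r * d)) (ℕₚ.*-comm q d))))
                  (autocorrelation-periodic d (r * d))
    flip : ∀ r → autocorrelation ((r + e) * d) ≡ ℤ.- autocorrelation (r * d)
    flip r = trans (cong autocorrelation (trans (ℕₚ.*-distribʳ-+ d r e) (cong (_+_ (r * d)) eq)))
                   (autocorrelation-antiperiodic t (r * d))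

  -- Inner product of columns x and y of the matrix h(r x + b) with rows (r , b); by `kernel-≢` the
  -- columns are orthogonal.
  kernel : ℕ → ℕ → ℤ
  kernel x y = ∑[ r < q ] ∑[ b < q ] (h (r * x + b) ℤ.* h (r * y + b))

  -- Translating b by r x is harmless by periodicity and leaves a dependence on d alone.
  kernel-shift : ∀ x d → kernel x (x + d) ≡ ∑[ r < q ] autocorrelation (r * d)
  kernel-shift x d = ∑-ext q λ r → trans
    (∑-ext q λ b → cong₂ (λ m n → h m ℤ.* h n) (ℕₚ.+-comm (r * x) b) (rearrange r x d b))
    (∑-shift q (r * x) (λ b → h b ℤ.* h (b + r * d))
      (λ b → cong₂ ℤ._*_ (periodic b) (trans (cong h (swap b q (r * d))) (periodic (b + r * d)))))
    where
    rearrange : ∀ r x d b → r * (x + d) + b ≡ b + r * x + r * d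
    rearrange = ℕ-Solver.solve-∀
    swap : ∀ a b c → a + b + c ≡ a + c + b
    swap = ℕ-Solver.solve-∀

  kernel-sym : ∀ x y → kernel x y ≡ kernel y x
  kernel-sym x y = ∑-ext q λ r → ∑-ext q λ b → ℤₚ.*-comm (h (r * x + b)) (h (r * y + b))

  kernel-< : ∀ {x y} → x < y → y < q → kernel x y ≡ 0ℤ
  kernel-< {x} {y} x<y y<q with ℕₚ.m≤n⇒∃[o]m+o≡n (ℕₚ.<⇒≤ x<y)
  ... | zero  , refl = ⊥-elim (ℕₚ.<-irrefl (sym (ℕₚ.+-identityʳ x)) x<y)
  ... | suc d , refl = trans (kernel-shift x (suc d))
    (autocorrelation-dilates (suc d) (s≤s z≤n) (ℕₚ.≤-<-trans (ℕₚ.m≤n+m (suc d) x) y<q))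

  kernel-≢ : ∀ {x y} → x < q → y < q → y ≢ x → kernel x y ≡ 0ℤ
  kernel-≢ {x} {y} x<q y<q y≢x with ℕₚ.<-cmp x y
  ... | tri< x<y _ _   = kernel-< x<y y<q
  ... | tri≈ _ x≡y _   = ⊥-elim (y≢x (sym x≡y))
  ... | tri> _ _   y<x = trans (kernel-sym x y) (kernel-< y<x x<q)

  norm² : ℤ
  norm² = ∑[ b < q ] (h b ℤ.* h b)

  kernel-diagonal : ∀ x → kernel x x ≡ + q ℤ.* norm²
  kernel-diagonal x = trans (cong (kernel x) (sym (ℕₚ.+-identityʳ x)))
    (trans (kernel-shift x 0)
    (trans (∑-ext q λ r → ∑-ext q λ b → cong (λ n → h b ℤ.* h n)
             (trans (cong (_+_ b) (ℕₚ.*-zeroʳ r)) (ℕₚ.+-identityʳ b)))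
           (∑-const q norm²)))

  transform : ℕ → (ℕ → ℤ) → ℕ → ℕ → ℤ
  transform N ε r b = ∑[ x < N ] (ε x ℤ.* h (r * x + b))

  -- Expand the square and sum over r and b first. The bound N ≤ q keeps distinct x incongruent
  -- modulo q, so only the diagonal of `kernel` survives.
  transform-energy : ∀ N (ε : ℕ → ℤ) → N ≤ q →
    ∑[ r < q ] ∑[ b < q ] (transform N ε r b ℤ.* transform N ε r b) ≡
    + q ℤ.* norm² ℤ.* ∑[ x < N ] (ε x ℤ.* ε x)
  transform-energy N ε N≤q = trans
    (∑-ext q λ r → trans
      (∑-ext q λ b → ∑-product N N (λ x → ε x ℤ.* h (r * x + b)) (λ x → ε x ℤ.* h (r * x + b)))
      (∑-swap₃ N N (λ b x y → ε x ℤ.* h (r * x + b) ℤ.* (ε y ℤ.* h (r * y + b))) q))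
    (trans (∑-swap₃ N N (λ r x y → ∑[ b < q ] (ε x ℤ.* h (r * x + b) ℤ.* (ε y ℤ.* h (r * y + b)))) q)
    (trans (∑-ext N λ x → ∑-ext N λ y → factor x y)
    (trans (∑-cong N λ x x<N → trans
             (∑-single N x<N λ y y<N y≢x → trans
               (cong ((ε x ℤ.* ε y) ℤ.*_) (kernel-≢ (ℕₚ.<-≤-trans x<N N≤q) (ℕₚ.<-≤-trans y<N N≤q) y≢x))
               (ℤₚ.*-zeroʳ (ε x ℤ.* ε y)))
             (trans (cong ((ε x ℤ.* ε x) ℤ.*_) (kernel-diagonal x)) (ℤₚ.*-comm (ε x ℤ.* ε x) _)))
           (∑-*ˡ N (+ q ℤ.* norm²) (λ x → ε x ℤ.* ε x)))))
    where
    regroup : ∀ a b c d → a ℤ.* b ℤ.* (c ℤ.* d) ≡ a ℤ.* c ℤ.* (b ℤ.* d)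
    regroup = solve-∀
    factor : ∀ x y → ∑[ r < q ] ∑[ b < q ] (ε x ℤ.* h (r * x + b) ℤ.* (ε y ℤ.* h (r * y + b))) ≡
                     ε x ℤ.* ε y ℤ.* kernel x y
    factor x y = trans
      (∑-ext q λ r → trans
        (∑-ext q λ b → regroup (ε x) (h (r * x + b)) (ε y) (h (r * y + b)))
        (∑-*ˡ q (ε x ℤ.* ε y) (λ b → h (r * x + b) ℤ.* h (r * y + b))))
      (∑-*ˡ q (ε x ℤ.* ε y) (λ r → ∑[ b < q ] (h (r * x + b) ℤ.* h (r * y + b))))

-- Reduction of a planar lattice basis.

-- A basis (a , b), (- c , d) of the lattice of all (x , y) with y ≡ r x mod q.
record Basis (q r : ℕ) : Set where
  field
    a b c d t₁ t₂ : ℕ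
    1≤a  : 1 ≤ a
    1≤c  : 1 ≤ c
    ra   : r * a ≡ b + q * t₁
    rc   : d + r * c ≡ q * t₂
    -- The quotients complete (a , c) to a matrix of determinant one, so the two vectors generate
    -- the whole lattice and not a proper sublattice.
    unit : t₂ * a ≡ 1 + t₁ * c
    area : a * d + b * c ≡ q

-- Since `area` bounds a d and b c by q, these two inequalities yield (a ⊔ b) (c ⊔ d) ≤ 2 q.
Reduced : ∀ {q r} → Basis q r → Set
Reduced {q} B = a * c ≤ 2 * q × b * d ≤ 2 * q
  where open Basis B

module _ {q r : ℕ} where

  private
    -- Replaces (- c , d) by its difference with (a , b), namely (- c - a , d - b); the signs are
    -- arranged so that every entry stays natural.
    subtract-right : (B : Basis q r) → ∀ e → Basis.d B ≡ Basis.b B + e → Basis q r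
    subtract-right B e eq = record
      { a = a ; b = b ; c = c + a ; d = e ; t₁ = t₁ ; t₂ = t₂ + t₁
      ; 1≤a = 1≤a ; 1≤c = ℕₚ.≤-trans 1≤c (ℕₚ.m≤m+n c a)
      ; ra = ra
      ; rc = ℕₚ.+-cancelˡ-≡ b _ _ (trans (p₁ b e r c a) (trans (cong₂ _+_ (trans (cong (_+ r * c) (sym eq)) rc) ra) (p₂ q t₁ t₂ b)))
      ; unit = trans (ℕₚ.*-distribʳ-+ a t₂ t₁) (trans (cong (_+ t₁ * a) unit) (p₃ t₁ c a))
      ; area = trans (p₄ a b c e) (trans (cong (λ x → a * x + b * c) (sym eq)) area)
      }
      where
      open Basis B
      p₁ : ∀ b e r c a → b + (e + r * (c + a)) ≡ (b + e + r * c) + r * a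
      p₁ = ℕ-Solver.solve-∀
      p₂ : ∀ q t₁ t₂ b → q * t₂ + (b + q * t₁) ≡ b + q * (t₂ + t₁)
      p₂ = ℕ-Solver.solve-∀
      p₃ : ∀ t₁ c a → 1 + t₁ * c + t₁ * a ≡ 1 + t₁ * (c + a)
      p₃ = ℕ-Solver.solve-∀
      p₄ : ∀ a b c e → a * e + b * (c + a) ≡ a * (b + e) + b * c
      p₄ = ℕ-Solver.solve-∀

    subtract-left : (B : Basis q r) → ∀ e → Basis.b B ≡ Basis.d B + e → Basis q r
    subtract-left B e eq = record
      { a = a + c ; b = e ; c = c ; d = d ; t₁ = t₁ + t₂ ; t₂ = t₂
      ; 1≤a = ℕₚ.≤-trans 1≤a (ℕₚ.m≤m+n a c) ; 1≤c = 1≤c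
      ; ra = ℕₚ.+-cancelˡ-≡ d _ _ (trans (p₁ d r a c) (trans (cong₂ _+_ (trans ra (cong (_+ q * t₁) eq)) rc) (p₂ q t₁ t₂ d e)))
      ; rc = rc
      ; unit = trans (ℕₚ.*-distribˡ-+ t₂ a c) (trans (cong (_+ t₂ * c) unit) (p₃ t₁ t₂ c))
      ; area = trans (p₄ a d c e) (trans (cong (λ x → a * d + x * c) (sym eq)) area)
      }
      where
      open Basis B
      p₁ : ∀ d r a c → d + r * (a + c) ≡ r * a + (d + r * c)
      p₁ = ℕ-Solver.solve-∀
      p₂ : ∀ q t₁ t₂ d e → d + e + q * t₁ + q * t₂ ≡ d + (e + q * (t₁ + t₂))
      p₂ = ℕ-Solver.solve-∀
      p₃ : ∀ t₁ t₂ c → 1 + t₁ * c + t₂ * c ≡ 1 + (t₁ + t₂) * c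
      p₃ = ℕ-Solver.solve-∀
      p₄ : ∀ a d c e → (a + c) * d + e * c ≡ a * d + (d + e) * c
      p₄ = ℕ-Solver.solve-∀

    height : Basis q r → ℕ
    height B = Basis.b B ⊔ Basis.d B

    m+n≤2* : ∀ {m n} → m ≤ q → n ≤ q → m + n ≤ 2 * q
    m+n≤2* {m} {n} m≤q n≤q = ℕₚ.≤-trans (ℕₚ.+-mono-≤ m≤q n≤q)
                                        (ℕₚ.≤-reflexive (cong (_+_ q) (sym (ℕₚ.+-identityʳ q))))

  -- Subtractive Euclid, stopped as soon as a ⊔ c catches up with b ⊔ d.
  reduce : ∀ fuel (B : Basis q r) → Basis.a B < height B → Basis.c B < height B →
           height B + height B ≤ fuel + (Basis.a B + Basis.c B) → Σ[ B′ ∈ Basis q r ] Reduced B′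
  -- The fuel bounds 2 `height` - (a + c), which drops at each step; it cannot be used up while a
  -- and c both lie below the height.
  reduce zero B a< c< le = ⊥-elim (ℕₚ.<⇒≱ (ℕₚ.+-mono-< a< c<) le)
  reduce (suc fuel) B a< c< le with ℕₚ.≤-total (Basis.b B) (Basis.d B)
  ... | inj₁ b≤d with ℕₚ.m≤n⇒∃[o]m+o≡n b≤d
  ...   | e , b+e≡d with Basis.c B + Basis.a B ℕₚ.<? Basis.b B ⊔ e
  ...     | yes a+c< = reduce fuel (subtract-right B e (sym b+e≡d)) (ℕₚ.≤-<-trans (ℕₚ.m≤n+m a c) a+c<) a+c< le′
    where
    open Basis B
    b⊔e≤ : b ⊔ e ≤ b ⊔ d
    b⊔e≤ = ℕₚ.⊔-monoʳ-≤ b (subst (e ≤_) b+e≡d (ℕₚ.m≤n+m e b))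
    le′ : (b ⊔ e) + (b ⊔ e) ≤ fuel + (a + (c + a))
    le′ = ℕₚ.≤-trans (ℕₚ.+-mono-≤ b⊔e≤ b⊔e≤) (ℕₚ.≤-trans le
      (subst (_≤ fuel + (a + (c + a))) (p fuel a c) (ℕₚ.+-monoʳ-≤ fuel (ℕₚ.+-monoʳ-≤ a (ℕₚ.+-monoʳ-≤ c 1≤a)))))
      where
      p : ∀ f a c → f + (a + (c + 1)) ≡ suc f + (a + c)
      p = ℕ-Solver.solve-∀
  -- The last subtraction is still carried out. The bound on a (c + a) uses a, c < d from before it,
  -- and the bound on b e uses the stopping condition: b e ≤ b (c + a) ≤ a d + b c = q.
  ...     | no a+c≮ = subtract-right B e (sym b+e≡d) , ac≤ , be≤
    where
    open Basis B
    ad≤q : a * d ≤ q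
    ad≤q = subst (a * d ≤_) area (ℕₚ.m≤m+n (a * d) (b * c))
    b⊔d≤d : b ⊔ d ≤ d
    b⊔d≤d = ℕₚ.≤-reflexive (ℕₚ.m≤n⇒m⊔n≡n b≤d)
    ac≤ : a * (c + a) ≤ 2 * q
    ac≤ = subst (_≤ 2 * q) (sym (ℕₚ.*-distribˡ-+ a c a))
      (m+n≤2* (ℕₚ.≤-trans (ℕₚ.*-monoʳ-≤ a (ℕₚ.≤-trans (ℕₚ.<⇒≤ c<) b⊔d≤d)) ad≤q)
              (ℕₚ.≤-trans (ℕₚ.*-monoʳ-≤ a (ℕₚ.≤-trans (ℕₚ.<⇒≤ a<) b⊔d≤d)) ad≤q))
    be≤ : b * e ≤ 2 * q
    be≤ = ℕₚ.≤-trans (ℕₚ.*-monoʳ-≤ b (ℕₚ.≤-trans (ℕₚ.m≤n⊔m b e) (ℕₚ.≮⇒≥ a+c≮)))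
      (ℕₚ.≤-trans (subst₂ _≤_ (p b a c) area (ℕₚ.+-monoˡ-≤ (b * c) (ℕₚ.*-monoʳ-≤ a b≤d)))
                  (ℕₚ.m≤m+n q _))
      where
      p : ∀ b a c → a * b + b * c ≡ b * (c + a)
      p = ℕ-Solver.solve-∀
  reduce (suc fuel) B a< c< le | inj₂ d≤b with ℕₚ.m≤n⇒∃[o]m+o≡n d≤b
  ...   | e , d+e≡b with Basis.a B + Basis.c B ℕₚ.<? e ⊔ Basis.d B
  ...     | yes a+c< = reduce fuel (subtract-left B e (sym d+e≡b)) a+c< (ℕₚ.≤-<-trans (ℕₚ.m≤n+m c a) a+c<) le′
    where
    open Basis B
    e⊔d≤ : e ⊔ d ≤ b ⊔ d
    e⊔d≤ = ℕₚ.⊔-monoˡ-≤ d (subst (e ≤_) d+e≡b (ℕₚ.m≤n+m e d))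
    le′ : (e ⊔ d) + (e ⊔ d) ≤ fuel + (a + c + c)
    le′ = ℕₚ.≤-trans (ℕₚ.+-mono-≤ e⊔d≤ e⊔d≤) (ℕₚ.≤-trans le
      (subst (_≤ fuel + (a + c + c)) (p fuel (a + c)) (ℕₚ.+-monoʳ-≤ fuel (ℕₚ.+-monoʳ-≤ (a + c) 1≤c))))
      where
      p : ∀ f s → f + (s + 1) ≡ suc f + s
      p = ℕ-Solver.solve-∀
  ...     | no a+c≮ = subtract-left B e (sym d+e≡b) , ac≤ , ed≤
    where
    open Basis B
    bc≤q : b * c ≤ q
    bc≤q = subst (b * c ≤_) area (ℕₚ.m≤n+m (b * c) (a * d))
    b⊔d≤b : b ⊔ d ≤ b
    b⊔d≤b = ℕₚ.≤-reflexive (ℕₚ.m≥n⇒m⊔n≡m d≤b)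
    ac≤ : (a + c) * c ≤ 2 * q
    ac≤ = subst (_≤ 2 * q) (sym (ℕₚ.*-distribʳ-+ c a c))
      (m+n≤2* (ℕₚ.≤-trans (ℕₚ.*-monoˡ-≤ c (ℕₚ.≤-trans (ℕₚ.<⇒≤ a<) b⊔d≤b)) bc≤q)
              (ℕₚ.≤-trans (ℕₚ.*-monoˡ-≤ c (ℕₚ.≤-trans (ℕₚ.<⇒≤ c<) b⊔d≤b)) bc≤q))
    ed≤ : e * d ≤ 2 * q
    ed≤ = ℕₚ.≤-trans (ℕₚ.*-monoˡ-≤ d (ℕₚ.≤-trans (ℕₚ.m≤m⊔n e d) (ℕₚ.≮⇒≥ a+c≮)))
      (ℕₚ.≤-trans (subst₂ _≤_ (p d a c) area (ℕₚ.+-monoʳ-≤ (a * d) (ℕₚ.*-monoˡ-≤ c d≤b)))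
                  (ℕₚ.m≤m+n q _))
      where
      p : ∀ d a c → a * d + d * c ≡ (a + c) * d
      p = ℕ-Solver.solve-∀

reducedBasis : ∀ q r → 4 ≤ q → r < q → Σ[ B ∈ Basis q r ] Reduced B
reducedBasis q r 4≤q r<q with ℕₚ.m≤n⇒∃[o]m+o≡n (ℕₚ.<⇒≤ r<q)
... | d , r+d≡q = reduce ((r ⊔ d) + (r ⊔ d)) start 1<r⊔d 1<r⊔d (ℕₚ.m≤m+n _ 2)
  where
  start : Basis q r
  start = record
    { a = 1 ; b = r ; c = 1 ; d = d ; t₁ = 0 ; t₂ = 1
    ; 1≤a = s≤s z≤n ; 1≤c = s≤s z≤n
    ; ra = trans (ℕₚ.*-identityʳ r) (trans (sym (ℕₚ.+-identityʳ r)) (cong (_+_ r) (sym (ℕₚ.*-zeroʳ q))))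
    ; rc = trans (trans (cong (_+_ d) (ℕₚ.*-identityʳ r)) (trans (ℕₚ.+-comm d r) r+d≡q)) (sym (ℕₚ.*-identityʳ q))
    ; unit = refl
    ; area = trans (p r d) r+d≡q
    }
    where
    p : ∀ r d → 1 * d + r * 1 ≡ r + d
    p = ℕ-Solver.solve-∀
  1<r⊔d : 1 < r ⊔ d
  1<r⊔d = ℕₚ.≰⇒> λ r⊔d≤1 → ℕₚ.<⇒≱ (s≤s (s≤s (s≤s z≤n)))
    (ℕₚ.≤-trans 4≤q (subst (_≤ 2) r+d≡q
      (ℕₚ.+-mono-≤ (ℕₚ.≤-trans (ℕₚ.m≤m⊔n r d) r⊔d≤1) (ℕₚ.≤-trans (ℕₚ.m≤n⊔m r d) r⊔d≤1))))

-- Sums over lattice points and proper rectangles.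

δ : ℤ → ℕ → ℤ
δ z x = if does (z ℤₚ.≟ + x) then 1ℤ else 0ℤ

δ-≡ : ∀ {z x} → z ≡ + x → δ z x ≡ 1ℤ
δ-≡ {z} {x} z≡x = cong (if_then 1ℤ else 0ℤ) (dec-true (z ℤₚ.≟ + x) z≡x)

δ-≢ : ∀ {z x} → z ≢ + x → δ z x ≡ 0ℤ
δ-≢ {z} {x} z≢x = cong (if_then 1ℤ else 0ℤ) (dec-false (z ℤₚ.≟ + x) z≢x)

-- Extension of ε by zero from {0, ..., N - 1} to ℤ, written with indicators so that a sum over
-- lattice points can be regrouped by x.
extend : ℕ → (ℕ → ℤ) → ℤ → ℤ
extend N ε z = ∑[ x < N ] (ε x ℤ.* δ z x)

∑∑-extend : ∀ N ε m n (X : ℕ → ℕ → ℤ) (φ : ℕ → ℕ → ℤ) →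
  ∑[ i < m ] ∑[ j < n ] (extend N ε (X i j) ℤ.* φ i j) ≡
  ∑[ x < N ] (ε x ℤ.* ∑[ i < m ] ∑[ j < n ] (δ (X i j) x ℤ.* φ i j))
∑∑-extend N ε m n X φ = trans
  (∑-ext m λ i → trans
    (∑-ext n λ j → trans (sym (∑-*ʳ N (φ i j) (λ x → ε x ℤ.* δ (X i j) x)))
                         (∑-ext N λ x → ℤₚ.*-assoc (ε x) (δ (X i j) x) (φ i j)))
    (trans (∑-swap n N (λ j x → ε x ℤ.* (δ (X i j) x ℤ.* φ i j)))
           (∑-ext N λ x → ∑-*ˡ n (ε x) (λ j → δ (X i j) x ℤ.* φ i j))))
  (trans (∑-swap m N (λ i x → ε x ℤ.* ∑[ j < n ] (δ (X i j) x ℤ.* φ i j)))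
         (∑-ext N λ x → ∑-*ˡ m (ε x) (λ i → ∑[ j < n ] (δ (X i j) x ℤ.* φ i j))))

Injective₂ : ℕ → ℕ → ℕ → ℕ → Set
Injective₂ δ₁ δ₂ m n = ∀ {i j i′ j′} → i < m → i′ < m → j < n → j′ < n →
  i * δ₁ + j * δ₂ ≡ i′ * δ₁ + j′ * δ₂ → i ≡ i′ × j ≡ j′

-- What bounded discrepancy provides. `Injective₂` is required because a sum over (i , j) counts
-- multiplicities and a hyperedge does not.
RectangleBound : ℕ → (ℕ → ℤ) → ℕ → Set
RectangleBound N ε D = ∀ X δ₁ δ₂ m n → 1 ≤ δ₁ → δ₁ ≤ N → 1 ≤ δ₂ → δ₂ ≤ N →
  1 ≤ m → m ≤ N → 1 ≤ n → n ≤ N → Injective₂ δ₁ δ₂ m n →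
  ∣ ∑[ i < m ] ∑[ j < n ] extend N ε (X ℤ.+ + (i * δ₁ + j * δ₂)) ∣ ≤ D

-- Blocks of a reduced lattice project injectively.

quarter : ∀ n → ∃[ L ] (n ≤ 4 * L × 4 * L < n + 4)
quarter zero = 0 , z≤n , s≤s z≤n
quarter (suc n) with quarter n
... | L , n≤4L , 4L<n+4 with suc n ℕₚ.≤? 4 * L
...   | yes 1+n≤4L = L , 1+n≤4L , ℕₚ.m<n⇒m<1+n 4L<n+4
...   | no  1+n≰4L = suc L , subst (suc n ≤_) (sym 4+) (ℕₚ.≤-trans (s≤s n≤4L) (ℕₚ.m≤n+m (suc (4 * L)) 3))
                           , s≤s (subst (_≤ n + 4) (trans (ℕₚ.+-comm (4 * L) 4) (sym 4+))
                                   (ℕₚ.+-monoˡ-≤ 4 (ℕₚ.≤-pred (ℕₚ.≰⇒> 1+n≰4L))))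
  where
  4+ : 4 * suc L ≡ 4 + 4 * L
  4+ = ℕₚ.*-suc 4 L

-- Since - o ≤ (P - R) / q ≤ u, the shifted coefficient becomes a natural number, fit to index a
-- finite sum.
shift-nonNeg : ∀ {q} .{{_ : NonZero q}} i {P R o u} → + q ℤ.* i ≡ + P ℤ.- + R →
               R ≤ q * o → P ≤ q * u → ∃[ n ] (+ n ≡ i ℤ.+ + o × n ≤ u + o)
shift-nonNeg {q} i {P} {R} {o} {u} qi≡ R≤ P≤ = go (i ℤ.+ + o) refl
  where
  balance : + q ℤ.* (i ℤ.+ + o) ℤ.+ + R ≡ + (P + q * o)
  balance = trans (p₁ (+ q) i (+ o) (+ R)) (trans (cong (λ x → x ℤ.+ + q ℤ.* + o ℤ.+ + R) qi≡)
            (trans (p₂ (+ P) (+ R) (+ q ℤ.* + o)) (cong (ℤ._+_ (+ P)) (sym (ℤₚ.pos-* q o)))))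
    where
    p₁ : ∀ q i o R → q ℤ.* (i ℤ.+ o) ℤ.+ R ≡ q ℤ.* i ℤ.+ q ℤ.* o ℤ.+ R
    p₁ = solve-∀
    p₂ : ∀ P R x → P ℤ.- R ℤ.+ x ℤ.+ R ≡ P ℤ.+ x
    p₂ = solve-∀
  go : ∀ z → z ≡ i ℤ.+ + o → ∃[ n ] (+ n ≡ i ℤ.+ + o × n ≤ u + o)
  go (+ n) z≡ = n , z≡ , ℕₚ.*-cancelˡ-≤ q (begin
    q * n        ≤⟨ ℕₚ.m≤m+n (q * n) R ⟩
    q * n + R    ≡⟨ ℤₚ.+-injective (trans (cong (ℤ._+ + R) (trans (ℤₚ.pos-* q n) (cong (ℤ._*_ (+ q)) z≡))) balance) ⟩
    P + q * o    ≤⟨ ℕₚ.+-monoˡ-≤ (q * o) P≤ ⟩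
    q * u + q * o ≡⟨ sym (ℕₚ.*-distribˡ-+ q u o) ⟩
    q * (u + o)  ∎)
    where open ℕₚ.≤-Reasoning
  go -[1+ k ] z≡ = ⊥-elim (ℕₚ.<-irrefl refl (begin-strict
    R                           ≤⟨ R≤ ⟩
    q * o                       ≤⟨ ℕₚ.m≤n+m (q * o) P ⟩
    P + q * o                   <⟨ ℕₚ.m<m+n (P + q * o) (ℕ.>-nonZero⁻¹ (q * suc k) {{ℕₚ.m*n≢0 q (suc k)}}) ⟩
    P + q * o + q * suc k       ≡⟨ ℤₚ.+-injective (trans (cong₂ ℤ._+_ (sym balance) (ℤₚ.pos-* q (suc k)))
                                     (trans (cong (λ x → + q ℤ.* x ℤ.+ + R ℤ.+ + q ℤ.* + suc k) (sym z≡))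
                                            (p (+ q) (+ suc k) (+ R)))) ⟩
    R                           ∎))
    where
    open ℕₚ.≤-Reasoning
    p : ∀ q k R → q ℤ.* (ℤ.- k) ℤ.+ R ℤ.+ q ℤ.* k ≡ R
    p = solve-∀

-- Uniqueness of division with remainder when the quotient is only known to be an integer: a
-- negative `s` would make y + q s negative.
mod-unique : ∀ {q} .{{_ : NonZero q}} m y s → y < q → + m ≡ + y ℤ.+ + q ℤ.* s → s ≡ + (m / q)
mod-unique {q} m y (+ k) y<q eq = cong +_ (sym (ℕₚ.*-cancelʳ-≡ (m / q) k q (ℕₚ.+-cancelˡ-≡ y _ _ (begin
  y + m / q * q     ≡⟨ cong (_+ m / q * q) (sym (trans (cong (_% q) m≡) (trans ([m+kn]%n≡m%n y k q) (m<n⇒m%n≡m y<q)))) ⟩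
  m % q + m / q * q ≡⟨ sym (m≡m%n+[m/n]*n m q) ⟩
  m                 ≡⟨ m≡ ⟩
  y + k * q         ∎))))
  where
  open ≡-Reasoning
  m≡ : m ≡ y + k * q
  m≡ = ℤₚ.+-injective (trans eq (cong (ℤ._+_ (+ y)) (trans (sym (ℤₚ.pos-* q k)) (cong +_ (ℕₚ.*-comm q k)))))
mod-unique {q} m y -[1+ k ] y<q eq = ⊥-elim (ℕₚ.<⇒≱ y<q (ℕₚ.≤-trans (ℕₚ.≤-trans (ℕₚ.m≤m*n q (suc k)) (ℕₚ.m≤n+m _ m))
  (ℕₚ.≤-reflexive (ℤₚ.+-injective (trans (cong₂ ℤ._+_ eq (ℤₚ.pos-* q (suc k))) (p (+ y) (+ q) (+ suc k)))))))
  where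
  p : ∀ y q k → y ℤ.+ q ℤ.* (ℤ.- k) ℤ.+ q ℤ.* k ≡ y
  p = solve-∀

⊔-*-⊔-lub : ∀ a b c d {k} → a * c ≤ k → a * d ≤ k → b * c ≤ k → b * d ≤ k → (a ⊔ b) * (c ⊔ d) ≤ k
⊔-*-⊔-lub a b c d ac ad bc bd with ℕₚ.⊔-sel a b | ℕₚ.⊔-sel c d
... | inj₁ p | inj₁ p′ rewrite p | p′ = ac
... | inj₁ p | inj₂ p′ rewrite p | p′ = ad
... | inj₂ p | inj₁ p′ rewrite p | p′ = bc
... | inj₂ p | inj₂ p′ rewrite p | p′ = bd

4m<m⊔n⇒4m<n : ∀ m n → 4 * m < m ⊔ n → 4 * m < n
4m<m⊔n⇒4m<n m n lt with ℕₚ.⊔-sel m n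
... | inj₁ p = ⊥-elim (ℕₚ.<⇒≱ (subst (4 * m <_) p lt) (ℕₚ.m≤m+n m _))
... | inj₂ p = subst (4 * m <_) p lt

module Lattice {q r : ℕ} .{{_ : NonZero q}} (basis : Basis q r) (reduced : Reduced basis)
               {N : ℕ} (N≤q : N ≤ q) (q≤2N : q ≤ 2 * N) where

  open Basis basis

  -- Sup norms of the two basis vectors.
  A C : ℕ
  A = a ⊔ b
  C = c ⊔ d

  private
    ad≤q : a * d ≤ q
    ad≤q = subst (a * d ≤_) area (ℕₚ.m≤m+n (a * d) (b * c))
    bc≤q : b * c ≤ q
    bc≤q = subst (b * c ≤_) area (ℕₚ.m≤n+m (b * c) (a * d))

  AC≤2q : A * C ≤ 2 * q
  AC≤2q = ⊔-*-⊔-lub a b c d (proj₁ reduced) (ℕₚ.≤-trans ad≤q (ℕₚ.m≤m+n q _))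
                            (ℕₚ.≤-trans bc≤q (ℕₚ.m≤m+n q _)) (proj₂ reduced)

  1≤A : 1 ≤ A
  1≤A = ℕₚ.≤-trans 1≤a (ℕₚ.m≤m⊔n a b)
  1≤C : 1 ≤ C
  1≤C = ℕₚ.≤-trans 1≤c (ℕₚ.m≤m⊔n c d)

  -- By Cramer's rule the coefficient of one vector is bounded by the norm of the other, hence the
  -- exchange: `L₁`, counting steps of length `a`, comes from `C`, and `L₂` from `A`.
  L₁ L₂ : ℕ
  L₁ = proj₁ (quarter C)
  L₂ = proj₁ (quarter A)

  C≤4L₁ : C ≤ 4 * L₁
  C≤4L₁ = proj₁ (proj₂ (quarter C))

  A≤4L₂ : A ≤ 4 * L₂
  A≤4L₂ = proj₁ (proj₂ (quarter A))

  private
    4L₁<C+4 : 4 * L₁ < C + 4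
    4L₁<C+4 = proj₂ (proj₂ (quarter C))
    4L₂<A+4 : 4 * L₂ < A + 4
    4L₂<A+4 = proj₂ (proj₂ (quarter A))

    quarter-positive : ∀ {n L} → 1 ≤ n → n ≤ 4 * L → 1 ≤ L
    quarter-positive {L = suc L} _ _ = s≤s z≤n
    quarter-positive {L = zero} 1≤n n≤0 = ℕₚ.≤-trans 1≤n n≤0

    quarter-≤ : ∀ {n L} → 4 * L < n + 4 → 1 ≤ n → L ≤ n
    quarter-≤ {n} {L} lt 1≤n = ℕₚ.≤-pred (ℕₚ.*-cancelˡ-< 4 L (suc n) (ℕₚ.<-≤-trans lt
      (subst (n + 4 ≤_) (trans (ℕₚ.+-comm (4 * n) 4) (sym (ℕₚ.*-suc 4 n))) (ℕₚ.+-monoˡ-≤ 4 (ℕₚ.m≤m+n n _)))))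

    quarter-< : ∀ {n L e} → 4 * L < n + 4 → e < L → 4 * e < n
    quarter-< {n} {L} {e} lt e<L = ℕₚ.+-cancelʳ-< 4 (4 * e) n (ℕₚ.≤-<-trans
      (subst (_≤ 4 * L) (trans (ℕₚ.*-suc 4 e) (ℕₚ.+-comm 4 (4 * e))) (ℕₚ.*-monoʳ-≤ 4 e<L)) lt)

  1≤L₁ : 1 ≤ L₁
  1≤L₁ = quarter-positive 1≤C C≤4L₁

  1≤L₂ : 1 ≤ L₂
  1≤L₂ = quarter-positive 1≤A A≤4L₂

  L₁b≤2q : L₁ * b ≤ 2 * q
  L₁b≤2q = ℕₚ.≤-trans (ℕₚ.*-mono-≤ (quarter-≤ {C} {L₁} 4L₁<C+4 1≤C) (ℕₚ.m≤n⊔m a b))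
                      (subst (_≤ 2 * q) (ℕₚ.*-comm A C) AC≤2q)

  L₂d≤2q : L₂ * d ≤ 2 * q
  L₂d≤2q = ℕₚ.≤-trans (ℕₚ.*-mono-≤ (quarter-≤ {A} {L₂} 4L₂<A+4 1≤A) (ℕₚ.m≤n⊔m c d)) AC≤2q

  private
    -- Two points of a block over the same x would differ by a multiple of (c , - a), which the
    -- area q = a d + b c makes too long.
    no-collision : ∀ {e g} → 1 ≤ e → e < L₁ → g < L₂ → e * a ≡ g * c → ⊥
    no-collision {e} {g} 1≤e e<L₁ g<L₂ ea≡gc = ℕₚ.<⇒≱ 4q<2bd 2bd≤4q
      where
      instance
        e≢0 : NonZero e
        e≢0 = ℕ.>-nonZero 1≤e
        a≢0 : NonZero a
        a≢0 = ℕ.>-nonZero 1≤a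
      g≢0 : NonZero g
      g≢0 = ℕ.≢-nonZero λ g≡0 → ℕ.≢-nonZero⁻¹ (e * a) {{ℕₚ.m*n≢0 e a}} (trans ea≡gc (cong (_* c) g≡0))
      -- By `unit`, a and c are coprime, so e a = g c makes c divide e and a divide g.
      c∣e : c ∣ₙ e
      c∣e = ∣m+n∣m⇒∣n {m = e * t₁ * c} (divides (t₂ * g) (begin
          e * t₁ * c + e   ≡⟨ p₁ e t₁ c ⟩
          e * (1 + t₁ * c) ≡⟨ cong (e *_) (sym unit) ⟩
          e * (t₂ * a)     ≡⟨ p₂ e t₂ a ⟩
          t₂ * (e * a)     ≡⟨ cong (t₂ *_) ea≡gc ⟩
          t₂ * (g * c)     ≡⟨ sym (ℕₚ.*-assoc t₂ g c) ⟩
          t₂ * g * c       ∎)) (divides (e * t₁) refl)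
        where
        open ≡-Reasoning
        p₁ : ∀ e t c → e * t * c + e ≡ e * (1 + t * c)
        p₁ = ℕ-Solver.solve-∀
        p₂ : ∀ e t a → e * (t * a) ≡ t * (e * a)
        p₂ = ℕ-Solver.solve-∀
      a∣g : a ∣ₙ g
      a∣g = ∣m+n∣m⇒∣n {m = t₁ * e * a} (divides (g * t₂) (begin
          t₁ * e * a + g   ≡⟨ cong (_+ g) (trans (ℕₚ.*-assoc t₁ e a) (cong (t₁ *_) ea≡gc)) ⟩
          t₁ * (g * c) + g ≡⟨ p₁ g t₁ c ⟩
          g * (1 + t₁ * c) ≡⟨ cong (g *_) (sym unit) ⟩
          g * (t₂ * a)     ≡⟨ sym (ℕₚ.*-assoc g t₂ a) ⟩
          g * t₂ * a       ∎)) (divides (t₁ * e) refl)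
        where
        open ≡-Reasoning
        p₁ : ∀ g t c → t * (g * c) + g ≡ g * (1 + t * c)
        p₁ = ℕ-Solver.solve-∀
      -- From c ≤ e < L₁ follows 4 c < C = c ⊔ d, so the maximum is d; likewise for a and b.
      4c<d : 4 * c < d
      4c<d = 4m<m⊔n⇒4m<n c d (ℕₚ.≤-<-trans (ℕₚ.*-monoʳ-≤ 4 (∣⇒≤ c∣e)) (quarter-< 4L₁<C+4 e<L₁))
      4a<b : 4 * a < b
      4a<b = 4m<m⊔n⇒4m<n a b (ℕₚ.≤-<-trans (ℕₚ.*-monoʳ-≤ 4 (∣⇒≤ {{g≢0}} a∣g)) (quarter-< 4L₂<A+4 g<L₂))
      2bd≤4q : b * d + b * d ≤ 4 * q
      2bd≤4q = ℕₚ.≤-trans (ℕₚ.+-mono-≤ (proj₂ reduced) (proj₂ reduced)) (ℕₚ.≤-reflexive (p q))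
        where
        p : ∀ q → 2 * q + 2 * q ≡ 4 * q
        p = ℕ-Solver.solve-∀
      4q<2bd : 4 * q < b * d + b * d
      4q<2bd = subst (_< b * d + b * d) (trans (p a b c d) (cong (4 *_) area))
        (ℕₚ.+-mono-<-≤ (ℕₚ.*-monoˡ-< d {{ℕ.>-nonZero (ℕₚ.≤-<-trans z≤n 4c<d)}} 4a<b)
                       (ℕₚ.*-monoʳ-≤ b (ℕₚ.<⇒≤ 4c<d)))
        where
        p : ∀ a b c d → 4 * a * d + b * (4 * c) ≡ 4 * (a * d + b * c)
        p = ℕ-Solver.solve-∀

    block-separated : ∀ {i j i′ j′} → i < i′ → i′ < L₁ → j < L₂ →
                      i * a + j * c ≡ i′ * a + j′ * c → ⊥
    block-separated {i} {j} {i′} {j′} i<i′ i′<L₁ j<L₂ eq with ℕₚ.m≤n⇒∃[o]m+o≡n i<i′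
    ... | e , refl with ℕₚ.≤-total j j′
    ...   | inj₁ j≤j′ = ℕₚ.<-irrefl eq (ℕₚ.+-mono-<-≤ (ℕₚ.*-monoˡ-< a {{ℕ.>-nonZero 1≤a}} i<i′) (ℕₚ.*-monoˡ-≤ c j≤j′))
    ...   | inj₂ j′≤j with ℕₚ.m≤n⇒∃[o]m+o≡n j′≤j
    ...     | g , refl = no-collision {suc e} {g} (s≤s z≤n)
      (ℕₚ.≤-<-trans (subst (suc e ≤_) (ℕₚ.+-suc i e) (ℕₚ.m≤n+m (suc e) i)) i′<L₁)
      (ℕₚ.≤-<-trans (ℕₚ.m≤n+m g j′) j<L₂)
      (ℕₚ.+-cancelˡ-≡ (i * a + j′ * c) _ _ (trans (p₁ i e a j′ c) (trans (sym eq) (p₂ i a j′ g c))))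
      where
      p₁ : ∀ i e a j c → i * a + j * c + (1 + e) * a ≡ (1 + i + e) * a + j * c
      p₁ = ℕ-Solver.solve-∀
      p₂ : ∀ i a j g c → i * a + (j + g) * c ≡ i * a + j * c + g * c
      p₂ = ℕ-Solver.solve-∀

  block-injective : Injective₂ a c L₁ L₂
  block-injective {i} {j} {i′} {j′} i<L₁ i′<L₁ j<L₂ j′<L₂ eq with ℕₚ.<-cmp i i′
  ... | tri< i<i′ _ _ = ⊥-elim (block-separated {i} {j} {i′} {j′} i<i′ i′<L₁ j<L₂ eq)
  ... | tri> _ _ i′<i = ⊥-elim (block-separated {i′} {j′} {i} {j} i′<i i<L₁ j′<L₂ (sym eq))
  ... | tri≈ _ refl _ = refl , ℕₚ.*-cancelʳ-≡ j j′ c {{ℕ.>-nonZero 1≤c}} (ℕₚ.+-cancelˡ-≡ (i * a) _ _ eq)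

  private
    AC≤4N : A * C ≤ 4 * N
    AC≤4N = ℕₚ.≤-trans AC≤2q (ℕₚ.≤-trans (ℕₚ.*-monoʳ-≤ 2 q≤2N) (ℕₚ.≤-reflexive (sym (ℕₚ.*-assoc 2 2 N))))

    -- A block with at least two columns has a step at most N; otherwise the step is irrelevant.
    admissible-step : ∀ {L S T δ₀} → 4 * L < T + 4 → S * T ≤ 4 * N → 1 ≤ δ₀ → δ₀ ≤ S → 1 ≤ N →
                      ∃[ δ₁ ] (1 ≤ δ₁ × δ₁ ≤ N × (∀ i → i < L → i * δ₀ ≡ i * δ₁))
    admissible-step {L} {S} {T} {δ₀} 4L<T+4 ST≤4N 1≤δ₀ δ₀≤S 1≤N with δ₀ ℕₚ.≤? N | 1 ℕₚ.<? L
    ... | yes δ₀≤N | _ = δ₀ , 1≤δ₀ , δ₀≤N , λ _ _ → refl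
    ... | no _     | no 1≮L = 1 , ℕₚ.≤-refl , 1≤N , λ i i<L →
      trans (cong (_* δ₀) (i≡0 i<L)) (sym (cong (_* 1) (i≡0 i<L)))
        where
        i≡0 : ∀ {i} → i < L → i ≡ 0
        i≡0 i<L = ℕₚ.n<1⇒n≡0 (ℕₚ.<-≤-trans i<L (ℕₚ.≮⇒≥ 1≮L))
    ... | no δ₀≰N  | yes 1<L = ⊥-elim (ℕₚ.<⇒≱ (ℕₚ.<-≤-trans
        (ℕₚ.*-monoʳ-< 4 (ℕₚ.<-≤-trans (ℕₚ.≰⇒> δ₀≰N) δ₀≤S))
        (subst (_≤ S * T) (ℕₚ.*-comm S 4) (ℕₚ.*-monoʳ-≤ S (ℕₚ.<⇒≤ (quarter-< 4L<T+4 1<L))))) ST≤4N)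

    length-≤N : ∀ {L S T} → 4 * L < T + 4 → S * T ≤ 4 * N → 1 ≤ S → L ≤ N
    length-≤N {L} {S} {T} 4L<T+4 ST≤4N 1≤S = ℕₚ.≤-pred (ℕₚ.*-cancelˡ-< 4 L (suc N) (ℕₚ.<-≤-trans 4L<T+4
      (subst (T + 4 ≤_) (trans (ℕₚ.+-comm (4 * N) 4) (sym (ℕₚ.*-suc 4 N)))
        (ℕₚ.+-monoˡ-≤ 4 (ℕₚ.≤-trans (ℕₚ.m≤n*m T S {{ℕ.>-nonZero 1≤S}}) ST≤4N)))))

  module _ {ε : ℕ → ℤ} {D : ℕ} (rectangle : RectangleBound N ε D) (1≤N : 1 ≤ N) where

    -- Sub-blocks inherit injectivity. Empty ones are settled apart, since progressions in a
    -- hyperedge have positive length.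
    block-bound : ∀ X k l → k ≤ L₁ → l ≤ L₂ →
                  ∣ ∑[ i < k ] ∑[ j < l ] extend N ε (X ℤ.+ + (i * a + j * c)) ∣ ≤ D
    block-bound X zero    l       _    _    = z≤n
    block-bound X (suc k) zero    _    _    = subst (λ z → ∣ z ∣ ≤ D) (sym (∑-0 (suc k) λ _ _ → refl)) z≤n
    block-bound X (suc k) (suc l) k<L₁ l<L₂
      with admissible-step 4L₁<C+4 AC≤4N 1≤a (ℕₚ.m≤m⊔n a b) 1≤N
         | admissible-step 4L₂<A+4 (subst (_≤ 4 * N) (ℕₚ.*-comm A C) AC≤4N) 1≤c (ℕₚ.m≤m⊔n c d) 1≤N
    ... | δ₁ , 1≤δ₁ , δ₁≤N , same₁ | δ₂ , 1≤δ₂ , δ₂≤N , same₂ =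
      subst (λ z → ∣ z ∣ ≤ D)
        (∑-cong (suc k) λ i i<k → ∑-cong (suc l) λ j j<l →
          cong (λ n → extend N ε (X ℤ.+ + n))
               (sym (cong₂ _+_ (same₁ i (ℕₚ.<-≤-trans i<k k<L₁)) (same₂ j (ℕₚ.<-≤-trans j<l l<L₂)))))
        (rectangle X δ₁ δ₂ (suc k) (suc l) 1≤δ₁ δ₁≤N 1≤δ₂ δ₂≤N
          (s≤s z≤n) (ℕₚ.≤-trans k<L₁ (length-≤N 4L₁<C+4 AC≤4N 1≤A))
          (s≤s z≤n) (ℕₚ.≤-trans l<L₂ (length-≤N 4L₂<A+4 (subst (_≤ 4 * N) (ℕₚ.*-comm A C) AC≤4N) 1≤C))
          λ {i} {j} {i′} {j′} i< i′< j< j′< eq →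
            let i<L₁ = ℕₚ.<-≤-trans i< k<L₁ ; i′<L₁ = ℕₚ.<-≤-trans i′< k<L₁
                j<L₂ = ℕₚ.<-≤-trans j< l<L₂ ; j′<L₂ = ℕₚ.<-≤-trans j′< l<L₂
            in block-injective i<L₁ i′<L₁ j<L₂ j′<L₂
                 (trans (cong₂ _+_ (same₁ i i<L₁) (same₂ j j<L₂))
                        (trans eq (sym (cong₂ _+_ (same₁ i′ i′<L₁) (same₂ j′ j′<L₂))))))

-- One lattice point over each x.

module Unfolding {q r : ℕ} .{{_ : NonZero q}} (basis : Basis q r) (reduced : Reduced basis)
                 {N : ℕ} (N≤q : N ≤ q) (q≤2N : q ≤ 2 * N)
                 (β : ℕ) (β≤2q : β ≤ 2 * q)
                 (w : ℤ → ℤ) (w-early : ∀ z → z ℤ.≤ 0ℤ → w z ≡ 0ℤ) (w-late : ∀ n → q ≤ n → w (+ n) ≡ 0ℤ) where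

  open Basis basis
  open Lattice basis reduced N≤q q≤2N

  -- The lattice point (i - 2 C) (a , b) + (j - A) (c , - d), with β added to its second coordinate.
  -- The shifts - 2 C and - A are lower bounds for the coefficients when 0 ≤ x, y ≤ q and β ≤ 2 q.
  X Y : ℕ → ℕ → ℤ
  X i j = (+ i ℤ.- + (2 * C)) ℤ.* + a ℤ.+ (+ j ℤ.- + A) ℤ.* + c
  Y i j = (+ i ℤ.- + (2 * C)) ℤ.* + b ℤ.- (+ j ℤ.- + A) ℤ.* + d ℤ.+ + β

  private
    raℤ : + r ℤ.* + a ≡ + b ℤ.+ + q ℤ.* + t₁
    raℤ = trans (sym (ℤₚ.pos-* r a)) (trans (cong +_ ra) (cong (ℤ._+_ (+ b)) (ℤₚ.pos-* q t₁)))
    rcℤ : + d ℤ.+ + r ℤ.* + c ≡ + q ℤ.* + t₂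
    rcℤ = trans (cong (ℤ._+_ (+ d)) (sym (ℤₚ.pos-* r c))) (trans (cong +_ rc) (ℤₚ.pos-* q t₂))
    unitℤ : + t₂ ℤ.* + a ≡ 1ℤ ℤ.+ + t₁ ℤ.* + c
    unitℤ = trans (sym (ℤₚ.pos-* t₂ a)) (trans (cong +_ unit) (cong (ℤ._+_ 1ℤ) (ℤₚ.pos-* t₁ c)))
    areaℤ : + a ℤ.* + d ℤ.+ + b ℤ.* + c ≡ + q
    areaℤ = trans (cong₂ ℤ._+_ (sym (ℤₚ.pos-* a d)) (sym (ℤₚ.pos-* b c))) (cong +_ area)

    -- Eliminating between `raℤ`, `rcℤ` and `unitℤ` expresses `r` through the basis; this is what
    -- the y-coordinate in `IJ-y` needs.
    cofactor : + t₂ ℤ.* + b ℤ.+ + t₁ ℤ.* + d ≡ + r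
    cofactor = begin
      + t₂ ℤ.* + b ℤ.+ + t₁ ℤ.* + d
        ≡⟨ p₁ (+ t₁) (+ t₂) (+ b) (+ c) (+ d) (+ q) (+ r) ⟩
      + t₂ ℤ.* (+ b ℤ.+ + q ℤ.* + t₁) ℤ.+ (+ t₁ ℤ.* (+ d ℤ.+ + r ℤ.* + c) ℤ.- + t₁ ℤ.* (+ q ℤ.* + t₂))
        ℤ.- + r ℤ.* (+ t₁ ℤ.* + c)
        ≡⟨ cong₂ (λ x y → + t₂ ℤ.* x ℤ.+ (+ t₁ ℤ.* y ℤ.- + t₁ ℤ.* (+ q ℤ.* + t₂)) ℤ.- + r ℤ.* (+ t₁ ℤ.* + c))
                 (sym raℤ) rcℤ ⟩
      + t₂ ℤ.* (+ r ℤ.* + a) ℤ.+ (+ t₁ ℤ.* (+ q ℤ.* + t₂) ℤ.- + t₁ ℤ.* (+ q ℤ.* + t₂))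
        ℤ.- + r ℤ.* (+ t₁ ℤ.* + c)
        ≡⟨ p₂ (+ t₁) (+ t₂) (+ a) (+ c) (+ q) (+ r) ⟩
      + r ℤ.* (+ t₂ ℤ.* + a) ℤ.- + r ℤ.* (+ t₁ ℤ.* + c)
        ≡⟨ cong (λ x → + r ℤ.* x ℤ.- + r ℤ.* (+ t₁ ℤ.* + c)) unitℤ ⟩
      + r ℤ.* (1ℤ ℤ.+ + t₁ ℤ.* + c) ℤ.- + r ℤ.* (+ t₁ ℤ.* + c)
        ≡⟨ p₃ (+ r) (+ t₁ ℤ.* + c) ⟩
      + r ∎
      where
      open ≡-Reasoning
      p₁ : ∀ t₁ t₂ b c d q r → t₂ ℤ.* b ℤ.+ t₁ ℤ.* d ≡
        t₂ ℤ.* (b ℤ.+ q ℤ.* t₁) ℤ.+ (t₁ ℤ.* (d ℤ.+ r ℤ.* c) ℤ.- t₁ ℤ.* (q ℤ.* t₂)) ℤ.- r ℤ.* (t₁ ℤ.* c)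
      p₁ = solve-∀
      p₂ : ∀ t₁ t₂ a c q r →
        t₂ ℤ.* (r ℤ.* a) ℤ.+ (t₁ ℤ.* (q ℤ.* t₂) ℤ.- t₁ ℤ.* (q ℤ.* t₂)) ℤ.- r ℤ.* (t₁ ℤ.* c) ≡
        r ℤ.* (t₂ ℤ.* a) ℤ.- r ℤ.* (t₁ ℤ.* c)
      p₂ = solve-∀
      p₃ : ∀ r x → r ℤ.* (1ℤ ℤ.+ x) ℤ.- r ℤ.* x ≡ r
      p₃ = solve-∀

    module Fibre (x : ℕ) (x≤q : x ≤ q) where

      m y s : ℕ
      m = r * x + β
      y = m % q
      s = m / q

      y≤q : y ≤ q
      y≤q = ℕₚ.<⇒≤ (m%n<n m q)

      mℤ : + r ℤ.* + x ℤ.+ + β ≡ + y ℤ.+ + s ℤ.* + q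
      mℤ = trans (cong (ℤ._+ + β) (sym (ℤₚ.pos-* r x)))
           (trans (cong +_ (m≡m%n+[m/n]*n m q)) (cong (ℤ._+_ (+ y)) (ℤₚ.pos-* s q)))

      -- In the coordinates (x , s) with y + s q = r x + β, the basis vectors become (a , t₁) and (c
      -- , t₂), of determinant one; Cramer's rule gives these coefficients.
      I J : ℤ
      I = + x ℤ.* + t₂ ℤ.- + s ℤ.* + c
      J = + s ℤ.* + a ℤ.- + x ℤ.* + t₁

      -- Multiplication by q eliminates the quotient s, so the size of I can be read off from 0 ≤ x,
      -- y ≤ q and β ≤ 2 q.
      qI : + q ℤ.* I ≡ + (x * d + y * c) ℤ.- + (β * c)
      qI = begin
        + q ℤ.* I
          ≡⟨ p₁ (+ q) (+ x) (+ t₂) (+ s) (+ c) (+ y) ⟩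
        + x ℤ.* (+ q ℤ.* + t₂) ℤ.- (+ y ℤ.+ + s ℤ.* + q) ℤ.* + c ℤ.+ + y ℤ.* + c
          ≡⟨ cong₂ (λ u v → + x ℤ.* u ℤ.- v ℤ.* + c ℤ.+ + y ℤ.* + c) (sym rcℤ) (sym mℤ) ⟩
        + x ℤ.* (+ d ℤ.+ + r ℤ.* + c) ℤ.- (+ r ℤ.* + x ℤ.+ + β) ℤ.* + c ℤ.+ + y ℤ.* + c
          ≡⟨ p₂ (+ x) (+ d) (+ r) (+ c) (+ β) (+ y) ⟩
        + x ℤ.* + d ℤ.+ + y ℤ.* + c ℤ.- + β ℤ.* + c
          ≡⟨ sym (cong₂ ℤ._-_ (cong₂ ℤ._+_ (ℤₚ.pos-* x d) (ℤₚ.pos-* y c)) (ℤₚ.pos-* β c)) ⟩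
        + (x * d + y * c) ℤ.- + (β * c) ∎
        where
        open ≡-Reasoning
        p₁ : ∀ q x t s c y → q ℤ.* (x ℤ.* t ℤ.- s ℤ.* c) ≡
             x ℤ.* (q ℤ.* t) ℤ.- (y ℤ.+ s ℤ.* q) ℤ.* c ℤ.+ y ℤ.* c
        p₁ = solve-∀
        p₂ : ∀ x d r c β y → x ℤ.* (d ℤ.+ r ℤ.* c) ℤ.- (r ℤ.* x ℤ.+ β) ℤ.* c ℤ.+ y ℤ.* c ≡
             x ℤ.* d ℤ.+ y ℤ.* c ℤ.- β ℤ.* c
        p₂ = solve-∀

      qJ : + q ℤ.* J ≡ + (x * b + β * a) ℤ.- + (y * a)
      qJ = begin
        + q ℤ.* J
          ≡⟨ p₁ (+ q) (+ x) (+ t₁) (+ s) (+ a) (+ y) (+ b) ⟩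
        (+ y ℤ.+ + s ℤ.* + q) ℤ.* + a ℤ.- + y ℤ.* + a ℤ.- + x ℤ.* (+ b ℤ.+ + q ℤ.* + t₁) ℤ.+ + x ℤ.* + b
          ≡⟨ cong₂ (λ u v → u ℤ.* + a ℤ.- + y ℤ.* + a ℤ.- + x ℤ.* v ℤ.+ + x ℤ.* + b) (sym mℤ) (sym raℤ) ⟩
        (+ r ℤ.* + x ℤ.+ + β) ℤ.* + a ℤ.- + y ℤ.* + a ℤ.- + x ℤ.* (+ r ℤ.* + a) ℤ.+ + x ℤ.* + b
          ≡⟨ p₂ (+ x) (+ a) (+ r) (+ b) (+ β) (+ y) ⟩
        + x ℤ.* + b ℤ.+ + β ℤ.* + a ℤ.- + y ℤ.* + a
          ≡⟨ sym (cong₂ ℤ._-_ (cong₂ ℤ._+_ (ℤₚ.pos-* x b) (ℤₚ.pos-* β a)) (ℤₚ.pos-* y a)) ⟩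
        + (x * b + β * a) ℤ.- + (y * a) ∎
        where
        open ≡-Reasoning
        p₁ : ∀ q x t s a y b → q ℤ.* (s ℤ.* a ℤ.- x ℤ.* t) ≡
             (y ℤ.+ s ℤ.* q) ℤ.* a ℤ.- y ℤ.* a ℤ.- x ℤ.* (b ℤ.+ q ℤ.* t) ℤ.+ x ℤ.* b
        p₁ = solve-∀
        p₂ : ∀ x a r b β y → (r ℤ.* x ℤ.+ β) ℤ.* a ℤ.- y ℤ.* a ℤ.- x ℤ.* (r ℤ.* a) ℤ.+ x ℤ.* b ≡
             x ℤ.* b ℤ.+ β ℤ.* a ℤ.- y ℤ.* a
        p₂ = solve-∀

      IJ-x : I ℤ.* + a ℤ.+ J ℤ.* + c ≡ + x
      IJ-x = trans (p₁ (+ x) (+ t₁) (+ t₂) (+ s) (+ a) (+ c))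
             (trans (cong (λ u → + x ℤ.* u ℤ.- + x ℤ.* (+ t₁ ℤ.* + c)) unitℤ) (p₂ (+ x) (+ t₁ ℤ.* + c)))
        where
        p₁ : ∀ x t₁ t₂ s a c → (x ℤ.* t₂ ℤ.- s ℤ.* c) ℤ.* a ℤ.+ (s ℤ.* a ℤ.- x ℤ.* t₁) ℤ.* c ≡
             x ℤ.* (t₂ ℤ.* a) ℤ.- x ℤ.* (t₁ ℤ.* c)
        p₁ = solve-∀
        p₂ : ∀ x u → x ℤ.* (1ℤ ℤ.+ u) ℤ.- x ℤ.* u ≡ x
        p₂ = solve-∀

      IJ-y : I ℤ.* + b ℤ.- J ℤ.* + d ℤ.+ + β ≡ + y
      IJ-y = begin
        I ℤ.* + b ℤ.- J ℤ.* + d ℤ.+ + β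
          ≡⟨ p₁ (+ x) (+ t₁) (+ t₂) (+ s) (+ a) (+ b) (+ c) (+ d) (+ β) ⟩
        + x ℤ.* (+ t₂ ℤ.* + b ℤ.+ + t₁ ℤ.* + d) ℤ.- + s ℤ.* (+ a ℤ.* + d ℤ.+ + b ℤ.* + c) ℤ.+ + β
          ≡⟨ cong₂ (λ u v → + x ℤ.* u ℤ.- + s ℤ.* v ℤ.+ + β) cofactor areaℤ ⟩
        + x ℤ.* + r ℤ.- + s ℤ.* + q ℤ.+ + β
          ≡⟨ p₂ (+ x) (+ r) (+ s) (+ q) (+ β) ⟩
        + r ℤ.* + x ℤ.+ + β ℤ.- + s ℤ.* + q
          ≡⟨ cong (ℤ._- + s ℤ.* + q) mℤ ⟩
        + y ℤ.+ + s ℤ.* + q ℤ.- + s ℤ.* + q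
          ≡⟨ p₃ (+ y) (+ s ℤ.* + q) ⟩
        + y ∎
        where
        open ≡-Reasoning
        p₁ : ∀ x t₁ t₂ s a b c d β →
             (x ℤ.* t₂ ℤ.- s ℤ.* c) ℤ.* b ℤ.- (s ℤ.* a ℤ.- x ℤ.* t₁) ℤ.* d ℤ.+ β ≡
             x ℤ.* (t₂ ℤ.* b ℤ.+ t₁ ℤ.* d) ℤ.- s ℤ.* (a ℤ.* d ℤ.+ b ℤ.* c) ℤ.+ β
        p₁ = solve-∀
        p₂ : ∀ x r s q β → x ℤ.* r ℤ.- s ℤ.* q ℤ.+ β ≡ r ℤ.* x ℤ.+ β ℤ.- s ℤ.* q
        p₂ = solve-∀
        p₃ : ∀ y u → y ℤ.+ u ℤ.- u ≡ y
        p₃ = solve-∀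

      -- So w, which vanishes outside one period, picks out a single lattice point over each x.
      unique : ∀ I′ J′ y′ → y′ < q → I′ ℤ.* + a ℤ.+ J′ ℤ.* + c ≡ + x →
               I′ ℤ.* + b ℤ.- J′ ℤ.* + d ℤ.+ + β ≡ + y′ → I′ ≡ I × J′ ≡ J
      unique I′ J′ y′ y′<q eqx eqy = I′≡I , J′≡J
        where
        open ≡-Reasoning
        S : ℤ
        S = I′ ℤ.* + t₁ ℤ.+ J′ ℤ.* + t₂
        S≡s : S ≡ + s
        S≡s = mod-unique m y′ S y′<q (begin
          + m
            ≡⟨ cong (ℤ._+ + β) (ℤₚ.pos-* r x) ⟩
          + r ℤ.* + x ℤ.+ + β
            ≡⟨ cong (λ u → + r ℤ.* u ℤ.+ + β) (sym eqx) ⟩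
          + r ℤ.* (I′ ℤ.* + a ℤ.+ J′ ℤ.* + c) ℤ.+ + β
            ≡⟨ p₁ (+ r) I′ (+ a) J′ (+ c) (+ β) (+ d) ⟩
          I′ ℤ.* (+ r ℤ.* + a) ℤ.+ J′ ℤ.* (+ d ℤ.+ + r ℤ.* + c) ℤ.- J′ ℤ.* + d ℤ.+ + β
            ≡⟨ cong₂ (λ u v → I′ ℤ.* u ℤ.+ J′ ℤ.* v ℤ.- J′ ℤ.* + d ℤ.+ + β) raℤ rcℤ ⟩
          I′ ℤ.* (+ b ℤ.+ + q ℤ.* + t₁) ℤ.+ J′ ℤ.* (+ q ℤ.* + t₂) ℤ.- J′ ℤ.* + d ℤ.+ + β
            ≡⟨ p₂ I′ (+ b) (+ q) (+ t₁) J′ (+ t₂) (+ d) (+ β) ⟩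
          I′ ℤ.* + b ℤ.- J′ ℤ.* + d ℤ.+ + β ℤ.+ + q ℤ.* S
            ≡⟨ cong (ℤ._+ + q ℤ.* S) eqy ⟩
          + y′ ℤ.+ + q ℤ.* S ∎)
          where
          p₁ : ∀ r I a J c β d → r ℤ.* (I ℤ.* a ℤ.+ J ℤ.* c) ℤ.+ β ≡
               I ℤ.* (r ℤ.* a) ℤ.+ J ℤ.* (d ℤ.+ r ℤ.* c) ℤ.- J ℤ.* d ℤ.+ β
          p₁ = solve-∀
          p₂ : ∀ I b q t₁ J t₂ d β → I ℤ.* (b ℤ.+ q ℤ.* t₁) ℤ.+ J ℤ.* (q ℤ.* t₂) ℤ.- J ℤ.* d ℤ.+ β ≡
               I ℤ.* b ℤ.- J ℤ.* d ℤ.+ β ℤ.+ q ℤ.* (I ℤ.* t₁ ℤ.+ J ℤ.* t₂)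
          p₂ = solve-∀
        absorb : ∀ u v → u ℤ.* (1ℤ ℤ.+ v) ℤ.- u ℤ.* v ≡ u
        absorb = solve-∀
        I′≡I : I′ ≡ I
        I′≡I = begin
          I′
            ≡⟨ sym (absorb I′ (+ t₁ ℤ.* + c)) ⟩
          I′ ℤ.* (1ℤ ℤ.+ + t₁ ℤ.* + c) ℤ.- I′ ℤ.* (+ t₁ ℤ.* + c)
            ≡⟨ cong (λ u → I′ ℤ.* u ℤ.- I′ ℤ.* (+ t₁ ℤ.* + c)) (sym unitℤ) ⟩
          I′ ℤ.* (+ t₂ ℤ.* + a) ℤ.- I′ ℤ.* (+ t₁ ℤ.* + c)
            ≡⟨ p I′ J′ (+ t₁) (+ t₂) (+ a) (+ c) ⟩
          (I′ ℤ.* + a ℤ.+ J′ ℤ.* + c) ℤ.* + t₂ ℤ.- S ℤ.* + c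
            ≡⟨ cong₂ (λ u v → u ℤ.* + t₂ ℤ.- v ℤ.* + c) eqx S≡s ⟩
          I ∎
          where
          p : ∀ I J t₁ t₂ a c → I ℤ.* (t₂ ℤ.* a) ℤ.- I ℤ.* (t₁ ℤ.* c) ≡
              (I ℤ.* a ℤ.+ J ℤ.* c) ℤ.* t₂ ℤ.- (I ℤ.* t₁ ℤ.+ J ℤ.* t₂) ℤ.* c
          p = solve-∀
        J′≡J : J′ ≡ J
        J′≡J = begin
          J′
            ≡⟨ sym (absorb J′ (+ t₁ ℤ.* + c)) ⟩
          J′ ℤ.* (1ℤ ℤ.+ + t₁ ℤ.* + c) ℤ.- J′ ℤ.* (+ t₁ ℤ.* + c)
            ≡⟨ cong (λ u → J′ ℤ.* u ℤ.- J′ ℤ.* (+ t₁ ℤ.* + c)) (sym unitℤ) ⟩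
          J′ ℤ.* (+ t₂ ℤ.* + a) ℤ.- J′ ℤ.* (+ t₁ ℤ.* + c)
            ≡⟨ p I′ J′ (+ t₁) (+ t₂) (+ a) (+ c) ⟩
          S ℤ.* + a ℤ.- (I′ ℤ.* + a ℤ.+ J′ ℤ.* + c) ℤ.* + t₁
            ≡⟨ cong₂ (λ u v → u ℤ.* + a ℤ.- v ℤ.* + t₁) S≡s eqx ⟩
          J ∎
          where
          p : ∀ I J t₁ t₂ a c → J ℤ.* (t₂ ℤ.* a) ℤ.- J ℤ.* (t₁ ℤ.* c) ≡
              (I ℤ.* t₁ ℤ.+ J ℤ.* t₂) ℤ.* a ℤ.- (I ℤ.* a ℤ.+ J ℤ.* c) ℤ.* t₁
          p = solve-∀

      private
        located-i : ∃[ n ] (+ n ≡ I ℤ.+ + (2 * C) × n ≤ 2 * C + 2 * C)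
        located-i = shift-nonNeg I qI
          (ℕₚ.≤-trans (ℕₚ.*-mono-≤ β≤2q (ℕₚ.m≤m⊔n c d)) (ℕₚ.≤-reflexive (p₁ q C)))
          (ℕₚ.≤-trans (ℕₚ.+-mono-≤ (ℕₚ.*-mono-≤ x≤q (ℕₚ.m≤n⊔m c d)) (ℕₚ.*-mono-≤ y≤q (ℕₚ.m≤m⊔n c d)))
                      (ℕₚ.≤-reflexive (p₂ q C)))
          where
          p₁ : ∀ q C → 2 * q * C ≡ q * (2 * C)
          p₁ = ℕ-Solver.solve-∀
          p₂ : ∀ q C → q * C + q * C ≡ q * (2 * C)
          p₂ = ℕ-Solver.solve-∀
        located-j : ∃[ n ] (+ n ≡ J ℤ.+ + A × n ≤ 3 * A + A)
        located-j = shift-nonNeg J qJ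
          (ℕₚ.*-mono-≤ y≤q (ℕₚ.m≤m⊔n a b))
          (ℕₚ.≤-trans (ℕₚ.+-mono-≤ (ℕₚ.*-mono-≤ x≤q (ℕₚ.m≤n⊔m a b)) (ℕₚ.*-mono-≤ β≤2q (ℕₚ.m≤m⊔n a b)))
                      (ℕₚ.≤-reflexive (p q A)))
          where
          p : ∀ q A → q * A + 2 * q * A ≡ q * (3 * A)
          p = ℕ-Solver.solve-∀
        -- The shifted coefficients run from 0 to 4 n ≤ 16 L inclusive, so 17 blocks of length L
        -- contain them.
        4n<17L : ∀ {n L} → 1 ≤ L → n ≤ 4 * L → 4 * n < 17 * L
        4n<17L {n} {L} 1≤L n≤4L = ℕₚ.≤-<-trans (ℕₚ.*-monoʳ-≤ 4 n≤4L)
          (subst (_< 17 * L) (ℕₚ.*-assoc 4 4 L) (ℕₚ.*-monoˡ-< L {{ℕ.>-nonZero 1≤L}} (ℕₚ.n<1+n 16)))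
        unshift : ∀ {u o z} → u ≡ z ℤ.+ o → u ℤ.- o ≡ z
        unshift {u} {o} {z} refl = p z o
          where
          p : ∀ z o → z ℤ.+ o ℤ.- o ≡ z
          p = solve-∀
        reshift : ∀ {u o z} → u ℤ.- o ≡ z → u ≡ z ℤ.+ o
        reshift {u} {o} refl = p u o
          where
          p : ∀ u o → u ≡ u ℤ.- o ℤ.+ o
          p = solve-∀

      fibre-sum : ∑[ i < 17 * L₁ ] ∑[ j < 17 * L₂ ] (δ (X i j) x ℤ.* w (Y i j)) ≡ w (+ y)
      fibre-sum with located-i | located-j
      ... | k , k≡ , k≤ | l , l≡ , l≤ = trans
          (∑∑-single (17 * L₁) (17 * L₂)
            (ℕₚ.≤-<-trans (subst (k ≤_) (p₁ C) k≤) (4n<17L 1≤L₁ C≤4L₁))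
            (ℕₚ.≤-<-trans (subst (l ≤_) (p₂ A) l≤) (4n<17L 1≤L₂ A≤4L₂))
            vanish)
          (trans (cong₂ ℤ._*_ (δ-≡ {x = x} X≡x) (cong w Y≡y)) (ℤₚ.*-identityˡ (w (+ y))))
        where
        p₁ : ∀ C → 2 * C + 2 * C ≡ 4 * C
        p₁ = ℕ-Solver.solve-∀
        p₂ : ∀ A → 3 * A + A ≡ 4 * A
        p₂ = ℕ-Solver.solve-∀
        X≡x : X k l ≡ + x
        X≡x = trans (cong₂ (λ u v → u ℤ.* + a ℤ.+ v ℤ.* + c)
                (unshift {o = + (2 * C)} {I} k≡) (unshift {o = + A} {J} l≡)) IJ-x
        Y≡y : Y k l ≡ + y
        Y≡y = trans (cong₂ (λ u v → u ℤ.* + b ℤ.- v ℤ.* + d ℤ.+ + β)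
                (unshift {o = + (2 * C)} {I} k≡) (unshift {o = + A} {J} l≡)) IJ-y
        vanish : ∀ i j → i < 17 * L₁ → j < 17 * L₂ → (i ≡ k → j ≢ l) → δ (X i j) x ℤ.* w (Y i j) ≡ 0ℤ
        vanish i j _ _ i≢k∨j≢l with X i j ℤₚ.≟ + x
        ... | no  X≢x = refl
        ... | yes Xij≡x = cong (ℤ._*_ 1ℤ) (outside (Y i j) refl)
          where
          outside : ∀ z → z ≡ Y i j → w z ≡ 0ℤ
          outside -[1+ n ] _ = w-early -[1+ n ] ℤ.-≤+
          outside (+ n) z≡ with q ℕₚ.≤? n
          ... | yes q≤n = w-late n q≤n
          ... | no  q≰n with unique (+ i ℤ.- + (2 * C)) (+ j ℤ.- + A) n (ℕₚ.≰⇒> q≰n) Xij≡x (sym z≡)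
          ...   | I′≡I , J′≡J = ⊥-elim (i≢k∨j≢l
                  (ℤₚ.+-injective (trans (reshift I′≡I) (sym k≡)))
                  (ℤₚ.+-injective (trans (reshift J′≡J) (sym l≡))))

  unfold : ∀ ε → ∑[ x < N ] (ε x ℤ.* w (+ ((r * x + β) % q))) ≡
                 ∑[ i < 17 * L₁ ] ∑[ j < 17 * L₂ ] (extend N ε (X i j) ℤ.* w (Y i j))
  unfold ε = trans
    (∑-cong N λ x x<N → cong (ℤ._*_ (ε x)) (sym (Fibre.fibre-sum x (ℕₚ.≤-trans (ℕₚ.<⇒≤ x<N) N≤q))))
    (sym (∑∑-extend N ε (17 * L₁) (17 * L₂) X (λ i j → w (Y i j))))

-- Smooth weights summed over blocks.

∑∑-blocks-bound : ∀ k m n (f : ℕ → ℕ → ℤ) {B} →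
  (∀ u v → ∣ ∑[ i < m ] ∑[ j < n ] f (u * m + i) (v * n + j) ∣ ≤ B) →
  ∣ ∑[ i < k * m ] ∑[ j < k * n ] f i j ∣ ≤ k * (k * B)
∑∑-blocks-bound k m n f {B} h = subst (λ z → ∣ z ∣ ≤ k * (k * B)) (sym eq)
  (∑-∣∣ k _ λ u _ → ∑-∣∣ k _ λ v _ → h u v)
  where
  eq : ∑[ i < k * m ] ∑[ j < k * n ] f i j ≡
       ∑[ u < k ] ∑[ v < k ] ∑[ i < m ] ∑[ j < n ] f (u * m + i) (v * n + j)
  eq = trans (∑-blocks k m (λ i → ∑ (k * n) (f i)))
       (∑-ext k λ u → trans
         (∑-ext m λ i → ∑-blocks k n (f (u * m + i)))
         (∑-swap m k (λ i v → ∑[ j < n ] f (u * m + i) (v * n + j))))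

module Smooth (w : ℤ → ℤ) {W₁ W₂ : ℕ}
              (step₁ : ∀ z → ∣ w (z ℤ.+ 1ℤ) ℤ.- w z ∣ ≤ W₁)
              (step₂ : ∀ z → ∣ (w (z ℤ.+ 1ℤ ℤ.+ 1ℤ) ℤ.- w (z ℤ.+ 1ℤ)) ℤ.- (w (z ℤ.+ 1ℤ) ℤ.- w z) ∣ ≤ W₂) where

  difference-bound : ∀ n {z z′} → z′ ≡ z ℤ.+ + n → ∣ w z′ ℤ.- w z ∣ ≤ n * W₁
  difference-bound n {z} refl = steps⇒Lipschitz w step₁ n z

  difference-bound′ : ∀ n {z z′} → z′ ≡ z ℤ.+ + n → ∣ w z ℤ.- w z′ ∣ ≤ n * W₁
  difference-bound′ n {z} {z′} eq = subst (_≤ n * W₁) (ℤₚ.∣i-j∣≡∣j-i∣ (w z′) (w z)) (difference-bound n eq)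

  -- The Lipschitz estimate applied twice: to the first difference of `w`, so that increments over
  -- length m vary slowly, and then to these increments.
  mixed-difference : ∀ m n z →
    ∣ (w (z ℤ.+ + m) ℤ.- w z) ℤ.- (w (z ℤ.+ + n ℤ.+ + m) ℤ.- w (z ℤ.+ + n)) ∣ ≤ n * (m * W₂)
  mixed-difference m n z = subst (_≤ n * (m * W₂)) (ℤₚ.∣i-j∣≡∣j-i∣ (g (z ℤ.+ + n)) (g z))
    (steps⇒Lipschitz g g-step n z)
    where
    g v : ℤ → ℤ
    g y = w (y ℤ.+ + m) ℤ.- w y
    v y = w (y ℤ.+ 1ℤ) ℤ.- w y
    g-step : ∀ y → ∣ g (y ℤ.+ 1ℤ) ℤ.- g y ∣ ≤ m * W₂
    g-step y = subst (λ u → ∣ u ∣ ≤ m * W₂)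
      (trans (exchange (w (y ℤ.+ + m ℤ.+ 1ℤ)) (w (y ℤ.+ + m)) (w (y ℤ.+ 1ℤ)) (w y))
             (cong (λ u → w u ℤ.- w (y ℤ.+ 1ℤ) ℤ.- g y) (commute y (+ m))))
      (steps⇒Lipschitz v step₂ m y)
      where
      exchange : ∀ a b c d → (a ℤ.- b) ℤ.- (c ℤ.- d) ≡ (a ℤ.- c) ℤ.- (b ℤ.- d)
      exchange = solve-∀
      commute : ∀ y m → y ℤ.+ m ℤ.+ 1ℤ ≡ y ℤ.+ 1ℤ ℤ.+ m
      commute = solve-∀

  mixed-difference-bound : ∀ m n {z z₁ z₂ z₃} → z₁ ≡ z ℤ.+ + m → z₂ ≡ z ℤ.+ + n → z₃ ≡ z₂ ℤ.+ + m →
    ∣ (w z₁ ℤ.- w z) ℤ.- (w z₃ ℤ.- w z₂) ∣ ≤ n * (m * W₂)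
  mixed-difference-bound m n {z} refl refl refl = mixed-difference m n z

module _ {q r : ℕ} .{{_ : NonZero q}} (basis : Basis q r) (reduced : Reduced basis)
         {N : ℕ} (N≤q : N ≤ q) (q≤2N : q ≤ 2 * N) (1≤N : 1 ≤ N)
         (β : ℕ) (β≤2q : β ≤ 2 * q)
         (w : ℤ → ℤ) (w-early : ∀ z → z ℤ.≤ 0ℤ → w z ≡ 0ℤ) (w-late : ∀ n → q ≤ n → w (+ n) ≡ 0ℤ)
         (w-bound : ∀ z → ∣ w z ∣ ≤ q * (q * 8))
         (step₁ : ∀ z → ∣ w (z ℤ.+ 1ℤ) ℤ.- w z ∣ ≤ q * 8)
         (step₂ : ∀ z → ∣ (w (z ℤ.+ 1ℤ ℤ.+ 1ℤ) ℤ.- w (z ℤ.+ 1ℤ)) ℤ.- (w (z ℤ.+ 1ℤ) ℤ.- w z) ∣ ≤ 8)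
         {ε : ℕ → ℤ} {D : ℕ} (rectangle : RectangleBound N ε D) where

  open Basis basis
  open Lattice basis reduced N≤q q≤2N
  open Unfolding basis reduced N≤q q≤2N β β≤2q w w-early w-late
  open Smooth w step₁ step₂

  private
    X-shift : ∀ i₀ j₀ i j → X (i₀ + i) (j₀ + j) ≡ X i₀ j₀ ℤ.+ + (i * a + j * c)
    X-shift i₀ j₀ i j = trans (p (+ i₀) (+ i) (+ (2 * C)) (+ a) (+ j₀) (+ j) (+ A) (+ c))
      (cong (ℤ._+_ (X i₀ j₀)) (sym (cong₂ ℤ._+_ (ℤₚ.pos-* i a) (ℤₚ.pos-* j c))))
      where
      p : ∀ i₀ i o a j₀ j o′ c →
        (i₀ ℤ.+ i ℤ.- o) ℤ.* a ℤ.+ (j₀ ℤ.+ j ℤ.- o′) ℤ.* c ≡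
        ((i₀ ℤ.- o) ℤ.* a ℤ.+ (j₀ ℤ.- o′) ℤ.* c) ℤ.+ (i ℤ.* a ℤ.+ j ℤ.* c)
      p = solve-∀

    Y-sucˡ : ∀ i₀ i j → Y (i₀ + suc i) j ≡ Y (i₀ + i) j ℤ.+ + b
    Y-sucˡ i₀ i j = p (+ i₀) (+ i) (+ (2 * C)) (+ b) ((+ j ℤ.- + A) ℤ.* + d) (+ β)
      where
      p : ∀ i₀ i o b y β → (i₀ ℤ.+ (1ℤ ℤ.+ i) ℤ.- o) ℤ.* b ℤ.- y ℤ.+ β ≡
          ((i₀ ℤ.+ i ℤ.- o) ℤ.* b ℤ.- y ℤ.+ β) ℤ.+ b
      p = solve-∀

    -- `Y` falls by d as j grows, so the later point serves as the base of the shift.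
    Y-sucʳ : ∀ j₀ i j → Y i (j₀ + j) ≡ Y i (j₀ + suc j) ℤ.+ + d
    Y-sucʳ j₀ i j = p (+ j₀) (+ j) (+ A) (+ d) ((+ i ℤ.- + (2 * C)) ℤ.* + b) (+ β)
      where
      p : ∀ j₀ j o d y β → y ℤ.- (j₀ ℤ.+ j ℤ.- o) ℤ.* d ℤ.+ β ≡
          (y ℤ.- (j₀ ℤ.+ (1ℤ ℤ.+ j) ℤ.- o) ℤ.* d ℤ.+ β) ℤ.+ d
      p = solve-∀

    weighted-block : ∀ i₀ j₀ →
      ∣ ∑[ i < L₁ ] ∑[ j < L₂ ] (extend N ε (X (i₀ + i) (j₀ + j)) ℤ.* w (Y (i₀ + i) (j₀ + j))) ∣ ≤
      D * (72 * (q * q))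
    weighted-block i₀ j₀ = ℕₚ.≤-trans
      (∑∑-abel-bound L₁ L₂ (λ i j → extend N ε (X (i₀ + i) (j₀ + j))) φ sums (λ i j → w-bound _) φ-sucʳ φ-sucˡ φ-mixed)
      total
      where
      φ : ℕ → ℕ → ℤ
      φ i j = w (Y (i₀ + i) (j₀ + j))
      sums : ∀ k l → k ≤ L₁ → l ≤ L₂ → ∣ ∑[ i < k ] ∑[ j < l ] extend N ε (X (i₀ + i) (j₀ + j)) ∣ ≤ D
      sums k l k≤ l≤ = subst (λ z → ∣ z ∣ ≤ D)
        (∑-ext k λ i → ∑-ext l λ j → cong (extend N ε) (sym (X-shift i₀ j₀ i j)))
        (block-bound {ε = ε} rectangle 1≤N (X i₀ j₀) k l k≤ l≤)
      φ-sucˡ : ∀ i j → ∣ φ (suc i) j ℤ.- φ i j ∣ ≤ b * (q * 8)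
      φ-sucˡ i j = difference-bound b (Y-sucˡ i₀ i (j₀ + j))
      φ-sucʳ : ∀ i j → ∣ φ i (suc j) ℤ.- φ i j ∣ ≤ d * (q * 8)
      φ-sucʳ i j = difference-bound′ d (Y-sucʳ j₀ (i₀ + i) j)
      φ-mixed : ∀ i j → ∣ (φ (suc i) (suc j) ℤ.- φ i (suc j)) ℤ.- (φ (suc i) j ℤ.- φ i j) ∣ ≤ d * (b * 8)
      φ-mixed i j = mixed-difference-bound b d
        (Y-sucˡ i₀ i (j₀ + suc j)) (Y-sucʳ j₀ (i₀ + i) j) (Y-sucˡ i₀ i (j₀ + j))
      open ℕₚ.≤-Reasoning
      -- 72 = 8 (1 + 2) (1 + 2): each direction contributes the value itself and, by L₁ b ≤ 2 q and
      -- L₂ d ≤ 2 q, twice as much from its variation.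
      total : (D * (q * (q * 8)) + L₂ * (D * (d * (q * 8)))) + L₁ * (D * (b * (q * 8)) + L₂ * (D * (d * (b * 8)))) ≤
              D * (72 * (q * q))
      total = begin
        (D * (q * (q * 8)) + L₂ * (D * (d * (q * 8)))) + L₁ * (D * (b * (q * 8)) + L₂ * (D * (d * (b * 8))))
          ≡⟨ p₁ D q L₁ b L₂ d ⟩
        D * (8 * (q * q) + 8 * (L₂ * d * q) + 8 * (L₁ * b * q) + 8 * (L₁ * b * (L₂ * d)))
          ≤⟨ ℕₚ.*-monoʳ-≤ D (ℕₚ.+-mono-≤ (ℕₚ.+-mono-≤ (ℕₚ.+-monoʳ-≤ (8 * (q * q))
               (ℕₚ.*-monoʳ-≤ 8 (ℕₚ.*-monoˡ-≤ q L₂d≤2q)))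
               (ℕₚ.*-monoʳ-≤ 8 (ℕₚ.*-monoˡ-≤ q L₁b≤2q)))
               (ℕₚ.*-monoʳ-≤ 8 (ℕₚ.*-mono-≤ L₁b≤2q L₂d≤2q))) ⟩
        D * (8 * (q * q) + 8 * (2 * q * q) + 8 * (2 * q * q) + 8 * (2 * q * (2 * q)))
          ≡⟨ cong (D *_) (p₂ q) ⟩
        D * (72 * (q * q)) ∎
        where
        p₁ : ∀ D q L₁ b L₂ d →
          (D * (q * (q * 8)) + L₂ * (D * (d * (q * 8)))) + L₁ * (D * (b * (q * 8)) + L₂ * (D * (d * (b * 8)))) ≡
          D * (8 * (q * q) + 8 * (L₂ * d * q) + 8 * (L₁ * b * q) + 8 * (L₁ * b * (L₂ * d)))
        p₁ = ℕ-Solver.solve-∀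
        p₂ : ∀ q → 8 * (q * q) + 8 * (2 * q * q) + 8 * (2 * q * q) + 8 * (2 * q * (2 * q)) ≡ 72 * (q * q)
        p₂ = ℕ-Solver.solve-∀

  smooth-transform-bound : ∣ ∑[ x < N ] (ε x ℤ.* w (+ ((r * x + β) % q))) ∣ ≤ 17 * (17 * (D * (72 * (q * q))))
  smooth-transform-bound = subst (λ z → ∣ z ∣ ≤ 17 * (17 * (D * (72 * (q * q))))) (sym (unfold ε))
    (∑∑-blocks-bound 17 L₁ L₂ (λ i j → extend N ε (X i j) ℤ.* w (Y i j))
      λ u v → weighted-block (u * L₁) (v * L₂))

-- Comparison of energies: the lower bound.

∃-power-of-2 : ∀ N → 1 ≤ N → ∃[ ℓ ] (N ≤ 2 ^ ℓ × 2 ^ ℓ ≤ 2 * N)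
∃-power-of-2 (suc zero)    _ = 0 , ℕₚ.≤-refl , ℕₚ.m≤m+n 1 1
∃-power-of-2 (suc (suc n)) _ with ∃-power-of-2 (suc n) (s≤s z≤n)
... | ℓ , ≤pow , pow≤ with suc (suc n) ℕₚ.≤? 2 ^ ℓ
...   | yes le = ℓ , le , ℕₚ.≤-trans pow≤ (ℕₚ.*-monoʳ-≤ 2 (ℕₚ.n≤1+n (suc n)))
...   | no  nle = suc ℓ , ℕₚ.≤-trans (s≤s (s≤s (ℕₚ.m≤m+n n (n + 0))))
                            (ℕₚ.≤-trans (ℕₚ.≤-reflexive (p n)) (ℕₚ.*-monoʳ-≤ 2 ≤pow))
                        , ℕₚ.*-monoʳ-≤ 2 (ℕₚ.<⇒≤ (ℕₚ.≰⇒> nle))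
  where
  p : ∀ n → 2 + (n + (n + 0)) ≡ 2 * (1 + n)
  p = ℕ-Solver.solve-∀

i*i≥0 : ∀ i → 0ℤ ℤ.≤ i ℤ.* i
i*i≥0 (+ n)    = subst (0ℤ ℤ.≤_) (ℤₚ.pos-* n n) (ℤ.+≤+ z≤n)
i*i≥0 -[1+ n ] = ℤ.+≤+ z≤n

∑-nonNeg : ∀ n {f : ℕ → ℤ} → (∀ i → 0ℤ ℤ.≤ f i) → 0ℤ ℤ.≤ ∑ n f
∑-nonNeg zero    h = ℤₚ.≤-refl
∑-nonNeg (suc n) h = ℤₚ.+-mono-≤ (∑-nonNeg n h) (h n)

∑-window : ∀ {q} m n (f : ℕ → ℤ) → m + n ≤ q → (∀ i → 0ℤ ℤ.≤ f i) → ∑[ i < n ] f (m + i) ℤ.≤ ∑ q f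
∑-window m n f m+n≤q f≥0 with ℕₚ.m≤n⇒∃[o]m+o≡n m+n≤q
... | o , refl = begin
  ∑[ i < n ] f (m + i)            ≡⟨ sym (ℤₚ.+-identityˡ _) ⟩
  0ℤ ℤ.+ ∑[ i < n ] f (m + i)     ≤⟨ ℤₚ.+-monoˡ-≤ _ (∑-nonNeg m f≥0) ⟩
  ∑ m f ℤ.+ ∑[ i < n ] f (m + i)  ≡⟨ sym (∑-split m n f) ⟩
  ∑ (m + n) f                     ≡⟨ sym (ℤₚ.+-identityʳ _) ⟩
  ∑ (m + n) f ℤ.+ 0ℤ              ≤⟨ ℤₚ.+-monoʳ-≤ (∑ (m + n) f) (∑-nonNeg o (λ i → f≥0 (m + n + i))) ⟩
  ∑ (m + n) f ℤ.+ ∑[ i < o ] f (m + n + i) ≡⟨ sym (∑-split (m + n) o f) ⟩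
  ∑ (m + n + o) f ∎
  where open ℤₚ.≤-Reasoning

triangular-mono : ∀ m i → triangular m ≤ triangular (m + i)
triangular-mono m zero    = ℕₚ.≤-reflexive (cong triangular (sym (ℕₚ.+-identityʳ m)))
triangular-mono m (suc i) = ℕₚ.≤-trans (triangular-mono m i)
  (subst (λ n → triangular (m + i) ≤ triangular n) (sym (ℕₚ.+-suc m i)) (ℕₚ.m≤n+m _ (m + i)))

n*n≤4*triangular : ∀ n → 2 ≤ n → n * n ≤ 4 * triangular n
n*n≤4*triangular (suc zero) (s≤s ())
n*n≤4*triangular (suc (suc zero)) _ = ℕₚ.≤-refl
n*n≤4*triangular (suc (suc (suc n))) _ = ℕₚ.≤-trans
  (subst₂ _≤_ (p₁ n) refl (ℕₚ.+-mono-≤ (n*n≤4*triangular (suc (suc n)) (s≤s (s≤s z≤n))) (ℕₚ.m≤m+n (2 * n + 5) (2 * n + 3))))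
  (ℕₚ.≤-reflexive (p₂ n (triangular (suc (suc n)))))
  where
  p₁ : ∀ n → (2 + n) * (2 + n) + (2 * n + 5) ≡ (3 + n) * (3 + n)
  p₁ = ℕ-Solver.solve-∀
  p₂ : ∀ n t → 4 * t + (2 * n + 5 + (2 * n + 3)) ≡ 4 * (2 + n + t)
  p₂ = ℕ-Solver.solve-∀

-- 4096² = 16 · 16 · 256²: one 16 from q = 16 ρ, one from T² ≥ ρ⁴ / 16, and 256² from (q²)² = (256
-- ρ²)².
energy-arithmetic : ∀ {q ρ T D N} g .{{_ : NonZero ρ}} → q ≡ 16 * ρ → ρ * ρ ≤ 4 * T →
  q * (ρ * (T * T)) * N ≤ q * (q * (g * (D * (q * q)) * (g * (D * (q * q))))) →
  N ≤ g * 4096 * (g * 4096) * (D * D)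
energy-arithmetic {q} {ρ} {T} {D} {N} g refl ρ²≤4T le = ℕₚ.*-cancelˡ-≤ (ρ * (ρ * ρ * (ρ * ρ)))
  {{ℕₚ.m*n≢0 ρ _ {{it}} {{ℕₚ.m*n≢0 (ρ * ρ) (ρ * ρ) {{ℕₚ.m*n≢0 ρ ρ}} {{ℕₚ.m*n≢0 ρ ρ}}}}}} (begin
  ρ * (ρ * ρ * (ρ * ρ)) * N
    ≤⟨ ℕₚ.*-monoˡ-≤ N (ℕₚ.*-monoʳ-≤ ρ (ℕₚ.*-mono-≤ ρ²≤4T ρ²≤4T)) ⟩
  ρ * (4 * T * (4 * T)) * N
    ≡⟨ p₁ ρ T N ⟩
  16 * (ρ * (T * T) * N)
    ≤⟨ ℕₚ.*-monoʳ-≤ 16 (ℕₚ.*-cancelˡ-≤ (16 * ρ) {{ℕₚ.m*n≢0 16 ρ}}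
         (subst (_≤ q * (q * (g * (D * (q * q)) * (g * (D * (q * q)))))) (ℕₚ.*-assoc (16 * ρ) (ρ * (T * T)) N) le)) ⟩
  16 * (q * (g * (D * (q * q)) * (g * (D * (q * q)))))
    ≡⟨ p₂ ρ g D ⟩
  ρ * (ρ * ρ * (ρ * ρ)) * (g * 4096 * (g * 4096) * (D * D)) ∎)
  where
  open ℕₚ.≤-Reasoning
  it : NonZero ρ
  it = ℕ.>-nonZero (ℕ.>-nonZero⁻¹ ρ)
  p₁ : ∀ ρ T N → ρ * (4 * T * (4 * T)) * N ≡ 16 * (ρ * (T * T) * N)
  p₁ = ℕ-Solver.solve-∀
  p₂ : ∀ ρ g D →
    16 * (16 * ρ * (g * (D * (16 * ρ * (16 * ρ))) * (g * (D * (16 * ρ * (16 * ρ)))))) ≡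
    ρ * (ρ * ρ * (ρ * ρ)) * (g * 4096 * (g * 4096) * (D * D))
  p₂ = ℕ-Solver.solve-∀

module Energy (k : ℕ) {N D : ℕ} (ε : ℕ → ℤ) (ε² : ∀ x → x < N → ε x ℤ.* ε x ≡ 1ℤ)
              (1≤N : 1 ≤ N) (N≤q : N ≤ 2 ^ (4 + k) + 2 ^ (4 + k)) (q≤2N : 2 ^ (4 + k) + 2 ^ (4 + k) ≤ 2 * N)
              (rectangle : RectangleBound N ε D) where

  private
    -- The knots of the spline are s = q / 8 apart, so its support has length 3 q / 8 < M = q / 2
    -- and does not overlap its translate by M modulo q. The window [ρ , 2 ρ) lies in the first
    -- piece.
    ρ M q s : ℕ
    ρ = 2 ^ suc k
    M = 2 ^ (4 + k)
    q = M + M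
    s = ρ + ρ

    M≡8ρ : M ≡ 8 * ρ
    M≡8ρ = p ρ
      where
      p : ∀ ρ → 2 * (2 * (2 * ρ)) ≡ 8 * ρ
      p = ℕ-Solver.solve-∀

    q≡16ρ : q ≡ 16 * ρ
    q≡16ρ = trans (cong₂ _+_ M≡8ρ M≡8ρ) (sym (ℕₚ.*-distribʳ-+ ρ 8 8))

    2≤ρ : 2 ≤ ρ
    2≤ρ = ℕₚ.*-monoʳ-≤ 2 (ℕₚ.m^n>0 2 k)

    instance
      ρ≢0 : NonZero ρ
      ρ≢0 = ℕ.>-nonZero (ℕₚ.≤-trans (s≤s z≤n) 2≤ρ)
      q≢0 : NonZero q
      q≢0 = ℕ.>-nonZero (ℕₚ.≤-trans (ℕₚ.m^n>0 2 (4 + k)) (ℕₚ.m≤m+n M M))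

    3s≡6ρ : s + (s + s) ≡ 6 * ρ
    3s≡6ρ = p ρ
      where
      p : ∀ ρ → ρ + ρ + (ρ + ρ + (ρ + ρ)) ≡ 6 * ρ
      p = ℕ-Solver.solve-∀

    3s≤M : s + (s + s) ≤ M
    3s≤M = subst₂ _≤_ (sym 3s≡6ρ) (sym M≡8ρ) (ℕₚ.*-monoˡ-≤ ρ (ℕₚ.m≤m+n 6 2))

    3s≤q : s + (s + s) ≤ q
    3s≤q = ℕₚ.≤-trans 3s≤M (ℕₚ.m≤m+n M M)

    w : ℤ → ℤ
    w = spline s

    w-late : ∀ n → s + (s + s) ≤ n → w (+ n) ≡ 0ℤ
    w-late = tri-late s

    step₂ : ∀ z → ∣ (w (z ℤ.+ 1ℤ ℤ.+ 1ℤ) ℤ.- w (z ℤ.+ 1ℤ)) ℤ.- (w (z ℤ.+ 1ℤ) ℤ.- w z) ∣ ≤ 8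
    step₂ z = subst (λ u → ∣ u ∣ ≤ 8)
      (sym (cong₂ ℤ._-_ (spline-step s (z ℤ.+ 1ℤ)) (spline-step s z))) (slope-step-bound s z)

    W : ℕ
    W = 17 * (17 * (D * (72 * (q * q))))

    w-transform : ∀ r β → r < q → β ≤ 2 * q → ∣ ∑[ x < N ] (ε x ℤ.* w (+ ((r * x + β) % q))) ∣ ≤ W
    w-transform r β r<q β≤2q = bound (reducedBasis q r 4≤q r<q)
      where
      4≤q : 4 ≤ q
      4≤q = ℕₚ.≤-trans (ℕₚ.*-mono-≤ (ℕₚ.m≤m+n 4 12) (ℕₚ.≤-trans (s≤s z≤n) 2≤ρ)) (ℕₚ.≤-reflexive (sym q≡16ρ))
      bound : Σ[ B ∈ Basis q r ] Reduced B → ∣ ∑[ x < N ] (ε x ℤ.* w (+ ((r * x + β) % q))) ∣ ≤ W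
      bound (basis , reduced) = smooth-transform-bound basis reduced N≤q q≤2N 1≤N β β≤2q w (spline-early s)
        (λ n q≤n → w-late n (ℕₚ.≤-trans 3s≤q q≤n))
        (λ z → ℕₚ.≤-trans (spline-bound s z) (ℕₚ.*-mono-≤ 3s≤q (ℕₚ.*-monoˡ-≤ 8 3s≤q)))
        (λ z → ℕₚ.≤-trans (spline-step-bound s z) (ℕₚ.*-monoˡ-≤ 8 3s≤q))
        step₂ {ε = ε} rectangle

    h : ℕ → ℤ
    h n = w (+ (n % q)) ℤ.- w (+ ((n + M) % q))

    h-anti : ∀ n → h (n + M) ≡ ℤ.- h n
    h-anti n = trans (cong (λ y → w (+ ((n + M) % q)) ℤ.- w (+ y))
                           (trans (cong (_% q) (ℕₚ.+-assoc n M M)) ([m+n]%n≡m%n n q)))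
                     (p (w (+ (n % q))) (w (+ ((n + M) % q))))
      where
      p : ∀ a b → b ℤ.- a ≡ ℤ.- (a ℤ.- b)
      p = solve-∀

    open Antiperiodic (4 + k) h h-anti

    -- Up to s only the first of the four truncated powers in the spline is nonzero, and n + M lies
    -- past the support.
    h-window : ∀ i → i < ρ → h (ρ + i) ≡ + triangular (ρ + i)
    h-window i i<ρ = begin
      w (+ (n % q)) ℤ.- w (+ ((n + M) % q))
        ≡⟨ cong₂ (λ u v → w (+ u) ℤ.- w (+ v)) (m<n⇒m%n≡m (ℕₚ.≤-<-trans (ℕₚ.m≤m+n n M) n+M<q)) (m<n⇒m%n≡m n+M<q) ⟩
      w (+ n) ℤ.- w (+ (n + M))
        ≡⟨ cong₂ ℤ._-_ (thirdDifference-early s tri tri-early (+ n) (ℤ.+≤+ (ℕₚ.<⇒≤ n<s)))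
                       (w-late (n + M) (ℕₚ.≤-trans 3s≤M (ℕₚ.m≤n+m M n))) ⟩
      + triangular n ℤ.- 0ℤ
        ≡⟨ ℤₚ.+-identityʳ (+ triangular n) ⟩
      + triangular n ∎
      where
      open ≡-Reasoning
      n = ρ + i
      n<s : n < s
      n<s = ℕₚ.+-monoʳ-< ρ i<ρ
      n+M<q : n + M < q
      n+M<q = ℕₚ.+-monoˡ-< M (ℕₚ.<-≤-trans n<s (ℕₚ.≤-trans (ℕₚ.m≤m+n s (s + s)) 3s≤M))

    T : ℕ
    T = triangular ρ

    norm²-bound : + (ρ * (T * T)) ℤ.≤ norm²
    norm²-bound = begin
      + (ρ * (T * T))                           ≡⟨ ℤₚ.pos-* ρ (T * T) ⟩
      + ρ ℤ.* + (T * T)                         ≡⟨ sym (∑-const ρ (+ (T * T))) ⟩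
      ∑[ _ < ρ ] (+ (T * T))                    ≤⟨ ∑-mono ρ pointwise ⟩
      ∑[ i < ρ ] (h (ρ + i) ℤ.* h (ρ + i))      ≤⟨ ∑-window ρ ρ (λ b → h b ℤ.* h b) s≤q (λ b → i*i≥0 (h b)) ⟩
      norm² ∎
      where
      open ℤₚ.≤-Reasoning
      s≤q : s ≤ q
      s≤q = ℕₚ.≤-trans (ℕₚ.m≤m+n s (s + s)) 3s≤q
      pointwise : ∀ i → i < ρ → + (T * T) ℤ.≤ h (ρ + i) ℤ.* h (ρ + i)
      pointwise i i<ρ = subst (+ (T * T) ℤ.≤_)
        (trans (ℤₚ.pos-* (triangular (ρ + i)) (triangular (ρ + i))) (sym (cong₂ ℤ._*_ (h-window i i<ρ) (h-window i i<ρ))))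
        (ℤ.+≤+ (ℕₚ.*-mono-≤ (triangular-mono ρ i) (triangular-mono ρ i)))

    -- The two halves of `h` correspond to the offsets b and b + M; this is why β is allowed up to 2
    -- q.
    h-transform : ∀ r b → r < q → b < q → ∣ transform N ε r b ∣ ≤ W + W
    h-transform r b r<q b<q = subst (λ z → ∣ z ∣ ≤ W + W) (sym eq)
      (∣-∣-mono (F b) (F (b + M)) (w-transform r b r<q b≤2q) (w-transform r (b + M) r<q b+M≤2q))
      where
      F : ℕ → ℤ
      F β = ∑[ x < N ] (ε x ℤ.* w (+ ((r * x + β) % q)))
      b≤2q : b ≤ 2 * q
      b≤2q = ℕₚ.≤-trans (ℕₚ.<⇒≤ b<q) (ℕₚ.m≤m+n q (q + 0))
      b+M≤2q : b + M ≤ 2 * q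
      b+M≤2q = ℕₚ.+-mono-≤ (ℕₚ.<⇒≤ b<q) (ℕₚ.≤-trans (ℕₚ.m≤m+n M M) (ℕₚ.m≤m+n q 0))
      distrib : ∀ e u v → e ℤ.* (u ℤ.- v) ≡ e ℤ.* u ℤ.- e ℤ.* v
      distrib = solve-∀
      eq : transform N ε r b ≡ F b ℤ.- F (b + M)
      eq = trans
        (∑-ext N λ x → trans (distrib (ε x) (w (+ ((r * x + b) % q))) (w (+ ((r * x + b + M) % q))))
          (cong (λ y → ε x ℤ.* w (+ ((r * x + b) % q)) ℤ.- ε x ℤ.* w (+ (y % q))) (ℕₚ.+-assoc (r * x) b M)))
        (∑-- N (λ x → ε x ℤ.* w (+ ((r * x + b) % q))) (λ x → ε x ℤ.* w (+ ((r * x + (b + M)) % q))))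

    energy-upper : ∣ ∑[ r < q ] ∑[ b < q ] (transform N ε r b ℤ.* transform N ε r b) ∣ ≤ q * (q * ((W + W) * (W + W)))
    energy-upper = ∑-∣∣ q _ λ r r<q → ∑-∣∣ q _ λ b b<q →
      ∣*∣-mono (transform N ε r b) (transform N ε r b) (h-transform r b r<q b<q) (h-transform r b r<q b<q)

    energy-lower : q * (ρ * (T * T)) * N ≤ ∣ ∑[ r < q ] ∑[ b < q ] (transform N ε r b ℤ.* transform N ε r b) ∣
    energy-lower = subst (λ z → q * (ρ * (T * T)) * N ≤ ∣ z ∣) (sym (transform-energy N ε N≤q))
      (subst (λ z → q * (ρ * (T * T)) * N ≤ ∣ + q ℤ.* norm² ℤ.* z ∣) (sym ones)
        (subst (q * (ρ * (T * T)) * N ≤_)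
          (sym (trans (ℤₚ.abs-* (+ q ℤ.* norm²) (+ N)) (cong (_* N) (ℤₚ.abs-* (+ q) norm²))))
          (ℕₚ.*-monoˡ-≤ N (ℕₚ.*-monoʳ-≤ q (abs-mono norm²-bound)))))
      where
      ones : ∑[ x < N ] (ε x ℤ.* ε x) ≡ + N
      ones = trans (∑-cong N ε²) (trans (∑-const N 1ℤ) (ℤₚ.*-identityʳ (+ N)))
      abs-mono : ∀ {m z} → + m ℤ.≤ z → m ≤ ∣ z ∣
      abs-mono (ℤ.+≤+ m≤n) = m≤n

  -- g q² D bounds |∑ χ h|: 17² blocks, each contributing 72 q² D, for both halves of h.
  discrepancy-bound : ∀ g → g ≡ 17 * (17 * (72 + 72)) → N ≤ g * 4096 * (g * 4096) * (D * D)
  discrepancy-bound g g≡ = energy-arithmetic {q} {ρ} {T} {D} {N} g q≡16ρ (n*n≤4*triangular ρ 2≤ρ)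
    (subst (λ G → q * (ρ * (T * T)) * N ≤ q * (q * (G * G)))
      (trans (p 17 72 D (q * q)) (cong (_* (D * (q * q))) (sym g≡)))
      (ℕₚ.≤-trans energy-lower energy-upper))
    where
    p : ∀ s t D Q → s * (s * (D * (t * Q))) + s * (s * (D * (t * Q))) ≡ s * (s * (t + t)) * (D * Q)
    p = ℕ-Solver.solve-∀

-- From N ≥ 32 the exponent of q is at least 5, which gives ρ = q / 16 ≥ 2, as `n*n≤4*triangular`
-- demands.
roth-bound : ∀ {N D} (ε : ℕ → ℤ) → (∀ x → x < N → ε x ℤ.* ε x ≡ 1ℤ) → 32 ≤ N → RectangleBound N ε D →
             ∀ g → g ≡ 17 * (17 * (72 + 72)) → N ≤ g * 4096 * (g * 4096) * (D * D)
roth-bound {N} ε ε² 32≤N rectangle g g≡ with ∃-power-of-2 N (ℕₚ.≤-trans (s≤s z≤n) 32≤N)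
... | ℓ , N≤pow , pow≤2N with 5 ℕₚ.≤? ℓ
...   | no  5≰ℓ = ⊥-elim (ℕₚ.<⇒≱ (ℕₚ.^-monoʳ-< 2 (s≤s (s≤s z≤n)) (ℕₚ.≰⇒> 5≰ℓ)) (ℕₚ.≤-trans 32≤N N≤pow))
...   | yes 5≤ℓ with ℕₚ.m≤n⇒∃[o]m+o≡n 5≤ℓ
...     | k , refl = Energy.discrepancy-bound k ε ε² (ℕₚ.≤-trans (s≤s z≤n) 32≤N)
            (subst (N ≤_) double N≤pow) (subst (_≤ 2 * N) double pow≤2N) rectangle g g≡
  where
  double : 2 ^ (5 + k) ≡ 2 ^ (4 + k) + 2 ^ (4 + k)
  double = cong (_+_ (2 ^ (4 + k))) (ℕₚ.+-identityʳ (2 ^ (4 + k)))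

-- A finite list of all hyperedges.

-- Normal form of membership in a sum of two progressions; the search over i and j is bounded, hence
-- decidable.
Hit : ℤ → ℕ → ℕ → ℕ → ℕ → ℤ → Set
Hit a δ₁ δ₂ L₁ L₂ z = ∃[ i ] (i < L₁ × ∃[ j ] (j < L₂ × z ≡ a ℤ.+ + (i * δ₁ + j * δ₂)))

hit? : ∀ a δ₁ δ₂ L₁ L₂ z → Dec (Hit a δ₁ δ₂ L₁ L₂ z)
hit? a δ₁ δ₂ L₁ L₂ z =
  ℕₚ.anyUpTo? (λ i → ℕₚ.anyUpTo? (λ j → z ℤₚ.≟ a ℤ.+ + (i * δ₁ + j * δ₂)) L₂) L₁

pos-*+* : ∀ i δ₁ j δ₂ → + (i * δ₁ + j * δ₂) ≡ + i ℤ.* + δ₁ ℤ.+ + j ℤ.* + δ₂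
pos-*+* i δ₁ j δ₂ = cong₂ ℤ._+_ (ℤₚ.pos-* i δ₁) (ℤₚ.pos-* j δ₂)

⊕⇔Hit : ∀ a₁ a₂ δ₁ δ₂ L₁ L₂ z → (AP a₁ δ₁ L₁ ⊕ AP a₂ δ₂ L₂) z ⇔ Hit (a₁ ℤ.+ a₂) δ₁ δ₂ L₁ L₂ z
⊕⇔Hit a₁ a₂ δ₁ δ₂ L₁ L₂ z = mk⇔
  (λ { (_ , _ , (i , i< , refl) , (j , j< , refl) , refl) → i , i< , j , j< , regroup i j })
  (λ { (i , i< , j , j< , eq) → _ , _ , (i , i< , refl) , (j , j< , refl) , trans eq (sym (regroup i j)) })
  where
  regroup : ∀ i j → (a₁ ℤ.+ + i ℤ.* + δ₁) ℤ.+ (a₂ ℤ.+ + j ℤ.* + δ₂) ≡ a₁ ℤ.+ a₂ ℤ.+ + (i * δ₁ + j * δ₂)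
  regroup i j = trans (p a₁ a₂ (+ i ℤ.* + δ₁) (+ j ℤ.* + δ₂)) (cong (ℤ._+_ (a₁ ℤ.+ a₂)) (sym (pos-*+* i δ₁ j δ₂)))
    where
    p : ∀ a b c d → (a ℤ.+ c) ℤ.+ (b ℤ.+ d) ≡ a ℤ.+ b ℤ.+ (c ℤ.+ d)
    p = solve-∀

module _ (N : ℕ) where

  edge : ℤ → ℕ → ℕ → ℕ → ℕ → Subset N
  edge a δ₁ δ₂ L₁ L₂ = tabulate (λ x → does (hit? a δ₁ δ₂ L₁ L₂ (+ suc (toℕ x))))

  lookup-edge : ∀ a δ₁ δ₂ L₁ L₂ x → lookup (edge a δ₁ δ₂ L₁ L₂) x ≡ does (hit? a δ₁ δ₂ L₁ L₂ (+ suc (toℕ x)))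
  lookup-edge a δ₁ δ₂ L₁ L₂ x = Vecₚ.lookup∘tabulate (λ y → does (hit? a δ₁ δ₂ L₁ L₂ (+ suc (toℕ y)))) x

  edge-trace : ∀ a₁ a₂ δ₁ δ₂ L₁ L₂ → IsTrace (AP a₁ δ₁ L₁ ⊕ AP a₂ δ₂ L₂) (edge (a₁ ℤ.+ a₂) δ₁ δ₂ L₁ L₂)
  edge-trace a₁ a₂ δ₁ δ₂ L₁ L₂ x with hit? (a₁ ℤ.+ a₂) δ₁ δ₂ L₁ L₂ (+ suc (toℕ x)) | lookup-edge (a₁ ℤ.+ a₂) δ₁ δ₂ L₁ L₂ x
  ... | yes hit | eq = mk⇔ (λ _ → Equivalence.from (⊕⇔Hit a₁ a₂ δ₁ δ₂ L₁ L₂ _) hit)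
                           (λ _ → Vecₚ.lookup⇒[]= x _ eq)
  ... | no ¬hit | eq = mk⇔ (λ x∈ → ⊥-elim (true≢false (trans (sym (Vecₚ.[]=⇒lookup x∈)) eq)))
                           (λ z∈ → ⊥-elim (¬hit (Equivalence.to (⊕⇔Hit a₁ a₂ δ₁ δ₂ L₁ L₂ _) z∈)))
    where
    true≢false : true ≡ false → ⊥
    true≢false ()

  -- Only the sum of the two starting points matters, which leaves five parameters to enumerate.
  trace-unique : ∀ {E : Subset N} a₁ a₂ δ₁ δ₂ L₁ L₂ →
                 IsTrace (AP a₁ δ₁ L₁ ⊕ AP a₂ δ₂ L₂) E → E ≡ edge (a₁ ℤ.+ a₂) δ₁ δ₂ L₁ L₂
  trace-unique {E} a₁ a₂ δ₁ δ₂ L₁ L₂ tr = trans (sym (Vecₚ.tabulate∘lookup E)) (Vecₚ.tabulate-cong same)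
    where
    same : ∀ x → lookup E x ≡ does (hit? (a₁ ℤ.+ a₂) δ₁ δ₂ L₁ L₂ (+ suc (toℕ x)))
    same x with lookup E x in eq
    ... | true  = sym (dec-true (hit? (a₁ ℤ.+ a₂) δ₁ δ₂ L₁ L₂ _)
                    (Equivalence.to (⊕⇔Hit a₁ a₂ δ₁ δ₂ L₁ L₂ _) (Equivalence.to (tr x) (Vecₚ.lookup⇒[]= x E eq))))
    ... | false = sym (dec-false (hit? (a₁ ℤ.+ a₂) δ₁ δ₂ L₁ L₂ _) λ hit →
                    false≢true (trans (sym eq) (Vecₚ.[]=⇒lookup (Equivalence.from (tr x)
                      (Equivalence.from (⊕⇔Hit a₁ a₂ δ₁ δ₂ L₁ L₂ _) hit)))))
      where
      false≢true : false ≡ true → ⊥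
      false≢true ()

  edge-isEdge : ∀ a {δ₁ δ₂ L₁ L₂} → δ₁ ∈[ N ] → δ₂ ∈[ N ] → L₁ ∈[ N ] → L₂ ∈[ N ] →
                Edge (H2AP N) (edge a δ₁ δ₂ L₁ L₂)
  edge-isEdge a {δ₁} {δ₂} {L₁} {L₂} hδ₁ hδ₂ hL₁ hL₂ =
    a , 0ℤ , δ₁ , δ₂ , L₁ , L₂ , hδ₁ , hδ₂ , hL₁ , hL₂ ,
    subst (λ b → IsTrace (AP a δ₁ L₁ ⊕ AP 0ℤ δ₂ L₂) (edge b δ₁ δ₂ L₁ L₂)) (ℤₚ.+-identityʳ a) (edge-trace a 0ℤ δ₁ δ₂ L₁ L₂)

  edge-cong-empty : ∀ a a′ δ₁ δ₂ L₁ L₂ → (∀ x → ¬ Hit a δ₁ δ₂ L₁ L₂ (+ suc (toℕ {N} x))) →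
                    (∀ x → ¬ Hit a′ δ₁ δ₂ L₁ L₂ (+ suc (toℕ {N} x))) → edge a δ₁ δ₂ L₁ L₂ ≡ edge a′ δ₁ δ₂ L₁ L₂
  edge-cong-empty a a′ δ₁ δ₂ L₁ L₂ h h′ = Vecₚ.tabulate-cong λ x →
    trans (dec-false (hit? a δ₁ δ₂ L₁ L₂ _) (h x)) (sym (dec-false (hit? a′ δ₁ δ₂ L₁ L₂ _) (h′ x)))

  -- Offsets outside [- 2 N² , N + 1] give an empty trace.
  offset : ℕ → ℤ
  offset k = + k ℤ.- + (2 * (N * N))

  offsets : ℕ
  offsets = 2 * (N * N) + (N + 2)

  no-hit-high : ∀ k δ₁ δ₂ L₁ L₂ → 2 * (N * N) + suc N ≤ k → ∀ x → ¬ Hit (offset k) δ₁ δ₂ L₁ L₂ (+ suc (toℕ {N} x))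
  no-hit-high k δ₁ δ₂ L₁ L₂ high x (i , _ , j , _ , eq) = ℕₚ.<⇒≱ (s≤s (Finₚ.toℕ<n x))
    (ℕₚ.+-cancelˡ-≤ (2 * (N * N)) _ _ (ℕₚ.≤-trans high (ℕₚ.≤-trans (ℕₚ.m≤m+n k n) (ℕₚ.≤-reflexive (sym balance)))))
    where
    n = i * δ₁ + j * δ₂
    balance : 2 * (N * N) + suc (toℕ x) ≡ k + n
    balance = ℤₚ.+-injective (trans (cong (ℤ._+_ (+ (2 * (N * N)))) eq) (p (+ (2 * (N * N))) (+ k) (+ n)))
      where
      p : ∀ a k n → a ℤ.+ (k ℤ.- a ℤ.+ n) ≡ k ℤ.+ n
      p = solve-∀

  no-hit-low : ∀ a {k} δ₁ δ₂ L₁ L₂ → δ₁ ≤ N → δ₂ ≤ N → L₁ ≤ N → L₂ ≤ N → -[1+ k ] ≡ a ℤ.+ + (2 * (N * N)) →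
               ∀ x → ¬ Hit a δ₁ δ₂ L₁ L₂ (+ suc (toℕ {N} x))
  no-hit-low a {k} δ₁ δ₂ L₁ L₂ hδ₁ hδ₂ hL₁ hL₂ low x (i , i< , j , j< , eq) = ℕₚ.<⇒≱ lt n≤
    where
    n = i * δ₁ + j * δ₂
    n≤ : n ≤ 2 * (N * N)
    n≤ = ℕₚ.≤-trans (ℕₚ.+-mono-≤ (ℕₚ.*-mono-≤ (ℕₚ.≤-trans (ℕₚ.<⇒≤ i<) hL₁) hδ₁) (ℕₚ.*-mono-≤ (ℕₚ.≤-trans (ℕₚ.<⇒≤ j<) hL₂) hδ₂))
                    (ℕₚ.≤-reflexive (cong (_+_ (N * N)) (sym (ℕₚ.+-identityʳ (N * N)))))
    balance : n ≡ 2 * (N * N) + (suc (toℕ x) + suc k)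
    balance = ℤₚ.+-injective (trans (p a (+ (2 * (N * N))) (+ n))
      (cong (ℤ._+_ (+ (2 * (N * N)))) (cong₂ ℤ._+_ (sym eq) (cong ℤ.-_ (sym low)))))
      where
      p : ∀ a m n → n ≡ m ℤ.+ ((a ℤ.+ n) ℤ.+ ℤ.- (a ℤ.+ m))
      p = solve-∀
    lt : 2 * (N * N) < n
    lt = subst (2 * (N * N) <_) (sym balance) (ℕₚ.m<m+n (2 * (N * N)) (s≤s z≤n))

  -- Every starting point out of range is represented by N + 1, which is `offset top` and has empty
  -- trace too.
  clamp : ∀ a {δ₁ δ₂ L₁ L₂} → δ₁ ≤ N → δ₂ ≤ N → L₁ ≤ N → L₂ ≤ N →
          ∃[ k ] (k < offsets × edge a δ₁ δ₂ L₁ L₂ ≡ edge (offset k) δ₁ δ₂ L₁ L₂)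
  clamp a {δ₁} {δ₂} {L₁} {L₂} hδ₁ hδ₂ hL₁ hL₂ = go (a ℤ.+ + (2 * (N * N))) refl
    where
    top : ℕ
    top = 2 * (N * N) + suc N
    top< : top < offsets
    top< = ℕₚ.+-monoʳ-< (2 * (N * N)) (subst (suc N <_) (ℕₚ.+-comm 2 N) (ℕₚ.n<1+n (suc N)))
    go : ∀ z → z ≡ a ℤ.+ + (2 * (N * N)) → ∃[ k ] (k < offsets × edge a δ₁ δ₂ L₁ L₂ ≡ edge (offset k) δ₁ δ₂ L₁ L₂)
    go -[1+ k ] z≡ = top , top< , edge-cong-empty a (offset top) δ₁ δ₂ L₁ L₂
      (no-hit-low a δ₁ δ₂ L₁ L₂ hδ₁ hδ₂ hL₁ hL₂ z≡) (no-hit-high top δ₁ δ₂ L₁ L₂ ℕₚ.≤-refl)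
    go (+ k) z≡ with k ℕₚ.<? offsets
    ... | yes k< = k , k< , cong (λ b → edge b δ₁ δ₂ L₁ L₂) a≡
      where
      p : ∀ a m → a ≡ a ℤ.+ m ℤ.- m
      p = solve-∀
      a≡ : a ≡ offset k
      a≡ = trans (p a (+ (2 * (N * N)))) (cong (ℤ._- + (2 * (N * N))) (sym z≡))
    ... | no  k≮ = top , top< , subst (λ b → edge b δ₁ δ₂ L₁ L₂ ≡ edge (offset top) δ₁ δ₂ L₁ L₂) a≡
        (edge-cong-empty (offset k) (offset top) δ₁ δ₂ L₁ L₂
          (no-hit-high k δ₁ δ₂ L₁ L₂ (ℕₚ.≤-trans (ℕₚ.<⇒≤ top<) (ℕₚ.≮⇒≥ k≮))) (no-hit-high top δ₁ δ₂ L₁ L₂ ℕₚ.≤-refl))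
      where
      p : ∀ a m → a ℤ.+ m ℤ.- m ≡ a
      p = solve-∀
      a≡ : offset k ≡ a
      a≡ = trans (cong (ℤ._- + (2 * (N * N))) z≡) (p a (+ (2 * (N * N))))

  range : List ℕ
  range = map suc (upTo N)

  ∈-range⁺ : ∀ {k} → k ∈[ N ] → k ∈ range
  ∈-range⁺ {suc k} (_ , k<N) = ∈ₚ.∈-map⁺ suc (∈ₚ.∈-upTo⁺ k<N)

  ∈-range⁻ : ∀ {k} → k ∈ range → k ∈[ N ]
  ∈-range⁻ k∈ with ∈ₚ.∈-map⁻ suc k∈
  ... | k , k∈ , refl = s≤s z≤n , ∈ₚ.∈-upTo⁻ k∈

  Parameters : Set
  Parameters = ℕ × (ℕ × ℕ) × (ℕ × ℕ)

  parameters : List Parameters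
  parameters = cartesianProduct (upTo offsets) (cartesianProduct (cartesianProduct range range) (cartesianProduct range range))

  edgeOf : Parameters → Subset N
  edgeOf (k , (δ₁ , δ₂) , (L₁ , L₂)) = edge (offset k) δ₁ δ₂ L₁ L₂

  edges : List (Subset N)
  edges = map edgeOf parameters

  edges-complete : ∀ {E} → Edge (H2AP N) E → E ∈ edges
  edges-complete {E} (a₁ , a₂ , δ₁ , δ₂ , L₁ , L₂ , hδ₁ , hδ₂ , hL₁ , hL₂ , tr)
    with clamp (a₁ ℤ.+ a₂) {δ₁} {δ₂} {L₁} {L₂} (proj₂ hδ₁) (proj₂ hδ₂) (proj₂ hL₁) (proj₂ hL₂)
  ... | k , k< , eq = subst (_∈ edges) (sym (trans (trace-unique a₁ a₂ δ₁ δ₂ L₁ L₂ tr) eq))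
    (∈ₚ.∈-map⁺ edgeOf (∈ₚ.∈-cartesianProduct⁺ (∈ₚ.∈-upTo⁺ k<)
      (∈ₚ.∈-cartesianProduct⁺ (∈ₚ.∈-cartesianProduct⁺ (∈-range⁺ hδ₁) (∈-range⁺ hδ₂))
                              (∈ₚ.∈-cartesianProduct⁺ (∈-range⁺ hL₁) (∈-range⁺ hL₂)))))

  edges-sound : ∀ {E} → E ∈ edges → Edge (H2AP N) E
  edges-sound E∈ with ∈ₚ.∈-map⁻ edgeOf E∈
  ... | (k , (δ₁ , δ₂) , (L₁ , L₂)) , p∈ , refl
    with ∈ₚ.∈-cartesianProduct⁻ (upTo offsets) _ p∈
  ... | _ , p∈′ with ∈ₚ.∈-cartesianProduct⁻ (cartesianProduct range range) (cartesianProduct range range) p∈′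
  ... | δ∈ , L∈ with ∈ₚ.∈-cartesianProduct⁻ range range δ∈ | ∈ₚ.∈-cartesianProduct⁻ range range L∈
  ... | δ₁∈ , δ₂∈ | L₁∈ , L₂∈ = edge-isEdge (offset k) (∈-range⁻ δ₁∈) (∈-range⁻ δ₂∈) (∈-range⁻ L₁∈) (∈-range⁻ L₂∈)

  length-edges : length edges ≡ offsets * (N * N * (N * N))
  length-edges = trans (Listₚ.length-map edgeOf parameters)
    (trans (length-product (upTo offsets) _)
    (cong₂ _*_ (Listₚ.length-upTo offsets) (trans (length-product (cartesianProduct range range) (cartesianProduct range range))
      (cong₂ _*_ square square))))
    where
    length-product : ∀ {A B : Set} (xs : List A) (ys : List B) → length (cartesianProduct xs ys) ≡ length xs * length ys
    length-product []       ys = refl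
    length-product (x ∷ xs) ys = trans (Listₚ.length-++ (map (x ,_) ys))
      (cong₂ _+_ (Listₚ.length-map (x ,_) ys) (length-product xs ys))
    length-range : length range ≡ N
    length-range = trans (Listₚ.length-map suc (upTo N)) (Listₚ.length-upTo N)
    square : length (cartesianProduct range range) ≡ N * N
    square = trans (length-product range range) (cong₂ _*_ length-range length-range)

-- Colour sums as rectangle sums.

sum-∑ : ∀ n (f : Fin n → ℤ) (g : ℕ → ℤ) → (∀ x → f x ≡ g (toℕ x)) → sum ℤₚ.+-0-commutativeMonoid f ≡ ∑ n g
sum-∑ zero    f g h = refl
sum-∑ (suc n) f g h = trans (cong₂ ℤ._+_ (h Fin.zero) (sum-∑ n (f ∘ Fin.suc) (g ∘ suc) (h ∘ Fin.suc)))
                            (sym (∑-head n g))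

module _ {N : ℕ} where

  color : Coloring N → ℕ → ℤ
  color χ n with n ℕₚ.<? N
  ... | yes n<N = χ (fromℕ< n<N) ◃ 1
  ... | no  _   = 0ℤ

  color-toℕ : ∀ χ x → color χ (toℕ x) ≡ χ x ◃ 1
  color-toℕ χ x with toℕ x ℕₚ.<? N
  ... | yes x<N = cong (λ y → χ y ◃ 1) (Finₚ.fromℕ<-toℕ x x<N)
  ... | no  x≮N = ⊥-elim (x≮N (Finₚ.toℕ<n x))

  color² : ∀ χ x → x < N → color χ x ℤ.* color χ x ≡ 1ℤ
  color² χ x x<N with x ℕₚ.<? N
  ... | no  x≮N = ⊥-elim (x≮N x<N)
  ... | yes x<N′ with χ (fromℕ< x<N′)
  ...   | Sign.+ = refl
  ...   | Sign.- = refl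

  rectangleBound : ∀ χ {D} → (∀ E → Edge (H2AP N) E → ∣ colorSum χ E ∣ ≤ D) → RectangleBound N (color χ) D
  rectangleBound χ {D} bound X δ₁ δ₂ m n 1≤δ₁ δ₁≤N 1≤δ₂ δ₂≤N 1≤m m≤N 1≤n n≤N inj =
    subst (λ z → ∣ z ∣ ≤ D) eq (bound E (edge-isEdge N (1ℤ ℤ.+ X) (1≤δ₁ , δ₁≤N) (1≤δ₂ , δ₂≤N) (1≤m , m≤N) (1≤n , n≤N)))
    where
    E : Subset N
    -- The summand `1ℤ` passes from indices starting at 0 to vertices starting at 1.
    E = edge N (1ℤ ℤ.+ X) δ₁ δ₂ m n
    Z : ℕ → ℕ → ℤ
    Z i j = X ℤ.+ + (i * δ₁ + j * δ₂)
    multiplicity : ℕ → ℤ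
    -- The number of representations of x, which `inj` makes 0 or 1; hence the sum over the set E
    -- equals the sum over index pairs.
    multiplicity x = ∑[ i < m ] ∑[ j < n ] (δ (Z i j) x ℤ.* 1ℤ)
    to-hit : ∀ {i j x} → Z i j ≡ + x → + suc x ≡ 1ℤ ℤ.+ X ℤ.+ + (i * δ₁ + j * δ₂)
    to-hit {i} {j} Z≡x = trans (cong (ℤ._+_ 1ℤ) (sym Z≡x)) (sym (ℤₚ.+-assoc 1ℤ X (+ (i * δ₁ + j * δ₂))))
    from-hit : ∀ {i j x} → + suc x ≡ 1ℤ ℤ.+ X ℤ.+ + (i * δ₁ + j * δ₂) → Z i j ≡ + x
    from-hit {i} {j} {x} hit = trans (p X (+ (i * δ₁ + j * δ₂))) (cong (ℤ._- 1ℤ) (sym hit))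
      where
      p : ∀ a b → a ℤ.+ b ≡ 1ℤ ℤ.+ a ℤ.+ b ℤ.- 1ℤ
      p = solve-∀
    Z-injective : ∀ {i j i′ j′} → i < m → i′ < m → j < n → j′ < n → Z i j ≡ Z i′ j′ → i ≡ i′ × j ≡ j′
    Z-injective i< i′< j< j′< eq = inj i< i′< j< j′< (ℤₚ.+-injective (+-cancelˡ X _ _ eq))
    hit-or-miss : ∀ x → (if lookup E x then χ x ◃ 1 else 0ℤ) ≡ color χ (toℕ x) ℤ.* multiplicity (toℕ x)
    hit-or-miss x with hit? (1ℤ ℤ.+ X) δ₁ δ₂ m n (+ suc (toℕ x)) | lookup-edge N (1ℤ ℤ.+ X) δ₁ δ₂ m n x
    ... | yes (k , k< , l , l< , hit) | look rewrite look = sym (trans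
        (cong₂ ℤ._*_ (color-toℕ χ x) (trans (∑∑-single m n k< l< others) (trans (ℤₚ.*-identityʳ _) (δ-≡ {Z k l} Zkl≡x))))
        (ℤₚ.*-identityʳ (χ x ◃ 1)))
      where
      Zkl≡x : Z k l ≡ + toℕ x
      Zkl≡x = from-hit {k} {l} hit
      others : ∀ i j → i < m → j < n → (i ≡ k → j ≢ l) → δ (Z i j) (toℕ x) ℤ.* 1ℤ ≡ 0ℤ
      others i j i< j< ne = trans (ℤₚ.*-identityʳ _) (δ-≢ {Z i j} λ Zij≡x →
        let same = Z-injective i< k< j< l< (trans Zij≡x (sym Zkl≡x)) in ne (proj₁ same) (proj₂ same))
    ... | no ¬hit | look rewrite look = sym (trans
        (cong (ℤ._*_ (color χ (toℕ x))) (∑-0 m λ i i< → ∑-0 n λ j j< → trans (ℤₚ.*-identityʳ _)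
          (δ-≢ {Z i j} λ Zij≡x → ¬hit (i , i< , j , j< , to-hit {i} {j} Zij≡x))))
        (ℤₚ.*-zeroʳ (color χ (toℕ x))))
    eq : colorSum χ E ≡ ∑[ i < m ] ∑[ j < n ] extend N (color χ) (Z i j)
    eq = trans (sum-∑ N _ (λ x → color χ x ℤ.* multiplicity x) hit-or-miss)
      (trans (sym (∑∑-extend N (color χ) m n Z (λ _ _ → 1ℤ)))
             (∑-ext m λ i → ∑-ext n λ j → ℤₚ.*-identityʳ (extend N (color χ) (Z i j))))

-- The discrepancy exists as a minimum of maxima.

maximum : List ℕ → ℕ
maximum = foldr _⊔_ 0

maximum-upper : ∀ {x} xs → x ∈ xs → x ≤ maximum xs
maximum-upper (x ∷ xs) (here refl) = ℕₚ.m≤m⊔n x (maximum xs)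
maximum-upper (x ∷ xs) (there x∈)  = ℕₚ.≤-trans (maximum-upper xs x∈) (ℕₚ.m≤n⊔m x (maximum xs))

maximum-least : ∀ {m} xs → (∀ x → x ∈ xs → x ≤ m) → maximum xs ≤ m
maximum-least []       h = z≤n
maximum-least (x ∷ xs) h = ℕₚ.⊔-lub (h x (here refl)) (maximum-least xs (λ y y∈ → h y (there y∈)))

maximum-∈-∷ : ∀ x xs → maximum (x ∷ xs) ∈ x ∷ xs
maximum-∈-∷ x []       = here (ℕₚ.⊔-identityʳ x)
maximum-∈-∷ x (y ∷ xs) with maximum-∈-∷ y xs | ℕₚ.⊔-sel x (maximum (y ∷ xs))
... | _  | inj₁ eq = here eq
... | ih | inj₂ eq = there (subst (_∈ y ∷ xs) (sym eq) ih)

maximum-∈ : ∀ {x} xs → x ∈ xs → maximum xs ∈ xs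
maximum-∈ (x ∷ xs) _ = maximum-∈-∷ x xs

colorSum-cong : ∀ {n} {χ χ′ : Coloring n} → (∀ x → χ x ≡ χ′ x) → ∀ E → colorSum χ E ≡ colorSum χ′ E
colorSum-cong {χ = χ} {χ′} h E = sum-cong-≗ ℤₚ.+-0-commutativeMonoid
  λ x → cong (λ s → if lookup E x then s ◃ 1 else 0ℤ) (h x)

-- Functions Fin n → Sign have no extensional equality, hence the congruence hypothesis.
minimize : ∀ n (g : Coloring n → ℕ) → (∀ {χ χ′} → (∀ x → χ x ≡ χ′ x) → g χ ≡ g χ′) →
           ∃[ χ ] (∀ χ′ → g χ ≤ g χ′)
minimize zero    g g-cong = (λ ()) , λ χ′ → ℕₚ.≤-reflexive (g-cong λ ())
minimize (suc n) g g-cong = choose (best Sign.+) (best Sign.-)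
  where
  ◂-cong : ∀ s {χ χ′ : Coloring n} → (∀ x → χ x ≡ χ′ x) → ∀ x → (s ◂ χ) x ≡ (s ◂ χ′) x
  ◂-cong s h Fin.zero    = refl
  ◂-cong s h (Fin.suc x) = h x
  ◂-η : ∀ (χ : Coloring (suc n)) x → (χ Fin.zero ◂ (χ ∘ Fin.suc)) x ≡ χ x
  ◂-η χ Fin.zero    = refl
  ◂-η χ (Fin.suc x) = refl
  Best : Sign → Set
  Best s = ∃[ χ ] (∀ χ′ → g (s ◂ χ) ≤ g (s ◂ χ′))
  best : ∀ s → Best s
  best s = minimize n (g ∘ (s ◂_)) (g-cong ∘ ◂-cong s)
  choose : Best Sign.+ → Best Sign.- → ∃[ χ ] (∀ χ′ → g χ ≤ g χ′)
  choose (χ₊ , min₊) (χ₋ , min₋) with ℕₚ.≤-total (g (Sign.+ ◂ χ₊)) (g (Sign.- ◂ χ₋))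
  ... | inj₁ ≤₋ = (Sign.+ ◂ χ₊) , λ χ′ → subst (g (Sign.+ ◂ χ₊) ≤_) (g-cong (◂-η χ′)) (below (χ′ Fin.zero) (χ′ ∘ Fin.suc))
    where
    below : ∀ s χ → g (Sign.+ ◂ χ₊) ≤ g (s ◂ χ)
    below Sign.+ χ = min₊ χ
    below Sign.- χ = ℕₚ.≤-trans ≤₋ (min₋ χ)
  ... | inj₂ ≤₊ = (Sign.- ◂ χ₋) , λ χ′ → subst (g (Sign.- ◂ χ₋) ≤_) (g-cong (◂-η χ′)) (below (χ′ Fin.zero) (χ′ ∘ Fin.suc))
    where
    below : ∀ s χ → g (Sign.- ◂ χ₋) ≤ g (s ◂ χ)
    below Sign.+ χ = ℕₚ.≤-trans ≤₊ (min₊ χ)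
    below Sign.- χ = min₋ χ

module Discrepancy (N : ℕ) (1≤N : 1 ≤ N) where

  discOf : Coloring N → ℕ
  discOf χ = maximum (map (λ E → ∣ colorSum χ E ∣) (edges N))

  discOf-cong : ∀ {χ χ′} → (∀ x → χ x ≡ χ′ x) → discOf χ ≡ discOf χ′
  discOf-cong h = cong maximum (Listₚ.map-cong (λ E → cong ∣_∣ (colorSum-cong h E)) (edges N))

  private
    -- A witness that hyperedges exist: on an empty list `maximum` would be 0 without being
    -- attained.
    unit : Subset N
    unit = edge N 0ℤ 1 1 1 1
    unit∈ : unit ∈ edges N
    unit∈ = edges-complete N (edge-isEdge N 0ℤ one one one one)
      where
      one : 1 ∈[ N ]
      one = ℕₚ.≤-refl , 1≤N

  isDiscOf : ∀ χ → IsDiscOf (H2AP N) χ (discOf χ)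
  isDiscOf χ = attained , λ { k (E , e , refl) → maximum-upper _ (∈ₚ.∈-map⁺ _ (edges-complete N e)) }
    where
    attained : ∃[ E ] (Edge (H2AP N) E × discOf χ ≡ ∣ colorSum χ E ∣)
    attained with ∈ₚ.∈-map⁻ (λ E → ∣ colorSum χ E ∣)
                    (maximum-∈ _ (∈ₚ.∈-map⁺ (λ E → ∣ colorSum χ E ∣) unit∈))
    ... | E , E∈ , eq = E , edges-sound N E∈ , eq

  discOf-least : ∀ χ {t} → (∀ E → E ∈ edges N → ∣ colorSum χ E ∣ ≤ t) → discOf χ ≤ t
  discOf-least χ {t} h = maximum-least _ bound
    where
    bound : ∀ k → k ∈ map (λ E → ∣ colorSum χ E ∣) (edges N) → k ≤ t
    bound k k∈ with ∈ₚ.∈-map⁻ (λ E → ∣ colorSum χ E ∣) k∈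
    ... | E , E∈ , refl = h E E∈

  optimal : ∃[ χ ] (∀ χ′ → discOf χ ≤ discOf χ′)
  optimal = minimize N discOf discOf-cong

  isDisc : IsDisc (H2AP N) (discOf (proj₁ optimal))
  isDisc = (proj₁ optimal , isDiscOf (proj₁ optimal)) ,
    λ { k (χ , isMax) → ℕₚ.≤-trans (proj₂ optimal χ)
          (let (E , e , eq) = proj₁ (isDiscOf χ) in subst (_≤ k) (sym eq) (proj₂ isMax _ (E , e , refl))) }

-- A colouring by multiplicative weights.

total : ∀ {A : Set} → List A → (A → ℕ) → ℕ
total []       f = 0
total (x ∷ xs) f = f x + total xs f

module _ {A : Set} where

  total-cong : ∀ (xs : List A) {f g : A → ℕ} → (∀ x → f x ≡ g x) → total xs f ≡ total xs g
  total-cong []       h = refl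
  total-cong (x ∷ xs) h = cong₂ _+_ (h x) (total-cong xs h)

  total-+ : ∀ (xs : List A) (f g : A → ℕ) → total xs (λ x → f x + g x) ≡ total xs f + total xs g
  total-+ []       f g = refl
  total-+ (x ∷ xs) f g = trans (cong (_+_ (f x + g x)) (total-+ xs f g)) (p (f x) (g x) (total xs f) (total xs g))
    where
    p : ∀ a b c d → a + b + (c + d) ≡ a + c + (b + d)
    p = ℕ-Solver.solve-∀

  total-* : ∀ (xs : List A) (f : A → ℕ) k → total xs (λ x → f x * k) ≡ total xs f * k
  total-* []       f k = refl
  total-* (x ∷ xs) f k = trans (cong (_+_ (f x * k)) (total-* xs f k)) (sym (ℕₚ.*-distribʳ-+ k (f x) (total xs f)))

  total-∈ : ∀ {xs : List A} (f : A → ℕ) {x} → x ∈ xs → f x ≤ total xs f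
  total-∈ f (here refl) = ℕₚ.m≤m+n _ _
  total-∈ f (there x∈)  = ℕₚ.≤-trans (total-∈ f x∈) (ℕₚ.m≤n+m _ _)

  total-1 : ∀ (xs : List A) → total xs (λ _ → 1) ≡ length xs
  total-1 []       = refl
  total-1 (x ∷ xs) = cong suc (total-1 xs)

-- Multiplicative weights: with m = suc p, a target coordinate contributes m + 1 when the colour
-- agrees with it and m - 1 when it does not, so the average over the two colours is m.
module Weights (p : ℕ) where

  factor : Maybe Sign → Sign → ℕ
  factor nothing       _      = suc p
  factor (just Sign.+) Sign.+ = 2 + p
  factor (just Sign.+) Sign.- = p
  factor (just Sign.-) Sign.+ = p
  factor (just Sign.-) Sign.- = 2 + p

  factor-average : ∀ v → factor v Sign.+ + factor v Sign.- ≡ suc p + suc p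
  factor-average nothing       = refl
  factor-average (just Sign.+) = cong suc (sym (ℕₚ.+-suc p p))
  factor-average (just Sign.-) = ℕₚ.+-suc p (suc p)

  weight : ∀ {n} → (Fin n → Maybe Sign) → Coloring n → ℕ
  weight {zero}  v χ = 1
  weight {suc n} v χ = factor (v Fin.zero) (χ Fin.zero) * weight (v ∘ Fin.suc) (χ ∘ Fin.suc)

  -- Conditional expectations: `c` carries the factors already fixed, and since the two candidate
  -- totals average to `suc p` times the old one, the smaller of them is no larger than that.
  greedy : ∀ {A : Set} (xs : List A) n (c : A → ℕ) (v : A → Fin n → Maybe Sign) →
           ∃[ χ ] (total xs (λ x → c x * weight (v x) χ) ≤ total xs c * suc p ^ n)
  greedy     xs zero    c v = (λ ()) , ℕₚ.≤-reflexive (total-* xs c 1)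
  greedy {A} xs (suc n) c v = choose (ℕₚ.≤-total (total xs (c′ Sign.+)) (total xs (c′ Sign.-)))
    where
    c′ : Sign → A → ℕ
    c′ s x = c x * factor (v x Fin.zero) s
    average : total xs (c′ Sign.+) + total xs (c′ Sign.-) ≡ total xs c * suc p + total xs c * suc p
    average = trans (sym (total-+ xs (c′ Sign.+) (c′ Sign.-)))
      (trans (total-cong xs λ x → trans (sym (ℕₚ.*-distribˡ-+ (c x) _ _)) (cong (c x *_) (factor-average (v x Fin.zero))))
      (trans (total-* xs c (suc p + suc p)) (ℕₚ.*-distribˡ-+ (total xs c) (suc p) (suc p))))
    smaller : ∀ {a b c} → a + b ≡ c + c → a ≤ b → a ≤ c
    smaller {a} {b} {c} eq a≤b = ℕₚ.≮⇒≥ λ c<a →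
      ℕₚ.<-irrefl (sym eq) (ℕₚ.+-mono-<-≤ c<a (ℕₚ.≤-trans (ℕₚ.<⇒≤ c<a) a≤b))
    prepend : ∀ s → total xs (c′ s) ≤ total xs c * suc p →
              ∃[ χ ] (total xs (λ x → c x * weight (v x) χ) ≤ total xs c * suc p ^ suc n)
    prepend s le with greedy xs n (c′ s) (λ x → v x ∘ Fin.suc)
    ... | χ , bound = (s ◂ χ) , (begin
      total xs (λ x → c x * (factor (v x Fin.zero) s * weight (v x ∘ Fin.suc) χ))
        ≡⟨ total-cong xs (λ x → sym (ℕₚ.*-assoc (c x) (factor (v x Fin.zero) s) _)) ⟩
      total xs (λ x → c′ s x * weight (v x ∘ Fin.suc) χ)
        ≤⟨ bound ⟩
      total xs (c′ s) * suc p ^ n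
        ≤⟨ ℕₚ.*-monoˡ-≤ (suc p ^ n) le ⟩
      total xs c * suc p * suc p ^ n
        ≡⟨ ℕₚ.*-assoc (total xs c) (suc p) (suc p ^ n) ⟩
      total xs c * suc p ^ suc n ∎)
      where open ℕₚ.≤-Reasoning
    choose : total xs (c′ Sign.+) ≤ total xs (c′ Sign.-) ⊎ total xs (c′ Sign.-) ≤ total xs (c′ Sign.+) →
             ∃[ χ ] (total xs (λ x → c x * weight (v x) χ) ≤ total xs c * suc p ^ suc n)
    choose (inj₁ ≤₋) = prepend Sign.+ (smaller average ≤₋)
    choose (inj₂ ≤₊) = prepend Sign.- (smaller (trans (ℕₚ.+-comm (total xs (c′ Sign.-)) _) average) ≤₊)

  mark : ∀ {n} → Sign → Subset n → Fin n → Maybe Sign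
  mark s E x = if lookup E x then just s else nothing

  -- P, Q, R count the vertices of E coloured s, the other vertices of E, and the vertices outside E.
  Counted : Sign → ℕ → ℕ → ℤ → Set
  Counted s n W Z = ∃[ P ] ∃[ Q ] ∃[ R ]
    (P + (Q + R) ≡ n × W ≡ (2 + p) ^ P * (p ^ Q * suc p ^ R) × + Q ℤ.+ (s ◃ 1) ℤ.* Z ≡ + P)

  weight-mark : ∀ {n} s (E : Subset n) χ → Counted s n (weight (mark s E) χ) (colorSum χ E)
  weight-mark s [] χ = 0 , 0 , 0 , refl , refl , trans (ℤₚ.+-identityˡ _) (ℤₚ.*-zeroʳ (s ◃ 1))
  weight-mark s (false ∷ E) χ with weight-mark s E (χ ∘ Fin.suc)
  ... | P , Q , R , count , eq , bal =
    P , Q , suc R ,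
    trans (cong (_+_ P) (ℕₚ.+-suc Q R)) (trans (ℕₚ.+-suc P (Q + R)) (cong suc count)) ,
    trans (cong (_*_ (suc p)) eq) (q (suc p) ((2 + p) ^ P) (p ^ Q) (suc p ^ R)) ,
    trans (cong (λ z → + Q ℤ.+ (s ◃ 1) ℤ.* z) (ℤₚ.+-identityˡ (colorSum (χ ∘ Fin.suc) E))) bal
    where
    q : ∀ m a b c → m * (a * (b * c)) ≡ a * (b * (m * c))
    q = ℕ-Solver.solve-∀
  weight-mark {suc n} s (true ∷ E) χ with weight-mark s E (χ ∘ Fin.suc)
  ... | P , Q , R , count , eq , bal = extend-count s (χ Fin.zero) bal
    where
    Z : ℤ
    Z = colorSum (χ ∘ Fin.suc) E
    W : ℕ
    W = weight (mark s E) (χ ∘ Fin.suc)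
    agree : ∀ {s s′} → factor (just s) s′ ≡ 2 + p → (s ◃ 1) ℤ.* (s′ ◃ 1) ≡ 1ℤ → + Q ℤ.+ (s ◃ 1) ℤ.* Z ≡ + P →
      Counted s (suc n) (factor (just s) s′ * W) ((s′ ◃ 1) ℤ.+ Z)
    agree {s} {s′} f≡ ss′ bal = suc P , Q , R , cong suc count ,
      trans (cong₂ _*_ f≡ eq) (sym (ℕₚ.*-assoc (2 + p) ((2 + p) ^ P) _)) ,
      trans (q (+ Q) (s ◃ 1) (s′ ◃ 1) Z) (cong₂ ℤ._+_ ss′ bal)
      where
      q : ∀ a s t z → a ℤ.+ s ℤ.* (t ℤ.+ z) ≡ s ℤ.* t ℤ.+ (a ℤ.+ s ℤ.* z)
      q = solve-∀
    disagree : ∀ {s s′} → factor (just s) s′ ≡ p → (s ◃ 1) ℤ.* (s′ ◃ 1) ≡ ℤ.- 1ℤ → + Q ℤ.+ (s ◃ 1) ℤ.* Z ≡ + P →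
      Counted s (suc n) (factor (just s) s′ * W) ((s′ ◃ 1) ℤ.+ Z)
    disagree {s} {s′} f≡ ss′ bal = P , suc Q , R , trans (ℕₚ.+-suc P (Q + R)) (cong suc count) ,
      trans (cong₂ _*_ f≡ eq) (q₁ p ((2 + p) ^ P) (p ^ Q) (suc p ^ R)) ,
      trans (q₂ (+ Q) (s ◃ 1) (s′ ◃ 1) Z) 
        (trans (cong (λ u → 1ℤ ℤ.+ u ℤ.+ (+ Q ℤ.+ (s ◃ 1) ℤ.* Z)) ss′) (trans (ℤₚ.+-identityˡ _) bal))
      where
      q₁ : ∀ m a b c → m * (a * (b * c)) ≡ a * (m * b * c)
      q₁ = ℕ-Solver.solve-∀
      q₂ : ∀ a s t z → 1ℤ ℤ.+ a ℤ.+ s ℤ.* (t ℤ.+ z) ≡ 1ℤ ℤ.+ s ℤ.* t ℤ.+ (a ℤ.+ s ℤ.* z)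
      q₂ = solve-∀
    extend-count : ∀ s s′ → + Q ℤ.+ (s ◃ 1) ℤ.* Z ≡ + P →
      Counted s (suc n) (factor (just s) s′ * W) ((s′ ◃ 1) ℤ.+ Z)
    extend-count Sign.+ Sign.+ = agree {Sign.+} {Sign.+} refl refl
    extend-count Sign.+ Sign.- = disagree {Sign.+} {Sign.-} refl refl
    extend-count Sign.- Sign.+ = disagree {Sign.-} {Sign.+} refl refl
    extend-count Sign.- Sign.- = agree {Sign.-} {Sign.-} refl refl

-- Bernoulli inequalities and the discrepancy of light sets.

^-distrib-* : ∀ m n k → (m * n) ^ k ≡ m ^ k * n ^ k
^-distrib-* m n zero    = refl
^-distrib-* m n (suc k) = trans (cong (m * n *_) (^-distrib-* m n k)) (q m n (m ^ k) (n ^ k))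
  where
  q : ∀ a b c d → a * b * (c * d) ≡ a * c * (b * d)
  q = ℕ-Solver.solve-∀

-- (1 + 1 / m)^k ≥ 1 + k / m, with denominators cleared.
bernoulli : ∀ m k → (m + k) * m ^ k ≤ m * suc m ^ k
bernoulli m zero    = ℕₚ.≤-reflexive (cong (_* 1) (ℕₚ.+-identityʳ m))
bernoulli m (suc k) = begin
  (m + suc k) * (m * m ^ k)      ≡⟨ q₁ m k (m ^ k) ⟩
  (m * (m + suc k)) * m ^ k      ≤⟨ ℕₚ.*-monoˡ-≤ (m ^ k) (ℕₚ.≤-trans (ℕₚ.m≤m+n _ k) (ℕₚ.≤-reflexive (q₂ m k))) ⟩
  suc m * (m + k) * m ^ k        ≡⟨ ℕₚ.*-assoc (suc m) (m + k) (m ^ k) ⟩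
  suc m * ((m + k) * m ^ k)      ≤⟨ ℕₚ.*-monoʳ-≤ (suc m) (bernoulli m k) ⟩
  suc m * (m * suc m ^ k)        ≡⟨ q₃ m (suc m ^ k) ⟩
  m * (suc m * suc m ^ k)        ∎
  where
  open ℕₚ.≤-Reasoning
  q₁ : ∀ m k c → (m + (1 + k)) * (m * c) ≡ (m * (m + (1 + k))) * c
  q₁ = ℕ-Solver.solve-∀
  q₂ : ∀ m k → m * (m + (1 + k)) + k ≡ (1 + m) * (m + k)
  q₂ = ℕ-Solver.solve-∀
  q₃ : ∀ m c → (1 + m) * (m * c) ≡ m * ((1 + m) * c)
  q₃ = ℕ-Solver.solve-∀

growth : ∀ m .{{_ : NonZero m}} T → 2 ^ T * m ^ (m * T) ≤ suc m ^ (m * T)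
growth m T = begin
  2 ^ T * m ^ (m * T)   ≡⟨ cong (2 ^ T *_) (sym (ℕₚ.^-*-assoc m m T)) ⟩
  2 ^ T * (m ^ m) ^ T   ≡⟨ sym (^-distrib-* 2 (m ^ m) T) ⟩
  (2 * m ^ m) ^ T       ≤⟨ ℕₚ.^-monoˡ-≤ T (ℕₚ.*-cancelˡ-≤ m (subst (_≤ m * suc m ^ m) (q m (m ^ m)) (bernoulli m m))) ⟩
  (suc m ^ m) ^ T       ≡⟨ ℕₚ.^-*-assoc (suc m) m T ⟩
  suc m ^ (m * T)       ∎
  where
  open ℕₚ.≤-Reasoning
  q : ∀ m c → (m + m) * c ≡ m * (2 * c)
  q = ℕ-Solver.solve-∀

-- (1 - 1 / (y + 1))^h ≥ 1 - h / (y + 1), with denominators cleared.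
bernoulli⁻ : ∀ y h → suc y * suc y ^ h ≤ suc y * y ^ h + h * suc y ^ h
bernoulli⁻ y zero    = ℕₚ.m≤m+n _ 0
bernoulli⁻ y (suc h) = begin
  suc y * (suc y * suc y ^ h)                                ≤⟨ ℕₚ.*-monoʳ-≤ (suc y) (bernoulli⁻ y h) ⟩
  suc y * (suc y * y ^ h + h * suc y ^ h)                    ≡⟨ q₁ y h (y ^ h) (suc y ^ h) ⟩
  suc y * (y * y ^ h) + (suc y * y ^ h + h * (suc y * suc y ^ h))
    ≤⟨ ℕₚ.+-monoʳ-≤ (suc y * (y * y ^ h)) (ℕₚ.+-monoˡ-≤ (h * (suc y * suc y ^ h))
         (ℕₚ.*-monoʳ-≤ (suc y) (ℕₚ.^-monoˡ-≤ h (ℕₚ.n≤1+n y)))) ⟩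
  suc y * (y * y ^ h) + suc h * (suc y * suc y ^ h) ∎
  where
  open ℕₚ.≤-Reasoning
  q₁ : ∀ y h a b → (1 + y) * ((1 + y) * a + h * b) ≡ (1 + y) * (y * a) + ((1 + y) * a + h * ((1 + y) * b))
  q₁ = ℕ-Solver.solve-∀

halving : ∀ y h → 2 * h ≤ suc y → suc y ^ h ≤ 2 * y ^ h
halving y h 2h≤ = ℕₚ.*-cancelˡ-≤ (suc y) (ℕₚ.+-cancelʳ-≤ (suc y * suc y ^ h) _ _ (begin
  suc y * suc y ^ h + suc y * suc y ^ h                  ≤⟨ ℕₚ.+-mono-≤ (bernoulli⁻ y h) (bernoulli⁻ y h) ⟩
  (suc y * y ^ h + h * suc y ^ h) + (suc y * y ^ h + h * suc y ^ h) ≡⟨ q (suc y) (y ^ h) h (suc y ^ h) ⟩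
  suc y * (2 * y ^ h) + 2 * h * suc y ^ h                ≤⟨ ℕₚ.+-monoʳ-≤ (suc y * (2 * y ^ h)) (ℕₚ.*-monoˡ-≤ (suc y ^ h) 2h≤) ⟩
  suc y * (2 * y ^ h) + suc y * suc y ^ h                ∎))
  where
  open ℕₚ.≤-Reasoning
  q : ∀ x a h b → (x * a + h * b) + (x * a + h * b) ≡ x * (2 * a) + 2 * h * b
  q = ℕ-Solver.solve-∀

decay : ∀ y h ℓ Q → 2 * h ≤ suc y → Q ≤ h * ℓ → suc y ^ Q ≤ 2 ^ ℓ * y ^ Q
decay y h ℓ Q 2h≤ Q≤ with ℕₚ.m≤n⇒∃[o]m+o≡n Q≤
-- The exponent Q is padded by r to h ℓ, so that `halving` applies ℓ times.
... | r , Q+r≡ = ℕₚ.*-cancelʳ-≤ _ _ (suc y ^ r) {{ℕₚ.m^n≢0 (suc y) r}} (begin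
  suc y ^ Q * suc y ^ r       ≡⟨ sym (ℕₚ.^-distribˡ-+-* (suc y) Q r) ⟩
  suc y ^ (Q + r)             ≡⟨ cong (suc y ^_) Q+r≡ ⟩
  suc y ^ (h * ℓ)             ≡⟨ sym (ℕₚ.^-*-assoc (suc y) h ℓ) ⟩
  (suc y ^ h) ^ ℓ             ≤⟨ ℕₚ.^-monoˡ-≤ ℓ (halving y h 2h≤) ⟩
  (2 * y ^ h) ^ ℓ             ≡⟨ ^-distrib-* 2 (y ^ h) ℓ ⟩
  2 ^ ℓ * (y ^ h) ^ ℓ         ≡⟨ cong (2 ^ ℓ *_) (trans (ℕₚ.^-*-assoc y h ℓ)
                                   (trans (cong (y ^_) (sym Q+r≡)) (ℕₚ.^-distribˡ-+-* y Q r))) ⟩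
  2 ^ ℓ * (y ^ Q * y ^ r)     ≡⟨ sym (ℕₚ.*-assoc (2 ^ ℓ) (y ^ Q) (y ^ r)) ⟩
  2 ^ ℓ * y ^ Q * y ^ r       ≤⟨ ℕₚ.*-monoʳ-≤ (2 ^ ℓ * y ^ Q) (ℕₚ.^-monoˡ-≤ r (ℕₚ.n≤1+n y)) ⟩
  2 ^ ℓ * y ^ Q * suc y ^ r   ∎)
  where open ℕₚ.≤-Reasoning

-- Let m = `suc p`. If P > Q + m T, the weight divided by m^n is at least (1 - 1 / m²)^Q (1 + 1 /
-- m)^(m T) ≥ 2^T / 2^ℓ > K, against lightness; here Q ≤ n ≤ h ℓ and 2 h ≤ m² control the first
-- factor.
light⇒balanced : ∀ p {n h ℓ T K P Q R} → 2 * h ≤ suc p * suc p → n ≤ h * ℓ → 2 ^ ℓ * K < 2 ^ T →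
  P + (Q + R) ≡ n → (2 + p) ^ P * (p ^ Q * suc p ^ R) ≤ K * suc p ^ n → P ≤ Q + suc p * T
light⇒balanced p {n} {h} {ℓ} {T} {K} {P} {Q} {R} 2h≤ n≤ K< count light = ℕₚ.≮⇒≥ contra
  where
  m : ℕ
  m = suc p
  t : ℕ
  t = m * T
  open ℕₚ.≤-Reasoning
  contra : Q + t < P → ⊥
  contra P> with ℕₚ.m≤n⇒∃[o]m+o≡n (ℕₚ.<⇒≤ P>)
  ... | e , refl = ℕₚ.<⇒≱ K< (ℕₚ.*-cancelʳ-≤ _ _ (m ^ n) {{ℕₚ.m^n≢0 m n}} (begin
    2 ^ T * m ^ n
      ≡⟨ cong (λ k → 2 ^ T * m ^ k) (trans (sym count) (q₁ Q t e R)) ⟩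
    2 ^ T * m ^ (Q + Q + t + (e + R))
      ≡⟨ cong (2 ^ T *_) powers ⟩
    2 ^ T * ((m * m) ^ Q * m ^ t * (m ^ e * m ^ R))
      ≡⟨ q₂ (2 ^ T) ((m * m) ^ Q) (m ^ t) (m ^ e * m ^ R) ⟩
    (m * m) ^ Q * (2 ^ T * m ^ t) * (m ^ e * m ^ R)
      ≤⟨ ℕₚ.*-mono-≤ (ℕₚ.*-mono-≤ square-decay (growth m T)) (ℕₚ.*-monoˡ-≤ (m ^ R) (ℕₚ.^-monoˡ-≤ e (ℕₚ.n≤1+n m))) ⟩
    2 ^ ℓ * ((2 + p) ^ Q * p ^ Q) * (2 + p) ^ t * ((2 + p) ^ e * m ^ R)
      ≡⟨ q₃ (2 ^ ℓ) ((2 + p) ^ Q) (p ^ Q) ((2 + p) ^ t) ((2 + p) ^ e) (m ^ R) ⟩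
    2 ^ ℓ * ((2 + p) ^ Q * (2 + p) ^ t * (2 + p) ^ e * (p ^ Q * m ^ R))
      ≡⟨ cong (λ k → 2 ^ ℓ * (k * (p ^ Q * m ^ R))) (sym (trans (ℕₚ.^-distribˡ-+-* (2 + p) (Q + t) e)
           (cong (_* (2 + p) ^ e) (ℕₚ.^-distribˡ-+-* (2 + p) Q t)))) ⟩
    2 ^ ℓ * ((2 + p) ^ (Q + t + e) * (p ^ Q * m ^ R))
      ≤⟨ ℕₚ.*-monoʳ-≤ (2 ^ ℓ) light ⟩
    2 ^ ℓ * (K * m ^ n)
      ≡⟨ sym (ℕₚ.*-assoc (2 ^ ℓ) K (m ^ n)) ⟩
    2 ^ ℓ * K * m ^ n ∎))
    where
    q₁ : ∀ Q t e R → Q + t + e + (Q + R) ≡ Q + Q + t + (e + R)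
    q₁ = ℕ-Solver.solve-∀
    q₂ : ∀ a b c d → a * (b * c * d) ≡ b * (a * c) * d
    q₂ = ℕ-Solver.solve-∀
    q₃ : ∀ a b c d e f → a * (b * c) * d * (e * f) ≡ a * (b * d * e * (c * f))
    q₃ = ℕ-Solver.solve-∀
    powers : m ^ (Q + Q + t + (e + R)) ≡ (m * m) ^ Q * m ^ t * (m ^ e * m ^ R)
    powers = trans (ℕₚ.^-distribˡ-+-* m (Q + Q + t) (e + R)) (cong₂ _*_
      (trans (ℕₚ.^-distribˡ-+-* m (Q + Q) t) (cong (_* m ^ t)
        (trans (ℕₚ.^-distribˡ-+-* m Q Q) (sym (^-distrib-* m m Q)))))
      (ℕₚ.^-distribˡ-+-* m e R))
    square : suc ((2 + p) * p) ≡ m * m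
    square = q p
      where
      q : ∀ p → 1 + (2 + p) * p ≡ (1 + p) * (1 + p)
      q = ℕ-Solver.solve-∀
    square-decay : (m * m) ^ Q ≤ 2 ^ ℓ * ((2 + p) ^ Q * p ^ Q)
    square-decay = subst₂ _≤_ (cong (_^ Q) square) (cong (2 ^ ℓ *_) (^-distrib-* (2 + p) p Q))
      (decay ((2 + p) * p) h ℓ Q (subst (2 * h ≤_) (sym square) 2h≤)
        (ℕₚ.≤-trans (ℕₚ.≤-trans (ℕₚ.m≤m+n Q R) (ℕₚ.m≤n+m (Q + R) (Q + t + e))) (ℕₚ.≤-trans (ℕₚ.≤-reflexive count) n≤)))

balanced⇒abs-≤ : ∀ z {t} → (∀ s → ∃[ P ] ∃[ Q ] (P ≤ Q + t × + Q ℤ.+ (s ◃ 1) ℤ.* z ≡ + P)) → ∣ z ∣ ≤ t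
balanced⇒abs-≤ (+ n) h with h Sign.+
... | P , Q , P≤ , eq = ℕₚ.+-cancelˡ-≤ Q _ _ (ℕₚ.≤-trans (ℕₚ.≤-reflexive (ℤₚ.+-injective
  (trans (cong (ℤ._+_ (+ Q)) (sym (ℤₚ.*-identityˡ (+ n)))) eq))) P≤)
balanced⇒abs-≤ -[1+ n ] h with h Sign.-
... | P , Q , P≤ , eq = ℕₚ.+-cancelˡ-≤ Q _ _ (ℕₚ.≤-trans (ℕₚ.≤-reflexive (ℤₚ.+-injective
  (trans (cong (ℤ._+_ (+ Q)) (sym (ℤₚ.-1*i≡-i -[1+ n ]))) eq))) P≤)

-- Each set enters once with either sign, so one potential controls the excess of both colours.
low-discrepancy-coloring : ∀ {n} p (Es : List (Subset n)) {h ℓ T} →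
  2 * h ≤ suc p * suc p → n ≤ h * ℓ → 2 ^ ℓ * (2 * length Es) < 2 ^ T →
  ∃[ χ ] (∀ E → E ∈ Es → ∣ colorSum χ E ∣ ≤ suc p * T)
low-discrepancy-coloring {n} p Es {h} {ℓ} {T} 2h≤ n≤ size< = result (greedy both n (λ _ → 1) target)
  where
  open Weights p
  tag : Sign → List (Sign × Subset n)
  tag s = map (s ,_) Es
  both : List (Sign × Subset n)
  both = tag Sign.+ ++ tag Sign.-
  both-size : total both (λ _ → 1) ≡ 2 * length Es
  both-size = trans (total-1 both) (trans (Listₚ.length-++ (tag Sign.+))
    (cong₂ _+_ (tag-size Sign.+) (trans (tag-size Sign.-) (sym (ℕₚ.+-identityʳ (length Es))))))
    where
    tag-size : ∀ s → length (tag s) ≡ length Es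
    tag-size s = Listₚ.length-map (s ,_) Es
  both-∈ : ∀ s {E} → E ∈ Es → (s , E) ∈ both
  both-∈ Sign.+ E∈ = ∈ₚ.∈-++⁺ˡ (∈ₚ.∈-map⁺ _ E∈)
  both-∈ Sign.- E∈ = ∈ₚ.∈-++⁺ʳ (tag Sign.+) (∈ₚ.∈-map⁺ _ E∈)
  target : Sign × Subset n → Fin n → Maybe Sign
  target (s , E) = mark s E
  result : ∃[ χ ] (total both (λ x → 1 * weight (target x) χ) ≤ total both (λ _ → 1) * suc p ^ n) →
           ∃[ χ ] (∀ E → E ∈ Es → ∣ colorSum χ E ∣ ≤ suc p * T)
  result (χ , light) = χ , λ E E∈ → balanced⇒abs-≤ (colorSum χ E) λ s → side s E E∈
    where
    side : ∀ s E → E ∈ Es → ∃[ P ] ∃[ Q ] (P ≤ Q + suc p * T × + Q ℤ.+ (s ◃ 1) ℤ.* colorSum χ E ≡ + P)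
    side s E E∈ with weight-mark s E χ
    ... | P , Q , R , count , eq , bal = P , Q ,
      light⇒balanced p {n} {h} {ℓ} {T} {2 * length Es} {P} {Q} {R} 2h≤ n≤ size< count
        (subst (_≤ 2 * length Es * suc p ^ n) eq
          (ℕₚ.≤-trans (ℕₚ.≤-reflexive (sym (ℕₚ.*-identityˡ (weight (mark s E) χ))))
          (ℕₚ.≤-trans (total-∈ (λ x → 1 * weight (target x) χ) (both-∈ s E∈))
                      (subst (λ k → total both (λ x → 1 * weight (target x) χ) ≤ k * suc p ^ n) both-size light)))) ,
      bal

-- Parameters for the upper bound.

n<2^n : ∀ n → n < 2 ^ n
n<2^n zero    = s≤s z≤n
n<2^n (suc n) = ℕₚ.≤-<-trans (n<2^n n) (ℕₚ.m<m+n (2 ^ n) (subst (0 <_) (sym (ℕₚ.+-identityʳ (2 ^ n))) (ℕₚ.m^n>0 2 n)))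

-- `ν` is an integer square root of N / (2 ℓ), updated as N grows by one; division is avoided.
scale : ∀ ℓ → 1 ≤ ℓ → ∀ N → ∃[ ν ] (N ≤ 2 * (suc ν * suc ν) * ℓ × 2 * (ν * ν) * ℓ ≤ N)
scale ℓ 1≤ℓ zero = 0 , z≤n , z≤n
scale ℓ 1≤ℓ (suc N) with scale ℓ 1≤ℓ N
... | ν , upper , lower with suc N ℕₚ.≤? 2 * (suc ν * suc ν) * ℓ
...   | yes le  = ν , le , ℕₚ.m≤n⇒m≤1+n lower
...   | no  nle = suc ν , ℕₚ.≤-trans (s≤s upper) (ℕₚ.≤-trans (ℕₚ.+-monoˡ-≤ _ 1≤ℓ)
                        (ℕₚ.≤-trans (ℕₚ.m≤m+n _ ((4 * ν + 5) * ℓ)) (ℕₚ.≤-reflexive (p ν ℓ))))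
                      , ℕₚ.<⇒≤ (ℕₚ.≰⇒> nle)
  where
  p : ∀ ν ℓ → ℓ + 2 * ((1 + ν) * (1 + ν)) * ℓ + (4 * ν + 5) * ℓ ≡ 2 * ((2 + ν) * (2 + ν)) * ℓ
  p = ℕ-Solver.solve-∀

suc-square : ∀ ν → suc ν * suc ν ≤ 2 * (ν * ν) + 2
suc-square zero    = s≤s z≤n
suc-square (suc k) = ℕₚ.≤-trans (ℕₚ.m≤m+n _ (k * k)) (ℕₚ.≤-reflexive (p k))
  where
  p : ∀ k → (2 + k) * (2 + k) + k * k ≡ 2 * ((1 + k) * (1 + k)) + 2
  p = ℕ-Solver.solve-∀

module Upper (N : ℕ) (32≤N : 32 ≤ N) where

  private
    instance
      N≢0 : NonZero N
      N≢0 = ℕ.>-nonZero (ℕₚ.≤-trans (s≤s z≤n) 32≤N)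

    1≤N : 1 ≤ N
    1≤N = ℕₚ.≤-trans (s≤s z≤n) 32≤N

    2≤N : 2 ≤ N
    2≤N = ℕₚ.≤-trans (s≤s (s≤s z≤n)) 32≤N

    3≤N : 3 ≤ N
    3≤N = ℕₚ.≤-trans (s≤s (s≤s (s≤s z≤n))) 32≤N

    edges-few : length (edges N) ≤ N ^ 7
    edges-few = begin
      length (edges N)                                    ≡⟨ length-edges N ⟩
      (2 * (N * N) + (N + 2)) * (N * N * (N * N))         ≤⟨ ℕₚ.*-monoˡ-≤ (N * N * (N * N)) (ℕₚ.+-monoʳ-≤ (2 * (N * N)) N+2≤) ⟩
      (2 * (N * N) + N * N) * (N * N * (N * N))           ≡⟨ p₁ (N * N) ⟩
      3 * (N * N * (N * N * (N * N)))                     ≤⟨ ℕₚ.*-monoˡ-≤ _ 3≤N ⟩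
      N * (N * N * (N * N * (N * N)))                     ≡⟨ p₂ N ⟩
      N ^ 7                                               ∎
      where
      open ℕₚ.≤-Reasoning
      N+2≤ : N + 2 ≤ N * N
      N+2≤ = ℕₚ.≤-trans (ℕₚ.+-monoʳ-≤ N 2≤N) (ℕₚ.≤-trans (ℕₚ.≤-reflexive (cong (_+_ N) (sym (ℕₚ.+-identityʳ N)))) (ℕₚ.*-monoˡ-≤ N 2≤N))
      p₁ : ∀ x → (2 * x + x) * (x * x) ≡ 3 * (x * (x * x))
      p₁ = ℕ-Solver.solve-∀
      p₂ : ∀ N → N * (N * N * (N * N * (N * N))) ≡ N * (N * (N * (N * (N * (N * (N * 1))))))
      p₂ = ℕ-Solver.solve-∀

    module _ (ℓ : ℕ) (N≤pow : N ≤ 2 ^ ℓ) (pow≤2N : 2 ^ ℓ ≤ 2 * N) where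

      1≤ℓ : 1 ≤ ℓ
      1≤ℓ = ℕₚ.n≢0⇒n>0 λ { refl → ℕₚ.<⇒≱ 2≤N N≤pow }

      -- With N ≤ 2 ^ ℓ the left side costs ℓ + ℓ + 7 ℓ binary digits, so T = 10 ℓ leaves a strict
      -- margin.
      size< : 2 ^ ℓ * (2 * length (edges N)) < 2 ^ (ℓ * 10)
      size< = ℕₚ.≤-<-trans (begin
        2 ^ ℓ * (2 * length (edges N))     ≤⟨ ℕₚ.*-monoʳ-≤ (2 ^ ℓ) (ℕₚ.*-monoʳ-≤ 2 (ℕₚ.≤-trans edges-few (ℕₚ.^-monoˡ-≤ 7 N≤pow))) ⟩
        2 ^ ℓ * (2 * (2 ^ ℓ) ^ 7)          ≤⟨ ℕₚ.*-monoʳ-≤ (2 ^ ℓ) (ℕₚ.*-monoˡ-≤ ((2 ^ ℓ) ^ 7) (ℕₚ.≤-trans 2≤N N≤pow)) ⟩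
        (2 ^ ℓ) ^ 9                        ≡⟨ ℕₚ.^-*-assoc 2 ℓ 9 ⟩
        2 ^ (ℓ * 9)                        ∎)
        (ℕₚ.^-monoʳ-< 2 (s≤s (s≤s z≤n)) (ℕₚ.*-monoʳ-< ℓ {{ℕ.>-nonZero 1≤ℓ}} (ℕₚ.n<1+n 9)))
        where open ℕₚ.≤-Reasoning

      -- The squared quantity is m T with m = 2 (ν + 1) and T = 10 ℓ; the factor 5 in κ comes from
      -- (ν + 1)² ℓ ≤ N + 2 ℓ ≤ 5 N.
      small : ∀ {ν} κ → 2 * (ν * ν) * ℓ ≤ N → κ ≡ 20 * (20 * 5) →
              2 * suc ν * (ℓ * 10) * (2 * suc ν * (ℓ * 10)) ≤ ℓ * (κ * N)
      small {ν} κ lower refl = begin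
        2 * suc ν * (ℓ * 10) * (2 * suc ν * (ℓ * 10))  ≡⟨ p₁ (suc ν) ℓ ⟩
        ℓ * (20 * (20 * (suc ν * suc ν * ℓ)))          ≤⟨ ℕₚ.*-monoʳ-≤ ℓ (ℕₚ.*-monoʳ-≤ 20 (ℕₚ.*-monoʳ-≤ 20 five)) ⟩
        ℓ * (20 * (20 * (5 * N)))                      ≡⟨ cong (_*_ ℓ) (p₂ 20 5 N) ⟩
        ℓ * (20 * (20 * 5) * N)                        ∎
        where
        open ℕₚ.≤-Reasoning
        p₁ : ∀ μ ℓ → 2 * μ * (ℓ * 10) * (2 * μ * (ℓ * 10)) ≡ ℓ * (20 * (20 * (μ * μ * ℓ)))
        p₁ = ℕ-Solver.solve-∀
        p₂ : ∀ a b N → a * (a * (b * N)) ≡ a * (a * b) * N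
        p₂ = ℕ-Solver.solve-∀
        p₃ : ∀ x ℓ → (x + 2) * ℓ ≡ x * ℓ + 2 * ℓ
        p₃ = ℕ-Solver.solve-∀
        p₄ : ∀ N → N + 2 * (2 * N) ≡ 5 * N
        p₄ = ℕ-Solver.solve-∀
        five : suc ν * suc ν * ℓ ≤ 5 * N
        five = begin
          suc ν * suc ν * ℓ          ≤⟨ ℕₚ.*-monoˡ-≤ ℓ (suc-square ν) ⟩
          (2 * (ν * ν) + 2) * ℓ      ≡⟨ p₃ (2 * (ν * ν)) ℓ ⟩
          2 * (ν * ν) * ℓ + 2 * ℓ    ≤⟨ ℕₚ.+-mono-≤ lower (ℕₚ.*-monoʳ-≤ 2 (ℕₚ.≤-trans (ℕₚ.<⇒≤ (n<2^n ℓ)) pow≤2N)) ⟩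
          N + 2 * (2 * N)            ≡⟨ p₄ N ⟩
          5 * N                      ∎

      -- 2 ^ ℓ ≤ 2 N ≤ N² changes the base from 2 to N at the price of doubling κ.
      exponentiate : ∀ {t} κ → t * t ≤ ℓ * (κ * N) → 2 ^ (t * t) ≤ N ^ ((κ + κ) * N)
      exponentiate {t} κ le = begin
        2 ^ (t * t)              ≤⟨ ℕₚ.^-monoʳ-≤ 2 le ⟩
        2 ^ (ℓ * (κ * N))        ≡⟨ sym (ℕₚ.^-*-assoc 2 ℓ (κ * N)) ⟩
        (2 ^ ℓ) ^ (κ * N)        ≤⟨ ℕₚ.^-monoˡ-≤ (κ * N) (ℕₚ.≤-trans pow≤2N (ℕₚ.*-monoˡ-≤ N 2≤N)) ⟩
        (N * N) ^ (κ * N)        ≡⟨ ^-distrib-* N N (κ * N) ⟩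
        N ^ (κ * N) * N ^ (κ * N) ≡⟨ sym (ℕₚ.^-distribˡ-+-* N (κ * N) (κ * N)) ⟩
        N ^ (κ * N + κ * N)      ≡⟨ cong (N ^_) (sym (ℕₚ.*-distribʳ-+ N κ κ)) ⟩
        N ^ ((κ + κ) * N)        ∎
        where open ℕₚ.≤-Reasoning

      coloring : ∀ κ → κ ≡ 20 * (20 * 5) →
                 ∃[ χ ] ∃[ t ] ((∀ E → E ∈ edges N → ∣ colorSum χ E ∣ ≤ t) × 2 ^ (t * t) ≤ N ^ ((κ + κ) * N))
      coloring κ κ≡ = from-scale (scale ℓ 1≤ℓ N)
        where
        p : ∀ μ → 2 * (2 * (μ * μ)) ≡ 2 * μ * (2 * μ)
        p = ℕ-Solver.solve-∀
        from-scale : ∃[ ν ] (N ≤ 2 * (suc ν * suc ν) * ℓ × 2 * (ν * ν) * ℓ ≤ N) →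
          ∃[ χ ] ∃[ t ] ((∀ E → E ∈ edges N → ∣ colorSum χ E ∣ ≤ t) × 2 ^ (t * t) ≤ N ^ ((κ + κ) * N))
        from-scale (ν , upper , lower) =
          -- This argument makes `suc p` equal to `2 * suc ν` by computation.
          let (χ , bound) = low-discrepancy-coloring (ν + (suc ν + 0)) (edges N)
                              {2 * (suc ν * suc ν)} {ℓ} {ℓ * 10} (ℕₚ.≤-reflexive (p (suc ν))) upper size<
          in χ , 2 * suc ν * (ℓ * 10) , bound , exponentiate {2 * suc ν * (ℓ * 10)} κ (small {ν} κ lower κ≡)

  upper-coloring : ∀ κ → κ ≡ 20 * (20 * 5) →
                   ∃[ χ ] ∃[ t ] ((∀ E → E ∈ edges N → ∣ colorSum χ E ∣ ≤ t) × 2 ^ (t * t) ≤ N ^ ((κ + κ) * N))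
  upper-coloring κ κ≡ = let (ℓ , N≤pow , pow≤2N) = ∃-power-of-2 N 1≤N in coloring ℓ N≤pow pow≤2N κ κ≡

-- The constants and the two bounds together.

-- `mkℚ` takes the denominator minus one: 170459136 = 41616 · 4096 with 41616 = 17² · 144. The value
-- 64 is chosen because 64² = 4096 exceeds κ + κ = 4000.
lowerConstant upperConstant : ℚ
lowerConstant = mkℚ (+ 1) 170459135 (Coprimality.1-coprimeTo 170459136)
upperConstant = mkℚ (+ 64) 0 (Coprimality.sym (Coprimality.1-coprimeTo 64))

-- Stated for abstract constants: a product with a large literal would be unfolded in unary.
lower-form : ∀ c N d g → ∣ ↥ c ∣ ≡ 1 → ↧ₙ c ≡ g * 4096 → N ≤ g * 4096 * (g * 4096) * (d * d) → c ·√ N ≤ d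
lower-form c N d g num den le = subst₂ (λ p q → p * p * N ≤ q * q * (d * d)) (sym num) (sym den)
  (ℕₚ.≤-trans (ℕₚ.≤-reflexive (ℕₚ.*-identityˡ N)) le)

upper-form : ∀ C N .{{_ : NonZero N}} t d κ → κ + κ ≤ ∣ ↥ C ∣ * ∣ ↥ C ∣ → ↧ₙ C ≡ 1 → d ≤ t →
             2 ^ (t * t) ≤ N ^ ((κ + κ) * N) → d ≤ C ·√[ N ·log₂ N ]
upper-form C N t d κ num den d≤t le = subst (λ q → 2 ^ (q * q * (d * d)) ≤ N ^ (∣ ↥ C ∣ * ∣ ↥ C ∣ * N)) (sym den) (begin
  2 ^ (1 * (d * d))                  ≡⟨ cong (2 ^_) (ℕₚ.*-identityˡ (d * d)) ⟩
  2 ^ (d * d)                        ≤⟨ ℕₚ.^-monoʳ-≤ 2 (ℕₚ.*-mono-≤ d≤t d≤t) ⟩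
  2 ^ (t * t)                        ≤⟨ le ⟩
  N ^ ((κ + κ) * N)                  ≤⟨ ℕₚ.^-monoʳ-≤ N (ℕₚ.*-monoˡ-≤ N num) ⟩
  N ^ (∣ ↥ C ∣ * ∣ ↥ C ∣ * N)        ∎)
  where open ℕₚ.≤-Reasoning

disc-bounds : ∀ g κ c C → g ≡ 17 * (17 * (72 + 72)) → κ ≡ 20 * (20 * 5) →
              ∣ ↥ c ∣ ≡ 1 → ↧ₙ c ≡ g * 4096 → κ + κ ≤ ∣ ↥ C ∣ * ∣ ↥ C ∣ → ↧ₙ C ≡ 1 →
              ∀ N → 32 ≤ N → ∃[ d ] (IsDisc (H2AP N) d × (c ·√ N ≤ d) × (d ≤ C ·√[ N ·log₂ N ]))
disc-bounds g κ c C g≡ κ≡ c-num c-den C-num C-den N 32≤N = d , isDisc , lower , upper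
  where
  1≤N : 1 ≤ N
  1≤N = ℕₚ.≤-trans (s≤s z≤n) 32≤N
  open Discrepancy N 1≤N
  χ₀ : Coloring N
  χ₀ = proj₁ optimal
  d : ℕ
  d = discOf χ₀
  lower : c ·√ N ≤ d
  lower = lower-form c N d g c-num c-den (roth-bound (color χ₀) (color² χ₀) 32≤N
    (rectangleBound χ₀ λ E e → proj₂ (isDiscOf χ₀) _ (E , e , refl)) g g≡)
  upper : d ≤ C ·√[ N ·log₂ N ]
  upper = let (χ , t , bound , le) = Upper.upper-coloring N 32≤N κ κ≡ in
    upper-form C N {{ℕ.>-nonZero 1≤N}} t d κ C-num C-den (ℕₚ.≤-trans (proj₂ optimal χ) (discOf-least χ bound)) le

theorem1 : ∃[ c ] ∃[ C ] ∃[ N₀ ] (0ℚ ℚ.< c × 0ℚ ℚ.< C × ((N : ℕ) → N₀ ≤ N → ∃[ d ] (IsDisc (H2AP N) d × (c ·√ N ≤ d) × (d ≤ C ·√[ N ·log₂ N ]))))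
theorem1 = lowerConstant , upperConstant , 32 , ℚₚ.positive⁻¹ lowerConstant , ℚₚ.positive⁻¹ upperConstant ,
  disc-bounds 41616 2000 lowerConstant upperConstant refl refl refl refl (ℕₚ.m≤m+n 4000 96) refl
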